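{- For all integers $k\ge 3$ and $n\ge 0$, \begin{align*} c\phi_{3}\Big(3^{2k}n+\tfrac{7\cdot 3^{2k}+1}{8} \Big) &\equiv 0 \pmod{3^{4k+5}},\\ c\phi_{3}\Big(3^{2k+1}n+\tfrac{5\cdot 3^{2k+1}+1}{8} \Big) &\equiv 0 \pmod{3^{4k+6}},\\ c\phi_{3}\Big(3^{2k+1}n+\tfrac{23\cdot 3^{2k}+1}{8}\Big) &\equiv 0 \pmod{3^{4k+7}},\\ c\phi_{3}\Big(3^{2k+2}n+\tfrac{13\cdot 3^{2k+1}+1}{8}\Big) &\equiv 0 \pmod{3^{4k+8}}. \end{align*}
   Context: For a positive integer $k$, color each nonnegative integer with each of $k$ colors $1,\dots,k$, writing $a_c$ for $a$ with color $c$, and order colored integers by $0_1\prec 0_2\prec\cdots\prec 0_k\prec 1_1\prec\cdots\prec 1_k\prec 2_1\prec\cdots$. A $k$-colored generalized Frobenius partition of $n$ is a two-row array $\begin{pmatrix} a_1,\dots,a_r\\ b_1,\dots,b_r\end{pmatrix}$ of colored integers with $a_r\prec a_{r-1}\prec\cdots\prec a_1$ and $b_r\prec\cdots\prec b_1$ and $n=r+\sum_{i=1}^r(a_i+b_i)$ (the sum using the underlying integers). $c\phi_k(n)$ denotes the number of $k$-colored generalized Frobenius partitions of $n$. Equivalently, $\sum_{n\ge0}c\phi_k(n)q^n=\frac{1}{(q;q)_\infty^k}\sum_{m_1,\dots,m_{k-1}\in\mathbb{Z}}q^{\sum_i m_i^2+\sum_{i<j}m_im_j}$, where $(q;q)_\infty=\prod_{n\ge1}(1-q^n)$.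 -}

module Defs where

open import Data.Nat using (ℕ; zero; suc; _+_; _*_; _∸_; _≤?_)
open import Data.Integer as ℤ using (ℤ; +_)
open import Data.List using (List; []; _∷_; map; upTo; length; filter; cartesianProduct)
open import Data.Product using (_×_; _,_; proj₁; proj₂)
open import Data.Bool using (if_then_else_)
open import Relation.Nullary using (does)

Σ≤ : ℕ → (ℕ → ℕ) → ℕ
Σ≤ zero    f = f 0
Σ≤ (suc n) f = Σ≤ n f + f (suc n)

-- pBounded m n = number of partitions of n into parts of size at most m
-- (recursion on the multiplicity j of the largest allowed part m)
pBounded : ℕ → ℕ → ℕ
pBounded zero    zero    = 1
pBounded zero    (suc n) = 0
pBounded (suc m) n =
  Σ≤ n (λ j → if does (j * suc m ≤? n) then pBounded m (n ∸ j * suc m) else 0)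

-- p n = number of partitions of n; Σ p(n) qⁿ = 1/(q;q)_∞
p : ℕ → ℕ
p n = pBounded n n

-- coefficients of 1/(q;q)_∞³
p3 : ℕ → ℕ
p3 n = Σ≤ n (λ i → Σ≤ (n ∸ i) (λ j → p i * p j * p (n ∸ i ∸ j)))

intRange : ℕ → List ℤ
intRange n = map (λ i → (+ i) ℤ.- (+ n)) (upTo (2 * n + 1))

-- quadratic form m₁² + m₂² + m₁m₂ (the exponent for k = 3)
Q : ℤ → ℤ → ℤ
Q m₁ m₂ = m₁ ℤ.* m₁ ℤ.+ m₂ ℤ.* m₂ ℤ.+ m₁ ℤ.* m₂

-- θ n = #{(m₁,m₂) ∈ ℤ² : Q m₁ m₂ = n}.  Any solution has |m₁|,|m₂| ≤ n,
-- so enumerating the box [-n,n]² counts all of them.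
θ : ℕ → ℕ
θ n = length (filter (λ pr → Q (proj₁ pr) (proj₂ pr) ℤ.≟ + n)
                     (cartesianProduct (intRange n) (intRange n)))

-- cφ₃ n : coefficient of qⁿ in (1/(q;q)_∞³) Σ_{m₁,m₂∈ℤ} q^{m₁²+m₂²+m₁m₂}
cφ3 : ℕ → ℕ
cφ3 n = Σ≤ n (λ i → θ i * p3 (n ∸ i))

{-# OPTIONS --safe #-}
{-
Write E = (q;q)_∞, V f = f(q³), and let a = Σ q^Q be the theta function of the hexagonal lattice, so that the generating
function of cφ₃ is a / E³.

For a primitive cube root of unity ω, the product of the Jacobi theta functions ϑ(x; q), ϑ(ωx; q), ϑ(ω²x; q) is a multiple
of ϑ(x³; q³).  Comparing constant terms in x gives Σ ω^(k−m) q^Q(k,m) = E³ / V E =: b.  Sorting the lattice by the class of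
k − m mod 3 gives a = A + 2C and b = A − C with A = V a.  The norm with respect to q ↦ ωq turns the second identity into
A³ − C³ = V b³; together these give a³ = b³ + qκ³ where C = q V κ, and a functional equation κ³ b = 9 V κ V b³ whose only
solution with the right constant term is κ = 3 (V E)³ / E.

Let x = a³/b³ − 1, y = a/b − 1 and X = V x.  Then x = y³ + 3y² + 3y and y³ = 9X(y² + 3y + 3), so that ℤ[x, y] is spanned
by 1, y, y² over ℤ[X], and extracting the coefficients of q^(3n+2) is explicit on this basis.  It maps
Godd ℤ[x] into 81 Geven ℤ[x], and after a shift Geven ℤ[x] into 3 Godd ℤ[x], for two explicit series Godd and Geven.
Starting from 27 Godd this yields divisibility by 3^(5k+3) along the progression of modulus 3^(2k+1) and by 3^(5k+2) along
the one of modulus 3^(2k); expanding Godd and Geven mod 9 gives a further factor 3² on the subprogressions.  For k ≥ 3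
these exponents are at least those claimed.
-}
module Submission where

open import Defs
open import Algebra.Bundles using (CommutativeRing)
open import Data.Bool using (true; false; if_then_else_)
open import Data.Empty using (⊥; ⊥-elim)
open import Data.Integer as ℤ using (ℤ; +_; -[1+_]; _⊖_; _◃_; ∣_∣)
import Data.Integer.Divisibility.Signed as ℤ∣
import Data.Integer.Properties as ℤₚ
open import Data.Integer.Tactic.RingSolver using (solve-∀)
open import Data.List using (List; map; _++_; filter; length; applyUpTo; cartesianProduct)
open import Data.List.Membership.Propositional using (_∈_)
open import Data.List.Membership.Propositional.Properties using (∈-map⁺; ∈-map⁻; ∈-filter⁺; ∈-filter⁻; ∈-upTo⁺; ∈-cartesianProduct⁺)
open import Data.List.Membership.Propositional.Properties.WithK using (unique∧set⇒bag)
import Data.List.Properties as Listₚ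
open import Data.List.Relation.Binary.BagAndSetEquality using (∼bag⇒↭)
open import Data.List.Relation.Binary.Permutation.Propositional.Properties using (↭-length)
open import Data.List.Relation.Unary.Unique.Propositional using (Unique)
import Data.List.Relation.Unary.Unique.Propositional.Properties as Unique
open import Data.Maybe using (Maybe; just; nothing)
open import Data.Nat as ℕ using (ℕ; zero; suc; z≤n; s≤s; _≤?_)
import Data.Nat.Divisibility as ℕ∣
open import Data.Nat.DivMod using (_%_; _/_; m≡m%n+[m/n]*n; m%n<n; m*n/n≡m; +-distrib-/-∣ˡ)
open import Data.Nat.Primality using (prime?; euclidsLemma)
import Data.Nat.Properties as ℕₚ
import Data.Nat.Tactic.RingSolver as ℕ-Solver
open import Data.Product using (_×_; _,_; ∃; proj₁; proj₂)
open import Data.Product.Properties using (,-injective)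
open import Data.Sign as Sign using (Sign)
open import Data.Sum using (inj₁; inj₂; [_,_]′)
open import Function using (mk⇔)
open import Level using (0ℓ)
open import Relation.Binary.PropositionalEquality as ≡ using (_≡_)
open import Relation.Nullary using (¬_; Dec; yes; no; does)
open import Relation.Nullary.Decidable using (dec-true; dec-false; from-yes; from-no)
open import Relation.Unary using (Decidable)
open import Algebra.Properties.AbelianGroup ℤₚ.+-0-abelianGroup using () renaming (∙-cancelʳ to +-cancelʳ)

-- Coefficients lie in ℤ[ω], since the rotations by ω need it; 2 and 3 are only cancelled, never
-- inverted, and divisibility returns to ℤ at the very end by comparing coordinates. Limits are
-- avoided as well: each coefficient of (q;q)_∞ is read off a finite product, and Jacobi's product
-- is kept finite and multiplied by a power of its variable that clears negative exponents.
--
-- The two prefactors are forced by the eta quotients. As b/E³ = 1/V E, the generating function is u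
-- / V E with u = a/b, and the denominator, a series in q³, passes through any extraction. Class 2
-- of u is 27 a l²/b³ with l = (V E)³/E; divided by E it is 27 Godd. Likewise 3 Godd is u z times a
-- series in q³, where z = y² + 3y + 3, and its class 2 is a multiple of Geven. Finally 27 q Geven
-- is x a/E³, so the initial situation recurs with an additional factor x. The powers of 3 stem from
-- the cubic relation for y: on the basis 1, y, y² it makes x divisible by 3 and x z divisible by 9.

-- Ring normalisation with integer coefficients

module IntegerSolver (K : CommutativeRing 0ℓ 0ℓ) where
  open CommutativeRing K
  open import Algebra.Properties.Ring ring
  open import Algebra.Properties.AbelianGroup +-abelianGroup using (⁻¹-∙-comm; ⁻¹-involutive; ε⁻¹≈ε)
  open import Algebra.Properties.Semiring.Mult.TCOptimised semiring using (×-homo-+; ×1-homo-*) renaming (_×_ to _×ₙ_)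
  open import Algebra.Properties.CommutativeSemigroup +-commutativeSemigroup using (interchange)
  open import Relation.Binary.Reasoning.Setoid setoid
  import Algebra.Solver.Ring.AlmostCommutativeRing as ACR

  -- This variant of repeated addition makes `nat 0` and `nat 1` compute to `0#` and `1#`, so that
  -- the numerals of the solver match these literals by definition.
  nat : ℕ → Carrier
  nat n = n ×ₙ 1#

  nat-suc : ∀ n → nat (suc n) ≈ 1# + nat n
  nat-suc n = ×-homo-+ 1# 1 n

  nat-+ : ∀ m n → nat (m ℕ.+ n) ≈ nat m + nat n
  nat-+ = ×-homo-+ 1#

  nat-* : ∀ m n → nat (m ℕ.* n) ≈ nat m * nat n
  nat-* = ×1-homo-*

  private
    int : ℤ → Carrier
    int (+ n)    = nat n
    int -[1+ n ] = - nat (suc n)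

    int-⊖ : ∀ m n → int (m ⊖ n) ≈ nat m - nat n
    int-⊖ m zero = begin
      nat m         ≈⟨ +-identityʳ _ ⟨
      nat m + 0#    ≈⟨ +-congˡ ε⁻¹≈ε ⟨
      nat m - 0#    ∎
    int-⊖ zero (suc n) = sym (+-identityˡ _)
    int-⊖ (suc m) (suc n) = begin
      int (suc m ⊖ suc n)              ≡⟨ ≡.cong int (ℤₚ.[1+m]⊖[1+n]≡m⊖n m n) ⟩
      int (m ⊖ n)                      ≈⟨ int-⊖ m n ⟩
      nat m - nat n                    ≈⟨ +-identityˡ _ ⟨
      0# + (nat m - nat n)             ≈⟨ +-congʳ (-‿inverseʳ 1#) ⟨
      (1# - 1#) + (nat m - nat n)      ≈⟨ interchange 1# (- 1#) (nat m) (- nat n) ⟩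
      (1# + nat m) + (- 1# - nat n)    ≈⟨ +-cong (sym (nat-suc m)) (⁻¹-∙-comm 1# (nat n)) ⟩
      nat (suc m) - (1# + nat n)       ≈⟨ +-congˡ (-‿cong (nat-suc n)) ⟨
      nat (suc m) - nat (suc n)        ∎

    int-+ : ∀ i j → int (i ℤ.+ j) ≈ int i + int j
    int-+ (+ m) (+ n) = ×-homo-+ 1# m n
    int-+ (+ m) -[1+ n ] = int-⊖ m (suc n)
    int-+ -[1+ m ] (+ n) = trans (int-⊖ n (suc m)) (+-comm _ _)
    int-+ -[1+ m ] -[1+ n ] = begin
      - nat (suc (suc (m ℕ.+ n)))      ≡⟨ ≡.cong (λ k → - nat (suc k)) (ℕₚ.+-suc m n) ⟨
      - nat (suc m ℕ.+ suc n)          ≈⟨ -‿cong (×-homo-+ 1# (suc m) (suc n)) ⟩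
      - (nat (suc m) + nat (suc n))    ≈⟨ ⁻¹-∙-comm _ _ ⟨
      - nat (suc m) - nat (suc n)      ∎

    int-neg : ∀ i → int (ℤ.- i) ≈ - int i
    int-neg (+ zero)  = sym ε⁻¹≈ε
    int-neg (+ suc n) = refl
    int-neg -[1+ n ]  = sym (⁻¹-involutive _)

    int-neg◃ : ∀ n → int (Sign.- ◃ n) ≈ - nat n
    int-neg◃ zero    = sym ε⁻¹≈ε
    int-neg◃ (suc n) = refl

    int-* : ∀ i j → int (i ℤ.* j) ≈ int i * int j
    int-* (+ m) (+ n) = begin
      int (Sign.+ ◃ m ℕ.* n)  ≡⟨ ≡.cong int (ℤₚ.+◃n≡+n (m ℕ.* n)) ⟩
      nat (m ℕ.* n)           ≈⟨ ×1-homo-* m n ⟩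
      nat m * nat n           ∎
    int-* (+ m) -[1+ n ] = begin
      int (Sign.- ◃ m ℕ.* suc n)  ≈⟨ int-neg◃ (m ℕ.* suc n) ⟩
      - nat (m ℕ.* suc n)         ≈⟨ -‿cong (×1-homo-* m (suc n)) ⟩
      - (nat m * nat (suc n))     ≈⟨ -‿distribʳ-* _ _ ⟩
      nat m * - nat (suc n)       ∎
    int-* -[1+ m ] (+ n) = begin
      int (Sign.- ◃ suc m ℕ.* n)  ≈⟨ int-neg◃ (suc m ℕ.* n) ⟩
      - nat (suc m ℕ.* n)         ≈⟨ -‿cong (×1-homo-* (suc m) n) ⟩
      - (nat (suc m) * nat n)     ≈⟨ -‿distribˡ-* _ _ ⟩
      - nat (suc m) * nat n       ∎
    int-* -[1+ m ] -[1+ n ] = begin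
      nat (suc m ℕ.* suc n)              ≈⟨ ×1-homo-* (suc m) (suc n) ⟩
      nat (suc m) * nat (suc n)          ≈⟨ ⁻¹-involutive _ ⟨
      - - (nat (suc m) * nat (suc n))    ≈⟨ -‿cong (-‿distribʳ-* _ _) ⟩
      - (nat (suc m) * - nat (suc n))    ≈⟨ -‿distribˡ-* _ _ ⟩
      - nat (suc m) * - nat (suc n)      ∎

    morphism : CommutativeRing.rawRing ℤₚ.+-*-commutativeRing
               ACR.-Raw-AlmostCommutative⟶ ACR.fromCommutativeRing K
    morphism = record
      { ⟦_⟧    = int
      ; +-homo = int-+
      ; *-homo = int-*
      ; -‿homo = int-neg
      ; 0-homo = refl
      ; 1-homo = refl
      }

    -- A semi-decision suffices: distinct integers may coincide in `K`, and then the solver merely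
    -- misses a cancellation.
    int-≟ : ∀ i j → Maybe (int i ≈ int j)
    int-≟ i j with i ℤ.≟ j
    ... | yes i≡j = just (reflexive (≡.cong int i≡j))
    ... | no  _   = nothing

  open import Algebra.Solver.Ring _ _ morphism int-≟ public
    using (Polynomial; solve; _:=_; _:+_; _:*_; _:-_; :-_; _:^_; con)

  :nat : ∀ {n} → ℕ → Polynomial n
  :nat k = con (+ k)

-- Formal power series

module PowerSeries (K : CommutativeRing 0ℓ 0ℓ) where
  open CommutativeRing K
  open import Algebra.Properties.CommutativeSemigroup +-commutativeSemigroup using (interchange)
  open import Algebra.Properties.Semiring.Exp semiring using (_^_; ^-homo-*)
  open import Relation.Binary.Reasoning.Setoid setoid

  Series : Set
  Series = ℕ → Carrier

  infix 4 _≋_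
  -- The record keeps `f` and `g` recoverable by unification, which a bare pointwise statement would
  -- not.
  record _≋_ (f g : Series) : Set where
    constructor pointwise
    field at : ∀ n → f n ≈ g n
  open _≋_ public

  tail : Series → Series
  tail f n = f (suc n)

  const : Carrier → Series
  const c zero    = c
  const c (suc _) = 0#

  var : Series
  var zero          = 0#
  var (suc zero)    = 1#
  var (suc (suc _)) = 0#

  infixl 6 _⊕_
  _⊕_ : Series → Series → Series
  (f ⊕ g) n = f n + g n

  infixr 7 _·_
  _·_ : Carrier → Series → Series
  (c · f) n = c * f n

  infixl 7 _⊛_
  -- The Cauchy product in the form f g = f(0) g + X (tail f) g, so that the ring laws follow by
  -- induction on the exponent instead of by manipulating double sums.
  _⊛_ : Series → Series → Series
  (f ⊛ g) zero    = f 0 * g 0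
  (f ⊛ g) (suc n) = f 0 * g (suc n) + (tail f ⊛ g) n

  -- Coefficient `n` of a product sees only coefficients up to `n`. This bounded form is what lets
  -- finite truncations stand for infinite products.
  ⊛-congᵇ : ∀ {f f′ g g′} n → (∀ m → m ℕ.≤ n → f m ≈ f′ m) → (∀ m → m ℕ.≤ n → g m ≈ g′ m) →
            (f ⊛ g) n ≈ (f′ ⊛ g′) n
  ⊛-congᵇ zero    p q = *-cong (p 0 z≤n) (q 0 z≤n)
  ⊛-congᵇ (suc n) p q =
    +-cong (*-cong (p 0 z≤n) (q (suc n) ℕₚ.≤-refl))
           (⊛-congᵇ n (λ m m≤n → p (suc m) (s≤s m≤n)) (λ m m≤n → q m (ℕₚ.m≤n⇒m≤1+n m≤n)))

  ⊛-cong : ∀ {f f′ g g′} → f ≋ f′ → g ≋ g′ → f ⊛ g ≋ f′ ⊛ g′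
  ⊛-cong p q .at n = ⊛-congᵇ n (λ m _ → at p m) (λ m _ → at q m)

  ⊛-zeroˡ : ∀ g n → ((λ _ → 0#) ⊛ g) n ≈ 0#
  ⊛-zeroˡ g zero    = zeroˡ _
  ⊛-zeroˡ g (suc n) = trans (+-cong (zeroˡ _) (⊛-zeroˡ g n)) (+-identityˡ _)

  const-⊛ : ∀ c g n → (const c ⊛ g) n ≈ c * g n
  const-⊛ c g zero    = refl
  const-⊛ c g (suc n) = trans (+-congˡ (⊛-zeroˡ g n)) (+-identityʳ _)

  ⊛-distribʳ : ∀ h f g n → ((f ⊕ g) ⊛ h) n ≈ (f ⊛ h) n + (g ⊛ h) n
  ⊛-distribʳ h f g zero    = distribʳ _ _ _
  ⊛-distribʳ h f g (suc n) = begin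
    (f 0 + g 0) * h (suc n) + ((tail f ⊕ tail g) ⊛ h) n
      ≈⟨ +-cong (distribʳ _ _ _) (⊛-distribʳ h (tail f) (tail g) n) ⟩
    f 0 * h (suc n) + g 0 * h (suc n) + ((tail f ⊛ h) n + (tail g ⊛ h) n)
      ≈⟨ interchange _ _ _ _ ⟩
    (f ⊛ h) (suc n) + (g ⊛ h) (suc n) ∎

  ·-⊛ : ∀ c f g n → ((c · f) ⊛ g) n ≈ c * (f ⊛ g) n
  ·-⊛ c f g zero    = *-assoc _ _ _
  ·-⊛ c f g (suc n) = trans (+-cong (*-assoc _ _ _) (·-⊛ c (tail f) g n)) (sym (distribˡ _ _ _))

  -- The definition peels the left factor, this peels the right one; together they give
  -- commutativity.
  ⊛-tailʳ : ∀ f g n → (f ⊛ g) (suc n) ≈ (f ⊛ tail g) n + f (suc n) * g 0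
  ⊛-tailʳ f g zero    = refl
  ⊛-tailʳ f g (suc n) = trans (+-congˡ (⊛-tailʳ (tail f) g n)) (sym (+-assoc _ _ _))

  ⊛-comm : ∀ f g n → (f ⊛ g) n ≈ (g ⊛ f) n
  ⊛-comm f g zero    = *-comm _ _
  ⊛-comm f g (suc n) = begin
    f 0 * g (suc n) + (tail f ⊛ g) n  ≈⟨ +-cong (*-comm _ _) (⊛-comm (tail f) g n) ⟩
    g (suc n) * f 0 + (g ⊛ tail f) n  ≈⟨ +-comm _ _ ⟩
    (g ⊛ tail f) n + g (suc n) * f 0  ≈⟨ ⊛-tailʳ g f n ⟨
    (g ⊛ f) (suc n)                   ∎

  ⊛-assoc : ∀ f g h n → ((f ⊛ g) ⊛ h) n ≈ (f ⊛ (g ⊛ h)) n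
  ⊛-assoc f g h zero    = *-assoc _ _ _
  ⊛-assoc f g h (suc n) = begin
    f 0 * g 0 * h (suc n) + ((f 0 · tail g ⊕ tail f ⊛ g) ⊛ h) n
      ≈⟨ +-cong (*-assoc _ _ _) (⊛-distribʳ h (f 0 · tail g) (tail f ⊛ g) n) ⟩
    f 0 * (g 0 * h (suc n)) + (((f 0 · tail g) ⊛ h) n + ((tail f ⊛ g) ⊛ h) n)
      ≈⟨ +-congˡ (+-cong (·-⊛ (f 0) (tail g) h n) (⊛-assoc (tail f) g h n)) ⟩
    f 0 * (g 0 * h (suc n)) + (f 0 * (tail g ⊛ h) n + (tail f ⊛ (g ⊛ h)) n)
      ≈⟨ +-assoc _ _ _ ⟨
    f 0 * (g 0 * h (suc n)) + f 0 * (tail g ⊛ h) n + (tail f ⊛ (g ⊛ h)) n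
      ≈⟨ +-congʳ (distribˡ _ _ _) ⟨
    f 0 * (g ⊛ h) (suc n) + (tail f ⊛ (g ⊛ h)) n ∎

  ring[[X]] : CommutativeRing 0ℓ 0ℓ
  ring[[X]] = record
    { Carrier = Series
    ; _≈_ = _≋_
    ; _+_ = _⊕_
    ; _*_ = _⊛_
    ; -_ = λ f n → - f n
    ; 0# = λ _ → 0#
    ; 1# = const 1#
    ; isCommutativeRing = record
      { isRing = record
        { +-isAbelianGroup = record
          { isGroup = record
            { isMonoid = record
              { isSemigroup = record
                { isMagma = record
                  { isEquivalence = record
                    { refl  = pointwise λ _ → refl
                    ; sym   = λ p → pointwise λ n → sym (at p n)
                    ; trans = λ p q → pointwise λ n → trans (at p n) (at q n)
                    }
                  ; ∙-cong = λ p q → pointwise λ n → +-cong (at p n) (at q n)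
                  }
                ; assoc = λ f g h → pointwise λ n → +-assoc _ _ _
                }
              ; identity = (λ f → pointwise λ n → +-identityˡ _) , (λ f → pointwise λ n → +-identityʳ _)
              }
            ; inverse = (λ f → pointwise λ n → -‿inverseˡ _) , (λ f → pointwise λ n → -‿inverseʳ _)
            ; ⁻¹-cong = λ p → pointwise λ n → -‿cong (at p n)
            }
          ; comm = λ f g → pointwise λ n → +-comm _ _
          }
        ; *-cong = ⊛-cong
        ; *-assoc = λ f g h → pointwise (⊛-assoc f g h)
        ; *-identity = (λ f → pointwise (identityˡ f))
                     , (λ f → pointwise λ n → trans (⊛-comm f (const 1#) n) (identityˡ f n))
        ; distrib = (λ h f g → pointwise λ n → trans (⊛-comm h (f ⊕ g) n)
                       (trans (⊛-distribʳ h f g n) (+-cong (⊛-comm f h n) (⊛-comm g h n))))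
                  , (λ h f g → pointwise (⊛-distribʳ h f g))
        }
      ; *-comm = λ f g → pointwise (⊛-comm f g)
      }
    }
    where
    identityˡ : ∀ f n → (const 1# ⊛ f) n ≈ f n
    identityˡ f n = trans (const-⊛ 1# f n) (*-identityˡ _)

  module S = CommutativeRing ring[[X]]
  open import Algebra.Properties.Semiring.Exp S.semiring using () renaming (_^_ to _^ₛ_)

  var-⊛-zero : ∀ f → (var ⊛ f) 0 ≈ 0#
  var-⊛-zero f = zeroˡ _

  var-⊛-suc : ∀ f n → (var ⊛ f) (suc n) ≈ f n
  var-⊛-suc f n = begin
    0# * f (suc n) + (tail var ⊛ f) n  ≈⟨ +-cong (zeroˡ _) (⊛-congᵇ n (λ m _ → tail-var m) (λ _ _ → refl)) ⟩
    0# + (const 1# ⊛ f) n              ≈⟨ +-identityˡ _ ⟩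
    (const 1# ⊛ f) n                   ≈⟨ at (S.*-identityˡ f) n ⟩
    f n                                ∎
    where
    tail-var : ∀ m → tail var m ≈ const 1# m
    tail-var zero    = refl
    tail-var (suc _) = refl

  var-cancel : ∀ f g → var ⊛ f ≋ var ⊛ g → f ≋ g
  var-cancel f g eq .at n = trans (sym (var-⊛-suc f n)) (trans (at eq (suc n)) (var-⊛-suc g n))

  const-cong : ∀ {c d} → c ≈ d → const c ≋ const d
  const-cong c≈d .at zero    = c≈d
  const-cong c≈d .at (suc _) = refl

  const-* : ∀ c d → const (c * d) ≋ const c ⊛ const d
  const-* c d .at zero    = refl
  const-* c d .at (suc n) = sym (trans (const-⊛ c (const d) (suc n)) (zeroʳ _))

  const-+ : ∀ c d → const (c + d) ≋ const c ⊕ const d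
  const-+ c d .at zero    = refl
  const-+ c d .at (suc n) = sym (+-identityˡ _)

  infix 4 _≈[_]_
  -- Congruence modulo X^(n+1), the sense in which finite products approach infinite ones.
  _≈[_]_ : Series → ℕ → Series → Set
  f ≈[ n ] g = ∀ m → m ℕ.≤ n → f m ≈ g m

  ⊛-cong[] : ∀ {f f′ g g′} n → f ≈[ n ] f′ → g ≈[ n ] g′ → f ⊛ g ≈[ n ] f′ ⊛ g′
  ⊛-cong[] n p q m m≤n =
    ⊛-congᵇ m (λ k k≤m → p k (ℕₚ.≤-trans k≤m m≤n)) (λ k k≤m → q k (ℕₚ.≤-trans k≤m m≤n))

  sum : ℕ → (ℕ → Carrier) → Carrier
  sum zero    f = 0#
  sum (suc n) f = f 0 + sum n (λ i → f (suc i))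

  sum-cong : ∀ n {f g : ℕ → Carrier} → (∀ i → i ℕ.< n → f i ≈ g i) → sum n f ≈ sum n g
  sum-cong zero    p = refl
  sum-cong (suc n) p = +-cong (p 0 (s≤s z≤n)) (sum-cong n (λ i i<n → p (suc i) (s≤s i<n)))

  ⊛-sum : ∀ f g n → (f ⊛ g) n ≈ sum (suc n) (λ i → f i * g (n ℕ.∸ i))
  ⊛-sum f g zero    = sym (+-identityʳ _)
  ⊛-sum f g (suc n) = +-congˡ (⊛-sum (tail f) g n)

  U : ℕ → Series → Series
  U r f n = f (r ℕ.+ n ℕ.* 3)

  V : Series → Series
  V f zero                = f 0
  V f (suc zero)          = 0#
  V f (suc (suc zero))    = 0#
  V f (suc (suc (suc n))) = V (tail f) n

  V-congᵇ : ∀ {f g} n → (∀ m → m ℕ.≤ n → f m ≈ g m) → V f n ≈ V g n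
  V-congᵇ zero                p = p 0 z≤n
  V-congᵇ (suc zero)          p = refl
  V-congᵇ (suc (suc zero))    p = refl
  V-congᵇ (suc (suc (suc n))) p =
    V-congᵇ n (λ m m≤n → p (suc m) (s≤s (ℕₚ.m≤n⇒m≤1+n (ℕₚ.m≤n⇒m≤1+n m≤n))))

  V-cong[] : ∀ {f g} n → f ≈[ n ] g → V f ≈[ n ] V g
  V-cong[] n p m m≤n = V-congᵇ m (λ k k≤m → p k (ℕₚ.≤-trans k≤m m≤n))

  V-cong : ∀ {f g} → f ≋ g → V f ≋ V g
  V-cong p .at n = V-congᵇ n (λ m _ → at p m)

  V-⊕ : ∀ f g → V (f ⊕ g) ≋ V f ⊕ V g
  V-⊕ f g = pointwise (go f g)
    where
    go : ∀ f g n → V (f ⊕ g) n ≈ V f n + V g n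
    go f g zero                = refl
    go f g (suc zero)          = sym (+-identityˡ _)
    go f g (suc (suc zero))    = sym (+-identityˡ _)
    go f g (suc (suc (suc n))) = go (tail f) (tail g) n

  private
    V-· : ∀ c f n → V (c · f) n ≈ c * V f n
    V-· c f zero                = refl
    V-· c f (suc zero)          = sym (zeroʳ _)
    V-· c f (suc (suc zero))    = sym (zeroʳ _)
    V-· c f (suc (suc (suc n))) = V-· c (tail f) n

    -- Two of any three consecutive coefficients of `V f` vanish, so three peeling steps collapse
    -- into one.
    V-⊛-step : ∀ f g n → (V f ⊛ g) (3 ℕ.+ n) ≈ f 0 * g (3 ℕ.+ n) + (V (tail f) ⊛ g) n
    V-⊛-step f g n = +-congˡ (begin
      0# * g (2 ℕ.+ n) + (0# * g (1 ℕ.+ n) + (V (tail f) ⊛ g) n)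
        ≈⟨ +-cong (zeroˡ _) (+-congʳ (zeroˡ _)) ⟩
      0# + (0# + (V (tail f) ⊛ g) n)  ≈⟨ trans (+-identityˡ _) (+-identityˡ _) ⟩
      (V (tail f) ⊛ g) n              ∎)

  V-⊛ : ∀ f g → V (f ⊛ g) ≋ V f ⊛ V g
  V-⊛ f g = pointwise (go f g)
    where
    go : ∀ f g n → V (f ⊛ g) n ≈ (V f ⊛ V g) n
    go f g zero                = refl
    go f g (suc zero)          = sym (trans (+-cong (zeroʳ _) (zeroˡ _)) (+-identityˡ _))
    go f g (suc (suc zero))    =
      sym (trans (+-cong (zeroʳ _) (+-cong (zeroˡ _) (zeroˡ _))) (trans (+-identityˡ _) (+-identityˡ _)))
    go f g (suc (suc (suc n))) = begin
      V (f 0 · tail g ⊕ tail f ⊛ g) n         ≈⟨ at (V-⊕ (f 0 · tail g) (tail f ⊛ g)) n ⟩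
      V (f 0 · tail g) n + V (tail f ⊛ g) n   ≈⟨ +-cong (V-· (f 0) (tail g) n) (go (tail f) g n) ⟩
      f 0 * V g (3 ℕ.+ n) + (V (tail f) ⊛ V g) n ≈⟨ V-⊛-step f (V g) n ⟨
      (V f ⊛ V g) (3 ℕ.+ n)                   ∎

  V-const : ∀ c → V (const c) ≋ const c
  V-const c = pointwise go
    where
    zeros : ∀ n → V (λ _ → 0#) n ≈ 0#
    zeros zero                = refl
    zeros (suc zero)          = refl
    zeros (suc (suc zero))    = refl
    zeros (suc (suc (suc n))) = zeros n
    go : ∀ n → V (const c) n ≈ const c n
    go zero                = refl
    go (suc zero)          = refl
    go (suc (suc zero))    = refl
    go (suc (suc (suc n))) = zeros n

  V-var : V var ≋ var ^ₛ 3
  V-var = pointwise go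
    where
    q¹ = var ^ₛ 1
    q² = var ^ₛ 2
    q³ : ∀ n → (var ^ₛ 3) (3 ℕ.+ n) ≈ const 1# n
    q³ n = trans (var-⊛-suc q² (2 ℕ.+ n)) (trans (var-⊛-suc q¹ (1 ℕ.+ n)) (var-⊛-suc (const 1#) n))
    tail-V-var : ∀ n → V (tail var) n ≈ const 1# n
    tail-V-var n = trans (V-congᵇ n (λ { zero _ → refl ; (suc _) _ → refl })) (at (V-const 1#) n)
    go : ∀ n → V var n ≈ (var ^ₛ 3) n
    go zero                = sym (var-⊛-zero q²)
    go (suc zero)          = sym (trans (var-⊛-suc q² 0) (var-⊛-zero q¹))
    go (suc (suc zero))    = sym (trans (var-⊛-suc q² 1) (trans (var-⊛-suc q¹ 0) (var-⊛-zero (const 1#))))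
    go (suc (suc (suc n))) = trans (tail-V-var n) (sym (q³ n))

  -- Extraction of a residue class is linear over series in q³. The descent therefore moves every
  -- denominator into the image of `V` before it extracts.
  U-V-⊛ : ∀ r f g → r ℕ.≤ 2 → U r (V f ⊛ g) ≋ f ⊛ U r g
  U-V-⊛ r f g r≤2 = pointwise (go r r≤2 f)
    where
    base : ∀ r → r ℕ.≤ 2 → ∀ f → (V f ⊛ g) (r ℕ.+ 0) ≈ f 0 * g (r ℕ.+ 0)
    base 0 _ f = refl
    base 1 _ f = trans (+-congˡ (zeroˡ _)) (+-identityʳ _)
    base 2 _ f = trans (+-congˡ (trans (+-cong (zeroˡ _) (zeroˡ _)) (+-identityˡ _))) (+-identityʳ _)
    base (suc (suc (suc _))) (s≤s (s≤s ())) f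

    go : ∀ r → r ℕ.≤ 2 → ∀ f n → U r (V f ⊛ g) n ≈ (f ⊛ U r g) n
    go r r≤2 f zero = base r r≤2 f
    go r r≤2 f (suc n) = begin
      (V f ⊛ g) (r ℕ.+ (3 ℕ.+ n ℕ.* 3))
        ≡⟨ ≡.cong (V f ⊛ g) eq ⟩
      (V f ⊛ g) (3 ℕ.+ (r ℕ.+ n ℕ.* 3))
        ≈⟨ V-⊛-step f g (r ℕ.+ n ℕ.* 3) ⟩
      f 0 * g (3 ℕ.+ (r ℕ.+ n ℕ.* 3)) + (V (tail f) ⊛ g) (r ℕ.+ n ℕ.* 3)
        ≈⟨ +-cong (*-congˡ (reflexive (≡.cong g (≡.sym eq)))) (go r r≤2 (tail f) n) ⟩
      f 0 * U r g (suc n) + (tail f ⊛ U r g) n ∎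
      where
      eq : r ℕ.+ (3 ℕ.+ n ℕ.* 3) ≡ 3 ℕ.+ (r ℕ.+ n ℕ.* 3)
      eq = ≡.trans (≡.sym (ℕₚ.+-assoc r 3 _)) (≡.trans (≡.cong (ℕ._+ n ℕ.* 3) (ℕₚ.+-comm r 3)) (ℕₚ.+-assoc 3 r _))

  V-multiple : ∀ f n → V f (n ℕ.* 3) ≈ f n
  V-multiple f zero    = refl
  V-multiple f (suc n) = V-multiple (tail f) n

  V-injective : ∀ f g → V f ≋ V g → f ≋ g
  V-injective f g eq .at n = trans (sym (V-multiple f n)) (trans (at eq (n ℕ.* 3)) (V-multiple g n))

  U₁V : ∀ f n → V f (1 ℕ.+ n ℕ.* 3) ≈ 0#
  U₁V f zero    = refl
  U₁V f (suc n) = U₁V (tail f) n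

  U₂V : ∀ f n → V f (2 ℕ.+ n ℕ.* 3) ≈ 0#
  U₂V f zero    = refl
  U₂V f (suc n) = U₂V (tail f) n

  residues-split : ∀ {f g} → (∀ n → f (n ℕ.* 3) ≈ g (n ℕ.* 3)) → (∀ n → f (1 ℕ.+ n ℕ.* 3) ≈ g (1 ℕ.+ n ℕ.* 3)) →
                   (∀ n → f (2 ℕ.+ n ℕ.* 3) ≈ g (2 ℕ.+ n ℕ.* 3)) → f ≋ g
  residues-split {f} {g} p₀ p₁ p₂ = pointwise (go f g p₀ p₁ p₂)
    where
    go : ∀ f g → (∀ n → f (n ℕ.* 3) ≈ g (n ℕ.* 3)) → (∀ n → f (1 ℕ.+ n ℕ.* 3) ≈ g (1 ℕ.+ n ℕ.* 3)) →
         (∀ n → f (2 ℕ.+ n ℕ.* 3) ≈ g (2 ℕ.+ n ℕ.* 3)) → ∀ n → f n ≈ g n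
    go f g p₀ p₁ p₂ 0 = p₀ 0
    go f g p₀ p₁ p₂ 1 = p₁ 0
    go f g p₀ p₁ p₂ 2 = p₂ 0
    go f g p₀ p₁ p₂ (suc (suc (suc n))) =
      go (λ m → f (3 ℕ.+ m)) (λ m → g (3 ℕ.+ m)) (λ m → p₀ (suc m)) (λ m → p₁ (suc m)) (λ m → p₂ (suc m)) n

  -- The substitution X ↦ c X. For a cube root of unity c it fixes the image of `V`.
  σ : Carrier → Series → Series
  σ c f n = c ^ n * f n

  σ-cong[] : ∀ c {f g} n → f ≈[ n ] g → σ c f ≈[ n ] σ c g
  σ-cong[] c n p m m≤n = *-congˡ (p m m≤n)

  σ-cong : ∀ c {f g} → f ≋ g → σ c f ≋ σ c g
  σ-cong c p .at n = *-congˡ (at p n)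

  σ-⊕ : ∀ c f g → σ c (f ⊕ g) ≋ σ c f ⊕ σ c g
  σ-⊕ c f g .at n = distribˡ _ _ _

  σ-⊛ : ∀ c f g → σ c (f ⊛ g) ≋ σ c f ⊛ σ c g
  σ-⊛ c f g = pointwise (go f)
    where
    go : ∀ f n → σ c (f ⊛ g) n ≈ (σ c f ⊛ σ c g) n
    go f zero    = trans (*-identityˡ _) (sym (*-cong (*-identityˡ _) (*-identityˡ _)))
    go f (suc n) = begin
      c ^ suc n * (f 0 * g (suc n) + (tail f ⊛ g) n)
        ≈⟨ distribˡ _ _ _ ⟩
      c ^ suc n * (f 0 * g (suc n)) + c * c ^ n * (tail f ⊛ g) n
        ≈⟨ +-cong (trans (sym (*-assoc _ _ _)) (trans (*-congʳ (*-comm _ _)) (*-assoc _ _ _))) (*-assoc _ _ _) ⟩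
      f 0 * (c ^ suc n * g (suc n)) + c * σ c (tail f ⊛ g) n
        ≈⟨ +-cong (*-congʳ (sym (*-identityˡ _))) (*-congˡ (go (tail f) n)) ⟩
      (1# * f 0) * σ c g (suc n) + c * (σ c (tail f) ⊛ σ c g) n
        ≈⟨ +-congˡ (·-⊛ c (σ c (tail f)) (σ c g) n) ⟨
      (1# * f 0) * σ c g (suc n) + ((c · σ c (tail f)) ⊛ σ c g) n
        ≈⟨ +-congˡ (⊛-congᵇ n (λ m _ → sym (*-assoc _ _ _)) (λ _ _ → refl)) ⟩
      (σ c f ⊛ σ c g) (suc n) ∎

  σ-const : ∀ c d → σ c (const d) ≋ const d
  σ-const c d .at zero    = *-identityˡ _
  σ-const c d .at (suc n) = zeroʳ _

  σ-var : ∀ c → σ c var ≋ const c ⊛ var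
  σ-var c .at n = trans (go n) (sym (const-⊛ c var n))
    where
    go : ∀ n → σ c var n ≈ c * var n
    go zero          = trans (*-identityˡ _) (sym (zeroʳ _))
    go (suc zero)    = *-congʳ (*-identityʳ _)
    go (suc (suc n)) = trans (zeroʳ _) (sym (zeroʳ _))

  σ-V : ∀ c → c ^ 3 ≈ 1# → ∀ f → σ c (V f) ≋ V f
  σ-V c c³ f = pointwise (go f)
    where
    go : ∀ f n → c ^ n * V f n ≈ V f n
    go f zero                = *-identityˡ _
    go f (suc zero)          = zeroʳ _
    go f (suc (suc zero))    = zeroʳ _
    go f (suc (suc (suc n))) = trans (*-congʳ (trans (^-homo-* c 3 n) (trans (*-congʳ c³) (*-identityˡ _)))) (go (tail f) n)

-- Dissection by exponents modulo 3

module Dissection (R : CommutativeRing 0ℓ 0ℓ) where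
  private module R = CommutativeRing R
  open PowerSeries R
  open CommutativeRing ring[[X]]
  open IntegerSolver ring[[X]]
  open import Relation.Binary.Reasoning.Setoid setoid

  U-cong : ∀ r {f g} → f ≈ g → U r f ≈ U r g
  U-cong r f≈g .at n = at f≈g (r ℕ.+ n ℕ.* 3)

  U-+ : ∀ r f g → U r (f + g) ≈ U r f + U r g
  U-+ r f g = refl

  V-nat : ∀ k → V (nat k) ≈ nat k
  V-nat zero    = pointwise go
    where
    go : ∀ n → V 0# n R.≈ R.0#
    go zero                = R.refl
    go (suc zero)          = R.refl
    go (suc (suc zero))    = R.refl
    go (suc (suc (suc n))) = go n
  V-nat (suc k) = begin
    V (nat (suc k))     ≈⟨ V-cong (nat-suc k) ⟩
    V (1# + nat k)      ≈⟨ V-⊕ 1# (nat k) ⟩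
    V 1# + V (nat k)    ≈⟨ +-cong (V-const R.1#) (V-nat k) ⟩
    1# + nat k          ≈⟨ nat-suc k ⟨
    nat (suc k)         ∎

  V-nat* : ∀ k f → V (nat k * f) ≈ nat k * V f
  V-nat* k f = trans (V-⊛ (nat k) f) (*-congʳ (V-nat k))

  V-sq : ∀ f → V (f * f) ≈ V f * V f
  V-sq f = V-⊛ f f

  V-cube : ∀ f → V (f * f * f) ≈ V f * V f * V f
  V-cube f = trans (V-⊛ (f * f) f) (*-congʳ (V-⊛ f f))

  V-q : V var ≈ var * var * var
  V-q = trans V-var (solve 1 (λ q → q :^ 3 := q :* q :* q) refl var)

  U-V* : ∀ r → r ℕ.≤ 2 → ∀ f g → U r (V f * g) ≈ f * U r g
  U-V* r r≤2 f g = U-V-⊛ r f g r≤2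

  U-nat* : ∀ r → r ℕ.≤ 2 → ∀ k f → U r (nat k * f) ≈ nat k * U r f
  U-nat* r r≤2 k f = trans (U-cong r (*-congʳ (sym (V-nat k)))) (U-V* r r≤2 (nat k) f)

  1≤2 : 1 ℕ.≤ 2
  1≤2 = s≤s z≤n

  2≤2 : 2 ℕ.≤ 2
  2≤2 = s≤s (s≤s z≤n)

  U₂-q* : ∀ f → U 2 (var * f) ≈ U 1 f
  U₂-q* f .at n = var-⊛-suc f (1 ℕ.+ n ℕ.* 3)

  U₁-q* : ∀ f → U 1 (var * f) ≈ U 0 f
  U₁-q* f .at n = var-⊛-suc f (n ℕ.* 3)

  U₁-V : ∀ f → U 1 (V f) ≈ 0#
  U₁-V f .at = U₁V f

  U₂-V : ∀ f → U 2 (V f) ≈ 0#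
  U₂-V f .at = U₂V f

  U₂-qV : ∀ f → U 2 (var * V f) ≈ 0#
  U₂-qV f = trans (U₂-q* (V f)) (U₁-V f)

  U₂-q²V : ∀ f → U 2 (var * (var * V f)) ≈ f
  U₂-q²V f = trans (U₂-q* (var * V f)) (trans (U₁-q* (V f)) (pointwise (V-multiple f)))

-- Descent modulo powers of 3

module EtaQuotients
  (R : CommutativeRing 0ℓ 0ℓ)
  (E P : PowerSeries.Series R)
  (EP≈1 : PowerSeries._≋_ R (PowerSeries._⊛_ R E P) (PowerSeries.const R (CommutativeRing.1# R)))
  where
  private module R = CommutativeRing R
  open PowerSeries R
  open Dissection R
  open CommutativeRing ring[[X]]
  open IntegerSolver ring[[X]]
  open import Algebra.Properties.Semiring.Exp semiring using (_^_; ^-congˡ)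
  open import Relation.Binary.Reasoning.Setoid setoid

  -- E stands for (q;q)_∞; then b is the cubic theta function b(q), and 3 q^(1/3) l is c(q).
  b l v : Carrier
  b = E * E * E * V P
  l = V E * V E * V E * P
  v = P * P * P * V E

  VEP≈1 : V E * V P ≈ 1#
  VEP≈1 = trans (sym (V-⊛ E P)) (trans (V-cong EP≈1) (V-const _))

  bv≈1 : b * v ≈ 1#
  bv≈1 = begin
    b * v
      ≈⟨ solve 4 (λ e p e₃ p₃ → e :* e :* e :* p₃ :* (p :* p :* p :* e₃) := (e :* p) :* (e :* p) :* (e :* p) :* (e₃ :* p₃))
           refl E P (V E) (V P) ⟩
    E * P * (E * P) * (E * P) * (V E * V P)
      ≈⟨ *-cong (*-cong (*-cong EP≈1 EP≈1) EP≈1) VEP≈1 ⟩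
    1# * 1# * 1# * 1#  ≈⟨ trans (*-identityʳ _) (trans (*-identityʳ _) (*-identityʳ _)) ⟩
    1#                 ∎

  b-cancel : ∀ f g → b * f ≈ b * g → f ≈ g
  b-cancel f g eq = begin
    f            ≈⟨ *-identityˡ f ⟨
    1# * f       ≈⟨ *-congʳ bv≈1 ⟨
    b * v * f    ≈⟨ solve 3 (λ b v f → b :* v :* f := v :* (b :* f)) refl b v f ⟩
    v * (b * f)  ≈⟨ *-congˡ eq ⟩
    v * (b * g)  ≈⟨ solve 3 (λ b v f → b :* v :* f := v :* (b :* f)) refl b v g ⟨
    b * v * g    ≈⟨ *-congʳ bv≈1 ⟩
    1# * g       ≈⟨ *-identityˡ g ⟩
    g            ∎

  VVEP≈1 : V (V E) * V (V P) ≈ 1#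
  VVEP≈1 = trans (sym (V-⊛ (V E) (V P))) (trans (V-cong VEP≈1) (V-const _))

  Vb : V b ≈ V E * V E * V E * V (V P)
  Vb = trans (V-⊛ (E * E * E) (V P)) (*-congʳ (V-cube E))

  -- Pure cancellation of eta quotients: both sides are `V E ^ 8`.
  l³b≈VlVb³ : l * l * l * b ≈ V l * V (b * b * b)
  l³b≈VlVb³ = begin
    l * l * l * b
      ≈⟨ solve 4 (λ e p e₃ p₃ → let l = e₃ :* e₃ :* e₃ :* p in
           l :* l :* l :* (e :* e :* e :* p₃) := e₃ :^ 8 :* ((e :* p) :^ 3 :* (e₃ :* p₃))) refl E P (V E) (V P) ⟩
    V E ^ 8 * ((E * P) ^ 3 * (V E * V P))
      ≈⟨ *-congˡ (*-cong (^-congˡ 3 EP≈1) VEP≈1) ⟩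
    V E ^ 8 * (1# ^ 3 * 1#)
      ≈⟨ *-congˡ (*-cong (^-congˡ 3 VVEP≈1) VEP≈1) ⟨
    V E ^ 8 * ((V (V E) * V (V P)) ^ 3 * (V E * V P))
      ≈⟨ solve 4 (λ e₃ p₃ e₉ p₉ → let c = e₃ :* e₃ :* e₃ :* p₉ in
           e₃ :^ 8 :* ((e₉ :* p₉) :^ 3 :* (e₃ :* p₃)) := (e₉ :* e₉ :* e₉ :* p₃) :* (c :* c :* c)) refl (V E) (V P) (V (V E)) (V (V P)) ⟩
    (V (V E) * V (V E) * V (V E) * V P) * (V E * V E * V E * V (V P) * (V E * V E * V E * V (V P)) * (V E * V E * V E * V (V P)))
      ≈⟨ *-cong (trans (V-⊛ _ P) (*-congʳ (V-cube (V E)))) (trans (V-cube b) (*-cong (*-cong Vb Vb) Vb)) ⟨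
    V l * V (b * b * b) ∎

module Descent
  (R : CommutativeRing 0ℓ 0ℓ)
  (E P : PowerSeries.Series R)
  (EP≈1 : PowerSeries._≋_ R (PowerSeries._⊛_ R E P) (PowerSeries.const R (CommutativeRing.1# R)))
  where
  private module R = CommutativeRing R
  open PowerSeries R
  open Dissection R
  open EtaQuotients R E P EP≈1
  open CommutativeRing ring[[X]] hiding (zero)
  open IntegerSolver ring[[X]]
  open import Algebra.Properties.Semiring.Exp semiring using (_^_; ^-congˡ)
  open import Relation.Binary.Reasoning.Setoid setoid

  module Steps
    (3-cancel : ∀ f g → nat 3 * f ≈ nat 3 * g → f ≈ g)
    (a : Carrier)
    (a-dissection : a ≈ V a + nat 6 * (var * V l))
    (b-dissection : b + nat 3 * (var * V l) ≈ V a)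
    (a³≈b³+27ql³ : a * a * a ≈ b * b * b + nat 27 * (var * (l * l * l)))
    where

    -- Multiplication by `v` replaces division by `b`. `M` is the cofactor (A³ - C³)/(A - C) for A =
    -- `V a`, and `D` anticipates the value of `U 2 y`.
    q C M y u x z D : Carrier
    q = var
    C = nat 3 * (q * V l)
    M = V a * V a + V a * C + C * C
    y = C * v * nat 3
    u = 1# + y
    x = nat 27 * (q * (l * l * l)) * (v * v * v)
    z = y * y + nat 3 * y + nat 3
    D = nat 27 * (a * (l * l) * (v * v * v))

    by≈3C : b * y ≈ nat 3 * C
    by≈3C = begin
      b * (C * v * nat 3)  ≈⟨ solve 3 (λ b c v → b :* (c :* v :* :nat 3) := b :* v :* (:nat 3 :* c)) refl b C v ⟩
      b * v * (nat 3 * C)  ≈⟨ *-congʳ bv≈1 ⟩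
      1# * (nat 3 * C)     ≈⟨ *-identityˡ _ ⟩
      nat 3 * C            ∎

    bu≈a : b * u ≈ a
    bu≈a = begin
      b * (1# + y)        ≈⟨ solve 2 (λ b y → b :* (:nat 1 :+ y) := b :+ b :* y) refl b y ⟩
      b + b * y           ≈⟨ +-congˡ by≈3C ⟩
      b + nat 3 * C       ≈⟨ solve 2 (λ b c → b :+ :nat 3 :* (:nat 3 :* c) := (b :+ :nat 3 :* c) :+ :nat 6 :* c)
           refl b (q * V l) ⟩
      b + C + nat 6 * (q * V l)  ≈⟨ +-congʳ b-dissection ⟩
      V a + nat 6 * (q * V l)    ≈⟨ a-dissection ⟨
      a ∎

    b³x≈27ql³ : b * b * b * x ≈ nat 27 * (q * (l * l * l))
    b³x≈27ql³ = begin
      b * b * b * x ≈⟨ solve 3 (λ b t v → b :* b :* b :* (t :* (v :* v :* v)) := t :* (b :* v :* (b :* v) :* (b :* v)))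
           refl b (nat 27 * (q * (l * l * l))) v ⟩
      nat 27 * (q * (l * l * l)) * (b * v * (b * v) * (b * v))
        ≈⟨ *-congˡ (*-cong (*-cong bv≈1 bv≈1) bv≈1) ⟩
      nat 27 * (q * (l * l * l)) * (1# * 1# * 1#)
        ≈⟨ solve 1 (λ t → t :* (:nat 1 :* :nat 1 :* :nat 1) := t) refl (nat 27 * (q * (l * l * l))) ⟩
      nat 27 * (q * (l * l * l)) ∎

    b³-cancel : ∀ f g → b * b * b * f ≈ b * b * b * g → f ≈ g
    b³-cancel f g eq = b-cancel f g (b-cancel _ _ (b-cancel _ _ (begin
      b * (b * (b * f))  ≈⟨ solve 2 (λ b f → b :* (b :* (b :* f)) := b :* b :* b :* f) refl b f ⟩
      b * b * b * f      ≈⟨ eq ⟩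
      b * b * b * g      ≈⟨ solve 2 (λ b f → b :* (b :* (b :* f)) := b :* b :* b :* f) refl b g ⟨
      b * (b * (b * g))  ∎)))

    -- 1 + x = u³ is the cubic theta identity a³ = b³ + c³ divided by b³.
    x≈yz : x ≈ y * z
    x≈yz = b³-cancel x (y * z) (begin
      b * b * b * x
        ≈⟨ b³x≈27ql³ ⟩
      nat 27 * (q * (l * l * l))
        ≈⟨ solve 2 (λ b t → t := b :* b :* b :+ t :- b :* b :* b) refl b (nat 27 * (q * (l * l * l))) ⟩
      b * b * b + nat 27 * (q * (l * l * l)) - b * b * b
        ≈⟨ +-congʳ (trans (sym a³≈b³+27ql³) (*-cong (*-cong (sym bu≈a) (sym bu≈a)) (sym bu≈a))) ⟩
      b * u * (b * u) * (b * u) - b * b * b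
        ≈⟨ solve 2 (λ b y → let u = :nat 1 :+ y in b :* u :* (b :* u) :* (b :* u) :- b :* b :* b
             := b :* b :* b :* (y :* (y :* y :+ :nat 3 :* y :+ :nat 3))) refl b y ⟩
      b * b * b * (y * z) ∎)

    VC³ : C * C * C ≈ nat 27 * V (q * (l * l * l))
    VC³ = begin
      C * C * C
        ≈⟨ solve 2 (λ q l → :nat 3 :* (q :* l) :* (:nat 3 :* (q :* l)) :* (:nat 3 :* (q :* l)) := :nat 27 :* (q :* q :* q :* (l :* l :* l)))
             refl q (V l) ⟩
      nat 27 * (q * q * q * (V l * V l * V l))
        ≈⟨ *-congˡ (*-cong V-q (V-cube l)) ⟨
      nat 27 * (V q * V (l * l * l))
        ≈⟨ *-congˡ (V-⊛ q (l * l * l)) ⟨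
      nat 27 * V (q * (l * l * l)) ∎

    -- Difference of cubes: `b` = A - C with A = `V a`, and `V` of the cubic identity turns A³ - C³
    -- into V b³. Multiplying by `V (b * b * b)` thus clears a denominator `b` and still commutes
    -- with extraction.
    bM≈Vb³ : b * M ≈ V (b * b * b)
    bM≈Vb³ = begin
      b * M
        ≈⟨ *-congʳ (solve 2 (λ b c → b := (b :+ c) :- c) refl b C) ⟩
      (b + C - C) * M
        ≈⟨ *-congʳ (+-congʳ b-dissection) ⟩
      (V a - C) * M
        ≈⟨ solve 2 (λ a c → (a :- c) :* (a :* a :+ a :* c :+ c :* c) := a :* a :* a :- c :* c :* c) refl (V a) C ⟩
      V a * V a * V a - C * C * C
        ≈⟨ +-cong (sym (V-cube a)) (-‿cong VC³) ⟩
      V (a * a * a) - nat 27 * V (q * (l * l * l))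
        ≈⟨ +-congʳ (trans (V-cong a³≈b³+27ql³) (trans (V-⊕ (b * b * b) (nat 27 * (q * (l * l * l)))) (+-congˡ (V-nat* 27 _)))) ⟩
      V (b * b * b) + nat 27 * V (q * (l * l * l)) - nat 27 * V (q * (l * l * l))
        ≈⟨ solve 2 (λ s t → s :+ t :- t := s) refl (V (b * b * b)) (nat 27 * V (q * (l * l * l))) ⟩
      V (b * b * b) ∎

    ÷b³ : ∀ f g → b * b * b * f ≈ g → f ≈ g * (v * v * v)
    ÷b³ f g eq = begin
      f                           ≈⟨ solve 1 (λ f → f := f :* (:nat 1 :* :nat 1 :* :nat 1)) refl f ⟩
      f * (1# * 1# * 1#)          ≈⟨ *-congˡ (*-cong (*-cong bv≈1 bv≈1) bv≈1) ⟨
      f * (b * v * (b * v) * (b * v))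
        ≈⟨ solve 3 (λ b v f → f :* (b :* v :* (b :* v) :* (b :* v)) := b :* b :* b :* f :* (v :* v :* v)) refl b v f ⟩
      b * b * b * f * (v * v * v) ≈⟨ *-congʳ eq ⟩
      g * (v * v * v)             ∎

    l³≈VlM : l * l * l ≈ V l * M
    l³≈VlM = b-cancel _ _ (begin
      b * (l * l * l)      ≈⟨ *-comm _ _ ⟩
      l * l * l * b        ≈⟨ l³b≈VlVb³ ⟩
      V l * V (b * b * b)  ≈⟨ *-congˡ bM≈Vb³ ⟨
      V l * (b * M)        ≈⟨ solve 3 (λ l b m → l :* (b :* m) := b :* (l :* m)) refl (V l) b M ⟩
      b * (V l * M)        ∎)

    -- Substituting A = b + C and 3C = b y makes the quadratic form homogeneous in b and b y; the
    -- factor 3 supplies what is missing for each C to occur as 3C.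
    3M≈b²z : nat 3 * M ≈ b * b * z
    3M≈b²z = begin
      nat 3 * M
        ≈⟨ *-congˡ (+-congʳ (+-cong (*-cong b-dissection b-dissection) (*-congʳ b-dissection))) ⟨
      nat 3 * ((b + C) * (b + C) + (b + C) * C + C * C)
        ≈⟨ solve 2 (λ b c → :nat 3 :* ((b :+ c) :* (b :+ c) :+ (b :+ c) :* c :+ c :* c)
             := (:nat 3 :* c) :* (:nat 3 :* c) :+ :nat 3 :* (b :* (:nat 3 :* c)) :+ :nat 3 :* (b :* b)) refl b C ⟩
      (nat 3 * C) * (nat 3 * C) + nat 3 * (b * (nat 3 * C)) + nat 3 * (b * b)
        ≈⟨ +-congʳ (+-cong (*-cong by≈3C by≈3C) (*-congˡ (*-congˡ by≈3C))) ⟨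
      (b * y) * (b * y) + nat 3 * (b * (b * y)) + nat 3 * (b * b)
        ≈⟨ solve 2 (λ b y → (b :* y) :* (b :* y) :+ :nat 3 :* (b :* (b :* y)) :+ :nat 3 :* (b :* b)
             := b :* b :* (y :* y :+ :nat 3 :* y :+ :nat 3)) refl b y ⟩
      b * b * z ∎

    X : Carrier
    X = V x

    b³X : V (b * b * b) * X ≈ nat 27 * V (q * (l * l * l))
    b³X = trans (sym (V-⊛ (b * b * b) x)) (trans (V-cong b³x≈27ql³) (V-nat* 27 _))

    -- The cube of b y = 3C is 27 C³, a series in q³, hence 27 V(b³) X; writing V(b³) as `b * M`
    -- brings `z` back in. Reduction modulo this cubic is the engine of the descent.
    y³≈9Xz : y * y * y ≈ nat 9 * (X * z)
    y³≈9Xz = b³-cancel _ _ (begin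
      b * b * b * (y * y * y)
        ≈⟨ solve 2 (λ b y → b :* b :* b :* (y :* y :* y) := b :* y :* (b :* y) :* (b :* y)) refl b y ⟩
      b * y * (b * y) * (b * y)
        ≈⟨ *-cong (*-cong by≈3C by≈3C) by≈3C ⟩
      nat 3 * C * (nat 3 * C) * (nat 3 * C)
        ≈⟨ solve 1 (λ c → :nat 3 :* c :* (:nat 3 :* c) :* (:nat 3 :* c) := :nat 27 :* (c :* c :* c)) refl C ⟩
      nat 27 * (C * C * C)
        ≈⟨ *-congˡ (trans VC³ (sym b³X)) ⟩
      nat 27 * (V (b * b * b) * X)
        ≈⟨ *-congˡ (*-congʳ bM≈Vb³) ⟨
      nat 27 * (b * M * X)
        ≈⟨ solve 3 (λ b m x → :nat 27 :* (b :* m :* x) := :nat 9 :* (x :* (b :* (:nat 3 :* m)))) refl b M X ⟩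
      nat 9 * (X * (b * (nat 3 * M)))
        ≈⟨ *-congˡ (*-congˡ (*-congˡ 3M≈b²z)) ⟩
      nat 9 * (X * (b * (b * b * z)))
        ≈⟨ solve 3 (λ b z x → :nat 9 :* (x :* (b :* (b :* b :* z))) := b :* b :* b :* (:nat 9 :* (x :* z))) refl b z X ⟩
      b * b * b * (nat 9 * (X * z)) ∎)

    t : Carrier
    t = nat 27 * (q * (l * l * l))

    C³≈Vt : C * C * C ≈ V t
    C³≈Vt = trans VC³ (sym (V-nat* 27 _))

    U₂A : ∀ w → U 2 (V a * w) ≈ a * U 2 w
    U₂A = U-V* 2 2≤2 a

    U₂C : U 2 C ≈ 0#
    U₂C = trans (U-nat* 2 2≤2 3 (q * V l)) (trans (*-congˡ (U₂-qV l)) (zeroʳ _))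

    -- `C` is supported on exponents 1 mod 3, so `C * C` lies entirely in class 2 and C³ in class 0.
    U₂C² : U 2 (C * C) ≈ nat 9 * (l * l)
    U₂C² = begin
      U 2 (C * C)
        ≈⟨ U-cong 2 (solve 2 (λ q l → :nat 3 :* (q :* l) :* (:nat 3 :* (q :* l)) := :nat 9 :* (q :* (q :* (l :* l))))
             refl q (V l)) ⟩
      U 2 (nat 9 * (q * (q * (V l * V l))))
        ≈⟨ U-nat* 2 2≤2 9 _ ⟩
      nat 9 * U 2 (q * (q * (V l * V l)))
        ≈⟨ *-congˡ (U-cong 2 (*-congˡ {q} (*-congˡ {q} (V-sq l)))) ⟨
      nat 9 * U 2 (q * (q * V (l * l)))
        ≈⟨ *-congˡ (U₂-q²V (l * l)) ⟩
      nat 9 * (l * l) ∎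

    -- Multiplied by `V (b * b * b)` = `b * M`, the series `y` becomes 3CM = 3(A²C + AC² + C³) with
    -- A = `V a`, where only AC² has exponents 2 mod 3.
    U₂y : U 2 y ≈ D
    U₂y = begin
      U 2 y
        ≈⟨ ÷b³ _ _ step ⟩
      nat 27 * (a * (l * l)) * (v * v * v)
        ≈⟨ solve 3 (λ a l v → :nat 27 :* (a :* (l :* l)) :* (v :* v :* v) := :nat 27 :* (a :* (l :* l) :* (v :* v :* v)))
             refl a l v ⟩
      D ∎
      where
      step : b * b * b * U 2 y ≈ nat 27 * (a * (l * l))
      step = begin
        b * b * b * U 2 y
          ≈⟨ U-V* 2 2≤2 (b * b * b) y ⟨
        U 2 (V (b * b * b) * y)
          ≈⟨ U-cong 2 (*-congʳ bM≈Vb³) ⟨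
        U 2 (b * M * y)
          ≈⟨ U-cong 2 (solve 3 (λ b m y → b :* m :* y := b :* y :* m) refl b M y) ⟩
        U 2 (b * y * M)
          ≈⟨ U-cong 2 (*-congʳ by≈3C) ⟩
        U 2 (nat 3 * C * M)
          ≈⟨ U-cong 2 (solve 2 (λ a c → :nat 3 :* c :* (a :* a :+ a :* c :+ c :* c)
               := :nat 3 :* (a :* (a :* c) :+ a :* (c :* c) :+ c :* c :* c)) refl (V a) C) ⟩
        U 2 (nat 3 * (V a * (V a * C) + V a * (C * C) + C * C * C))
          ≈⟨ U-nat* 2 2≤2 3 _ ⟩
        nat 3 * (U 2 (V a * (V a * C)) + U 2 (V a * (C * C)) + U 2 (C * C * C))
          ≈⟨ *-congˡ (+-cong (+-cong (trans (U₂A _) (*-congˡ (trans (U₂A C) (*-congˡ U₂C))))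
                                     (trans (U₂A _) (*-congˡ U₂C²)))
                             (trans (U-cong 2 C³≈Vt) (U₂-V t))) ⟩
        nat 3 * (a * (a * 0#) + a * (nat 9 * (l * l)) + 0#)
          ≈⟨ solve 2 (λ a l → :nat 3 :* (a :* (a :* :nat 0) :+ a :* (:nat 9 :* (l :* l)) :+ :nat 0)
               := :nat 27 :* (a :* (l :* l))) refl a l ⟩
        nat 27 * (a * (l * l)) ∎

    -- Now two factors `b * M` are needed. In 9C²M² class 2 consists of A⁴C² and 2AC⁵, and the cubic
    -- identity merges the two contributions into the factor 1 + 3x.
    U₂y² : U 2 (y * y) ≈ nat 3 * (D * (1# + nat 3 * x))
    U₂y² = begin
      U 2 (y * y)
        ≈⟨ ÷b³ _ _ (÷b³ _ _ step) ⟩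
      nat 81 * (a * (l * l) * (b * b * b * (1# + nat 3 * x))) * (v * v * v) * (v * v * v)
        ≈⟨ solve 5 (λ a l b v x → :nat 81 :* (a :* (l :* l) :* (b :* b :* b :* (:nat 1 :+ :nat 3 :* x))) :* (v :* v :* v) :* (v :* v :* v)
             := :nat 3 :* (:nat 27 :* (a :* (l :* l) :* (v :* v :* v)) :* (:nat 1 :+ :nat 3 :* x)) :* ((b :* v) :^ 3)) refl a l b v x ⟩
      nat 3 * (D * (1# + nat 3 * x)) * ((b * v) ^ 3)
        ≈⟨ *-congˡ (^-congˡ 3 bv≈1) ⟩
      nat 3 * (D * (1# + nat 3 * x)) * (1# ^ 3)
        ≈⟨ solve 1 (λ w → w :* (:nat 1 :^ 3) := w) refl (nat 3 * (D * (1# + nat 3 * x))) ⟩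
      nat 3 * (D * (1# + nat 3 * x)) ∎
      where
      step : b * b * b * (b * b * b * U 2 (y * y)) ≈ nat 81 * (a * (l * l) * (b * b * b * (1# + nat 3 * x)))
      step = begin
        b * b * b * (b * b * b * U 2 (y * y))
          ≈⟨ trans (U-V* 2 2≤2 (b * b * b) _) (*-congˡ (U-V* 2 2≤2 (b * b * b) (y * y))) ⟨
        U 2 (V (b * b * b) * (V (b * b * b) * (y * y)))
          ≈⟨ U-cong 2 (*-cong bM≈Vb³ (*-congʳ bM≈Vb³)) ⟨
        U 2 (b * M * (b * M * (y * y)))
          ≈⟨ U-cong 2 (solve 3 (λ b m y → b :* m :* (b :* m :* (y :* y)) := (b :* y) :* (b :* y) :* (m :* m)) refl b M y) ⟩
        U 2 ((b * y) * (b * y) * (M * M))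
          ≈⟨ U-cong 2 (*-congʳ (*-cong by≈3C by≈3C)) ⟩
        U 2 ((nat 3 * C) * (nat 3 * C) * (M * M))
          -- The grouping pulls out C³, a series in q³, so that each remaining term is a product of
          -- powers of A with C, C² or nothing and has a visible residue class.
          ≈⟨ U-cong 2 (solve 2 (λ a c → let m = a :* a :+ a :* c :+ c :* c ; t = c :* c :* c in
               (:nat 3 :* c) :* (:nat 3 :* c) :* (m :* m)
               := :nat 9 :* (a :* (a :* (a :* (a :* (c :* c)))) :+ (t :* (t :+ :nat 2 :* (a :* a :* a)) :+ t :* (:nat 2 :* (a :* (c :* c)) :+ :nat 3 :* (a :* (a :* c))))))
               refl (V a) C) ⟩
        U 2 (nat 9 * (V a * (V a * (V a * (V a * (C * C)))) + (C * C * C * (C * C * C + nat 2 * (V a * V a * V a))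
                + C * C * C * (nat 2 * (V a * (C * C)) + nat 3 * (V a * (V a * C))))))
          ≈⟨ U-cong 2 (*-congˡ {nat 9} (+-congˡ (+-cong (*-cong C³≈Vt (+-cong C³≈Vt (*-congˡ {nat 2} (sym (V-cube a))))) (*-congʳ C³≈Vt)))) ⟩
        U 2 (nat 9 * (V a * (V a * (V a * (V a * (C * C)))) + (V t * (V t + nat 2 * V (a * a * a))
                + V t * (nat 2 * (V a * (C * C)) + nat 3 * (V a * (V a * C))))))
          ≈⟨ U-nat* 2 2≤2 9 _ ⟩
        nat 9 * (U 2 (V a * (V a * (V a * (V a * (C * C))))) + (U 2 (V t * (V t + nat 2 * V (a * a * a)))
                + U 2 (V t * (nat 2 * (V a * (C * C)) + nat 3 * (V a * (V a * C))))))
          ≈⟨ *-congˡ (+-cong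
               (trans (U₂A _) (*-congˡ (trans (U₂A _) (*-congˡ (trans (U₂A _) (*-congˡ (trans (U₂A _) (*-congˡ U₂C²))))))))
               (+-cong
                 (trans (U-V* 2 2≤2 t _) (*-congˡ (+-cong (U₂-V t) (trans (U-nat* 2 2≤2 2 _) (*-congˡ (U₂-V _))))))
                 (trans (U-V* 2 2≤2 t _) (*-congˡ (+-cong
                   (trans (U-nat* 2 2≤2 2 _) (*-congˡ (trans (U₂A _) (*-congˡ U₂C²))))
                   (trans (U-nat* 2 2≤2 3 _) (*-congˡ (trans (U₂A _) (*-congˡ (trans (U₂A _) (*-congˡ U₂C)))))))))))  ⟩
        nat 9 * (a * (a * (a * (a * (nat 9 * (l * l))))) + (t * (0# + nat 2 * 0#)
                + t * (nat 2 * (a * (nat 9 * (l * l))) + nat 3 * (a * (a * 0#)))))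
          ≈⟨ solve 3 (λ a l t → :nat 9 :* (a :* (a :* (a :* (a :* (:nat 9 :* (l :* l))))) :+ (t :* (:nat 0 :+ :nat 2 :* :nat 0)
                :+ t :* (:nat 2 :* (a :* (:nat 9 :* (l :* l))) :+ :nat 3 :* (a :* (a :* :nat 0)))))
                := :nat 81 :* (a :* (l :* l) :* (a :* a :* a :+ :nat 2 :* t))) refl a l t ⟩
        nat 81 * (a * (l * l) * (a * a * a + nat 2 * t))
          ≈⟨ *-congˡ (*-congˡ (+-cong a³≈b³+27ql³ refl)) ⟩
        nat 81 * (a * (l * l) * (b * b * b + t + nat 2 * t))
          ≈⟨ *-congˡ (*-congˡ (+-cong (+-congˡ (sym b³x≈27ql³)) (*-congˡ (sym b³x≈27ql³)))) ⟩
        nat 81 * (a * (l * l) * (b * b * b + b * b * b * x + nat 2 * (b * b * b * x)))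
          ≈⟨ solve 4 (λ a l b x → :nat 81 :* (a :* (l :* l) :* (b :* b :* b :+ b :* b :* b :* x :+ :nat 2 :* (b :* b :* b :* x)))
               := :nat 81 :* (a :* (l :* l) :* (b :* b :* b :* (:nat 1 :+ :nat 3 :* x)))) refl a l b x ⟩
        nat 81 * (a * (l * l) * (b * b * b * (1# + nat 3 * x))) ∎

    -- Polynomials in x with natural number coefficients; no subtraction ever occurs.
    data Poly : Carrier → Set where
      zero : Poly 0#
      one  : Poly 1#
      _⊞_  : ∀ {f g} → Poly f → Poly g → Poly (f + g)
      x⊠_  : ∀ {f} → Poly f → Poly (x * f)
      resp : ∀ {f g} → f ≈ g → Poly f → Poly g

    infixl 6 _⊞_
    infixr 7 x⊠_ _⊠_

    _⊠_ : ∀ k {f} → Poly f → Poly (nat k * f)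
    _⊠_ zero {f} p    = resp (sym (zeroˡ f)) zero
    _⊠_ (suc k) {f} p = resp (begin
      f + nat k * f        ≈⟨ +-congʳ (*-identityˡ f) ⟨
      1# * f + nat k * f   ≈⟨ distribʳ f 1# (nat k) ⟨
      (1# + nat k) * f     ≈⟨ *-congʳ (nat-suc k) ⟨
      nat (suc k) * f      ∎) (p ⊞ k ⊠ p)

    -- V α, V β, V γ are polynomials in X, over which y is cubic by y³≈9Xz.
    record Cubic (w : Carrier) : Set where
      constructor cubicForm
      field
        {α β γ} : Carrier
        α-poly  : Poly α
        β-poly  : Poly β
        γ-poly  : Poly γ
        eq      : w ≈ V α + V β * y + V γ * (y * y)

    Cubic-resp : ∀ {w w′} → w ≈ w′ → Cubic w → Cubic w′
    Cubic-resp w≈w′ (cubicForm p p′ p″ eq) = cubicForm p p′ p″ (trans (sym w≈w′) eq)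

    Cubic-+ : ∀ {w w′} → Cubic w → Cubic w′ → Cubic (w + w′)
    Cubic-+ (cubicForm {α} {β} {γ} p₀ p₁ p₂ eq) (cubicForm {α′} {β′} {γ′} p₀′ p₁′ p₂′ eq′) =
      cubicForm (p₀ ⊞ p₀′) (p₁ ⊞ p₁′) (p₂ ⊞ p₂′) (trans (+-cong eq eq′) (trans
        (solve 7 (λ α β γ α′ β′ γ′ y → (α :+ β :* y :+ γ :* (y :* y)) :+ (α′ :+ β′ :* y :+ γ′ :* (y :* y))
           := (α :+ α′) :+ (β :+ β′) :* y :+ (γ :+ γ′) :* (y :* y)) refl (V α) (V β) (V γ) (V α′) (V β′) (V γ′) y)
        (sym (+-cong (+-cong (V-⊕ α α′) (*-congʳ (V-⊕ β β′))) (*-congʳ (V-⊕ γ γ′))))))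

    Cubic-nat : ∀ k {w} → Cubic w → Cubic (nat k * w)
    Cubic-nat k (cubicForm {α} {β} {γ} p₀ p₁ p₂ eq) =
      cubicForm (k ⊠ p₀) (k ⊠ p₁) (k ⊠ p₂) (trans (*-congˡ {nat k} eq) (trans
        (solve 5 (λ α β γ k y → k :* (α :+ β :* y :+ γ :* (y :* y)) := k :* α :+ k :* β :* y :+ k :* γ :* (y :* y))
             refl (V α) (V β) (V γ) (nat k) y)
        (sym (+-cong (+-cong (V-nat* k α) (*-congʳ (V-nat* k β))) (*-congʳ (V-nat* k γ))))))

    Cubic-y : ∀ {w} → Cubic w → Cubic (y * w)
    Cubic-y {w} (cubicForm {α} {β} {γ} p₀ p₁ p₂ eq) =
      -- The overflow γ y³ equals 9Xγ(y² + 3y + 3), whence 27, 27 and 9.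
      cubicForm (27 ⊠ x⊠ p₂) (p₀ ⊞ 27 ⊠ x⊠ p₂) (p₁ ⊞ 9 ⊠ x⊠ p₂) (begin
        y * w
          ≈⟨ *-congˡ eq ⟩
        y * (V α + V β * y + V γ * (y * y))
          ≈⟨ solve 4 (λ α β γ y → y :* (α :+ β :* y :+ γ :* (y :* y)) := α :* y :+ β :* (y :* y) :+ γ :* (y :* y :* y))
               refl (V α) (V β) (V γ) y ⟩
        V α * y + V β * (y * y) + V γ * (y * y * y)
          ≈⟨ +-congˡ (*-congˡ y³≈9Xz) ⟩
        V α * y + V β * (y * y) + V γ * (nat 9 * (X * z))
          ≈⟨ solve 5 (λ α β γ x y → α :* y :+ β :* (y :* y) :+ γ :* (:nat 9 :* (x :* (y :* y :+ :nat 3 :* y :+ :nat 3)))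
               := :nat 27 :* (x :* γ) :+ (α :+ :nat 27 :* (x :* γ)) :* y :+ (β :+ :nat 9 :* (x :* γ)) :* (y :* y)) refl (V α) (V β) (V γ) X y ⟩
        nat 27 * (X * V γ) + (V α + nat 27 * (X * V γ)) * y + (V β + nat 9 * (X * V γ)) * (y * y)
          ≈⟨ +-cong (+-cong (Vx 27) (*-congʳ (trans (V-⊕ α _) (+-congˡ (Vx 27))))) (*-congʳ (trans (V-⊕ β _) (+-congˡ (Vx 9)))) ⟨
        V (nat 27 * (x * γ)) + V (α + nat 27 * (x * γ)) * y + V (β + nat 9 * (x * γ)) * (y * y) ∎)
      where
      Vx : ∀ k → V (nat k * (x * γ)) ≈ nat k * (X * V γ)
      Vx k = trans (V-nat* k (x * γ)) (*-congˡ {nat k} (V-⊛ x γ))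

    Cubic-x : ∀ {w} → Cubic w → Cubic (x * w)
    Cubic-x {w} c = Cubic-resp (begin
      y * (y * (y * w)) + nat 3 * (y * (y * w)) + nat 3 * (y * w)
        ≈⟨ solve 2 (λ y w → y :* (y :* (y :* w)) :+ :nat 3 :* (y :* (y :* w)) :+ :nat 3 :* (y :* w)
             := y :* (y :* y :+ :nat 3 :* y :+ :nat 3) :* w) refl y w ⟩
      y * z * w  ≈⟨ *-congʳ x≈yz ⟨
      x * w      ∎)
      (Cubic-+ (Cubic-+ (Cubic-y (Cubic-y (Cubic-y c))) (Cubic-nat 3 (Cubic-y (Cubic-y c)))) (Cubic-nat 3 (Cubic-y c)))

    Poly⇒Cubic : ∀ {f} → Poly f → Cubic f
    Poly⇒Cubic zero = cubicForm zero zero zero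
      (trans (solve 1 (λ y → :nat 0 := :nat 0 :+ :nat 0 :* y :+ :nat 0 :* (y :* y)) refl y)
             (sym (+-cong (+-cong (V-nat 0) (*-congʳ (V-nat 0))) (*-congʳ (V-nat 0)))))
    Poly⇒Cubic one = cubicForm one zero zero
      (trans (solve 1 (λ y → :nat 1 := :nat 1 :+ :nat 0 :* y :+ :nat 0 :* (y :* y)) refl y)
             (sym (+-cong (+-cong (V-nat 1) (*-congʳ (V-nat 0))) (*-congʳ (V-nat 0)))))
    Poly⇒Cubic (p ⊞ p′)      = Cubic-+ (Poly⇒Cubic p) (Poly⇒Cubic p′)
    Poly⇒Cubic (x⊠ p)        = Cubic-x (Poly⇒Cubic p)
    Poly⇒Cubic (resp f≈g p)  = Cubic-resp f≈g (Poly⇒Cubic p)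

    PolyMultiple : Carrier → Carrier → Set
    PolyMultiple d w = ∃ λ f → Poly f × w ≈ d * f

    U₂-Cubic : ∀ {w} → Cubic w → PolyMultiple D (U 2 w)
    U₂-Cubic {w} (cubicForm {α} {β} {γ} p₀ p₁ p₂ eq) = _ , p₁ ⊞ 3 ⊠ p₂ ⊞ 9 ⊠ x⊠ p₂ , (begin
      U 2 w
        ≈⟨ U-cong 2 eq ⟩
      U 2 (V α) + U 2 (V β * y) + U 2 (V γ * (y * y))
        ≈⟨ +-cong (+-cong (U₂-V α) (trans (U-V* 2 2≤2 β y) (*-congˡ U₂y))) (trans (U-V* 2 2≤2 γ (y * y)) (*-congˡ U₂y²)) ⟩
      0# + β * D + γ * (nat 3 * (D * (1# + nat 3 * x)))
        ≈⟨ solve 4 (λ β γ d x → :nat 0 :+ β :* d :+ γ :* (:nat 3 :* (d :* (:nat 1 :+ :nat 3 :* x)))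
             := d :* (β :+ :nat 3 :* γ :+ :nat 9 :* (x :* γ))) refl β γ D x ⟩
      D * (β + nat 3 * γ + nat 9 * (x * γ)) ∎)

    Cubic-u : ∀ {f} → Poly f → Cubic (u * f)
    Cubic-u {f} p = Cubic-resp (solve 2 (λ y f → f :+ y :* f := (:nat 1 :+ y) :* f) refl y f)
                               (Cubic-+ (Poly⇒Cubic p) (Cubic-y (Poly⇒Cubic p)))

    y³*≈9X : ∀ w → y * y * y * w ≈ nat 9 * (X * (y * (y * w) + nat 3 * (y * w) + nat 3 * w))
    y³*≈9X w = begin
      y * y * y * w          ≈⟨ *-congʳ y³≈9Xz ⟩
      nat 9 * (X * z) * w
        ≈⟨ solve 3 (λ x y w → :nat 9 :* (x :* (y :* y :+ :nat 3 :* y :+ :nat 3)) :* w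
             := :nat 9 :* (x :* (y :* (y :* w) :+ :nat 3 :* (y :* w) :+ :nat 3 :* w))) refl X y w ⟩
      nat 9 * (X * (y * (y * w) + nat 3 * (y * w) + nat 3 * w)) ∎

    -- The numerical factors and `X` leave `U 2` unharmed, `X` as `x`; the powers of 3 visible
    -- before extraction thus survive it.
    U₂-combination : ∀ k {w₁ w₂} → Cubic w₁ → Cubic w₂ → ∃ λ f₁ → ∃ λ f₂ → Poly f₁ × Poly f₂ ×
      U 2 (nat k * w₁ + nat 9 * (X * w₂)) ≈ nat k * (D * f₁) + nat 9 * (x * (D * f₂))
    U₂-combination k {w₁} {w₂} c₁ c₂ =
      let (f₁ , p₁ , eq₁) = U₂-Cubic c₁
          (f₂ , p₂ , eq₂) = U₂-Cubic c₂
      in f₁ , f₂ , p₁ , p₂ , (begin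
      U 2 (nat k * w₁ + nat 9 * (X * w₂))
        ≈⟨ U-+ 2 (nat k * w₁) (nat 9 * (X * w₂)) ⟩
      U 2 (nat k * w₁) + U 2 (nat 9 * (X * w₂))
        ≈⟨ +-cong (U-nat* 2 2≤2 k w₁) (trans (U-nat* 2 2≤2 9 (X * w₂)) (*-congˡ {nat 9} (U-V* 2 2≤2 x w₂))) ⟩
      nat k * U 2 w₁ + nat 9 * (x * U 2 w₂)
        ≈⟨ +-cong (*-congˡ {nat k} eq₁) (*-congˡ {nat 9} (*-congˡ {x} eq₂)) ⟩
      nat k * (D * f₁) + nat 9 * (x * (D * f₂)) ∎)

    -- The 3 comes from x = y³ + 3y² + 3y, whose leading term is a multiple of 9 by the cubic
    -- relation.
    ux-expansion : ∀ f → let w = u * f; w₁ = y * w + y * (y * w); w₂ = y * (y * w) + nat 3 * (y * w) + nat 3 * w in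
                   u * x * f ≈ nat 3 * w₁ + nat 9 * (X * w₂)
    ux-expansion f = begin
      u * x * f        ≈⟨ *-congʳ {f} (*-congˡ {u} x≈yz) ⟩
      u * (y * z) * f
        ≈⟨ solve 3 (λ u y f → u :* (y :* (y :* y :+ :nat 3 :* y :+ :nat 3)) :* f
             := :nat 3 :* (y :* (u :* f) :+ y :* (y :* (u :* f))) :+ y :* y :* y :* (u :* f)) refl u y f ⟩
      nat 3 * (y * (u * f) + y * (y * (u * f))) + y * y * y * (u * f)
        ≈⟨ +-congˡ (y³*≈9X (u * f)) ⟩
      nat 3 * (y * (u * f) + y * (y * (u * f))) + nat 9 * (X * (y * (y * (u * f)) + nat 3 * (y * (u * f)) + nat 3 * (u * f))) ∎

    U₂-ux : ∀ {f} → Poly f → PolyMultiple (nat 3 * D) (U 2 (u * x * f))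
    U₂-ux {f} p =
      let c = Cubic-u p
          (f₁ , f₂ , p₁ , p₂ , eq) = U₂-combination 3
            (Cubic-+ (Cubic-y c) (Cubic-y (Cubic-y c)))
            (Cubic-+ (Cubic-+ (Cubic-y (Cubic-y c)) (Cubic-nat 3 (Cubic-y c))) (Cubic-nat 3 c))
      in f₁ + nat 3 * (x * f₂) , p₁ ⊞ 3 ⊠ x⊠ p₂ , (begin
      U 2 (u * x * f)
        ≈⟨ U-cong 2 (ux-expansion f) ⟩
      _ ≈⟨ eq ⟩
      nat 3 * (D * f₁) + nat 9 * (x * (D * f₂))
        ≈⟨ solve 4 (λ d f₁ f₂ x → :nat 3 :* (d :* f₁) :+ :nat 9 :* (x :* (d :* f₂)) := :nat 3 :* d :* (f₁ :+ :nat 3 :* (x :* f₂)))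
             refl D f₁ f₂ x ⟩
      nat 3 * D * (f₁ + nat 3 * (x * f₂)) ∎)

    -- Since z x = y z² and y z² = y³(y² + 6y + 15) + 9(2y² + y), every term is a multiple of 9 once
    -- y³ is replaced.
    uzx-expansion : ∀ f → let w = u * f; w₁ = nat 2 * (y * (y * w)) + y * w; s = y * (y * w) + nat 6 * (y * w) + nat 15 * w
                              w₂ = y * (y * s) + nat 3 * (y * s) + nat 3 * s in
                    u * z * (x * f) ≈ nat 9 * w₁ + nat 9 * (X * w₂)
    uzx-expansion f = begin
      u * z * (x * f)        ≈⟨ *-congˡ {u * z} (*-congʳ {f} x≈yz) ⟩
      u * z * (y * z * f)
        ≈⟨ solve 3 (λ u y f → let w = u :* f ; z = y :* y :+ :nat 3 :* y :+ :nat 3 in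
             u :* z :* (y :* z :* f)
             := :nat 9 :* (:nat 2 :* (y :* (y :* w)) :+ y :* w)
                :+ y :* y :* y :* (y :* (y :* w) :+ :nat 6 :* (y :* w) :+ :nat 15 :* w)) refl u y f ⟩
      nat 9 * w₁ + y * y * y * s
        ≈⟨ +-congˡ (y³*≈9X s) ⟩
      nat 9 * w₁ + nat 9 * (X * (y * (y * s) + nat 3 * (y * s) + nat 3 * s)) ∎
      where
      w w₁ s : Carrier
      w  = u * f
      w₁ = nat 2 * (y * (y * w)) + y * w
      s  = y * (y * w) + nat 6 * (y * w) + nat 15 * w

    U₂-uzx : ∀ {f} → Poly f → PolyMultiple (nat 9 * D) (U 2 (u * z * (x * f)))
    U₂-uzx {f} p =
      let c   = Cubic-u p
          yc  = Cubic-y c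
          y²c = Cubic-y yc
          s   = Cubic-+ (Cubic-+ y²c (Cubic-nat 6 yc)) (Cubic-nat 15 c)
          (f₁ , f₂ , p₁ , p₂ , eq) = U₂-combination 9
            (Cubic-+ (Cubic-nat 2 y²c) yc)
            (Cubic-+ (Cubic-+ (Cubic-y (Cubic-y s)) (Cubic-nat 3 (Cubic-y s))) (Cubic-nat 3 s))
      in f₁ + x * f₂ , p₁ ⊞ x⊠ p₂ , (begin
      U 2 (u * z * (x * f))
        ≈⟨ U-cong 2 (uzx-expansion f) ⟩
      _ ≈⟨ eq ⟩
      nat 9 * (D * f₁) + nat 9 * (x * (D * f₂))
        ≈⟨ solve 4 (λ d f₁ f₂ x → :nat 9 :* (d :* f₁) :+ :nat 9 :* (x :* (d :* f₂)) := :nat 9 :* d :* (f₁ :+ x :* f₂))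
             refl D f₁ f₂ x ⟩
      nat 9 * D * (f₁ + x * f₂) ∎)

    -- The constant polynomial is the delicate case. There u z = y³ + 4y² + 6y + 3 has no factor 9;
    -- it appears only after extraction, where the last 3 disappears and 4y² + 6y contributes (4 · 3
    -- + 6) `D` = 18 `D` to the constant part.
    U₂-uz : ∀ {f} → Poly f → PolyMultiple (nat 9 * D) (U 2 (u * z * f))
    U₂-uz zero = _ , zero , trans (U-cong 2 (zeroʳ (u * z))) (trans (pointwise λ _ → R.refl) (sym (zeroʳ _)))
    -- The contributions add up to (18 + 90x + 81x²) `D`.
    U₂-uz one = _ , 2 ⊠ one ⊞ 10 ⊠ x⊠ one ⊞ 9 ⊠ x⊠ x⊠ one , (begin
      U 2 (u * z * 1#)
        ≈⟨ U-cong 2 (solve 1 (λ y → (:nat 1 :+ y) :* (y :* y :+ :nat 3 :* y :+ :nat 3) :* :nat 1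
             := y :* y :* y :+ :nat 4 :* (y :* y) :+ :nat 6 :* y :+ :nat 3) refl y) ⟩
      U 2 (y * y * y) + U 2 (nat 4 * (y * y)) + U 2 (nat 6 * y) + U 2 (nat 3)
        ≈⟨ +-cong (+-cong (+-cong U₂y³ (trans (U-nat* 2 2≤2 4 _) (*-congˡ {nat 4} U₂y²)))
                          (trans (U-nat* 2 2≤2 6 y) (*-congˡ {nat 6} U₂y))) U₂3 ⟩
      nat 9 * (x * (nat 3 * (D * (1# + nat 3 * x)) + nat 3 * D + 0#)) + nat 4 * (nat 3 * (D * (1# + nat 3 * x))) + nat 6 * D + 0#
        ≈⟨ solve 2 (λ d x → let e = :nat 3 :* (d :* (:nat 1 :+ :nat 3 :* x)) in
             :nat 9 :* (x :* (e :+ :nat 3 :* d :+ :nat 0)) :+ :nat 4 :* e :+ :nat 6 :* d :+ :nat 0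
             := :nat 9 :* d :* (:nat 2 :* :nat 1 :+ :nat 10 :* (x :* :nat 1) :+ :nat 9 :* (x :* (x :* :nat 1)))) refl D x ⟩
      nat 9 * D * (nat 2 * 1# + nat 10 * (x * 1#) + nat 9 * (x * (x * 1#))) ∎)
      where
      U₂3 : U 2 (nat 3) ≈ 0#
      U₂3 = trans (U-cong 2 (sym (V-nat 3))) (U₂-V (nat 3))
      U₂y³ : U 2 (y * y * y) ≈ nat 9 * (x * (nat 3 * (D * (1# + nat 3 * x)) + nat 3 * D + 0#))
      U₂y³ = begin
        U 2 (y * y * y)               ≈⟨ U-cong 2 y³≈9Xz ⟩
        U 2 (nat 9 * (X * z))         ≈⟨ trans (U-nat* 2 2≤2 9 (X * z)) (*-congˡ {nat 9} (U-V* 2 2≤2 x z)) ⟩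
        nat 9 * (x * (U 2 (y * y) + U 2 (nat 3 * y) + U 2 (nat 3)))
          ≈⟨ *-congˡ {nat 9} (*-congˡ (+-cong (+-cong U₂y² (trans (U-nat* 2 2≤2 3 y) (*-congˡ {nat 3} U₂y))) U₂3)) ⟩
        nat 9 * (x * (nat 3 * (D * (1# + nat 3 * x)) + nat 3 * D + 0#)) ∎
    U₂-uz (_⊞_ {f} {g} p p′) =
      let (f₁ , p₁ , eq₁) = U₂-uz p
          (f₂ , p₂ , eq₂) = U₂-uz p′
      in f₁ + f₂ , p₁ ⊞ p₂ , trans (U-cong 2 (distribˡ (u * z) f g)) (trans (+-cong eq₁ eq₂) (sym (distribˡ _ f₁ f₂)))
    U₂-uz (x⊠ p) = U₂-uzx p
    U₂-uz (resp f≈g p) =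
      let (f₁ , p₁ , eq₁) = U₂-uz p
      in f₁ , p₁ , trans (U-cong 2 (*-congˡ {u * z} (sym f≈g))) eq₁

    27-cancel : ∀ f g → nat 27 * f ≈ nat 27 * g → f ≈ g
    27-cancel f g eq = 3-cancel f g (3-cancel _ _ (3-cancel _ _ (begin
      nat 3 * (nat 3 * (nat 3 * f))  ≈⟨ solve 1 (λ f → :nat 3 :* (:nat 3 :* (:nat 3 :* f)) := :nat 27 :* f) refl f ⟩
      nat 27 * f                     ≈⟨ eq ⟩
      nat 27 * g                     ≈⟨ solve 1 (λ f → :nat 3 :* (:nat 3 :* (:nat 3 :* f)) := :nat 27 :* f) refl g ⟨
      nat 3 * (nat 3 * (nat 3 * g))  ∎)))

    -- They differ only in P³ against (V P)³. `Godd` is a 27th of `P * D`, which is the first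
    -- extraction of the generating function.
    Geven Godd : Carrier
    Geven = a * (l * l * l) * (v * v * v) * (P * P * P)
    Godd  = a * (l * l * l) * (v * v * v) * (V P * V P * V P)

    -- As b P³ = V P, the generating function of cφ₃ is `u` up to a series in q³.
    aP³≈VPu : a * (P * P * P) ≈ V P * u
    aP³≈VPu = begin
      a * (P * P * P)       ≈⟨ *-congʳ bu≈a ⟨
      b * u * (P * P * P)
        ≈⟨ solve 4 (λ e p p₃ u → e :* e :* e :* p₃ :* u :* (p :* p :* p) := e :* p :* (e :* p) :* (e :* p) :* (p₃ :* u))
             refl E P (V P) u ⟩
      E * P * (E * P) * (E * P) * (V P * u)
        ≈⟨ *-congʳ (*-cong (*-cong EP≈1 EP≈1) EP≈1) ⟩
      1# * 1# * 1# * (V P * u)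
        ≈⟨ solve 1 (λ w → :nat 1 :* :nat 1 :* :nat 1 :* w := w) refl (V P * u) ⟩
      V P * u               ∎

    VP³l≈P : V P * V P * V P * l ≈ P
    VP³l≈P = begin
      V P * V P * V P * l
        ≈⟨ solve 3 (λ e₃ p₃ p → p₃ :* p₃ :* p₃ :* (e₃ :* e₃ :* e₃ :* p) := e₃ :* p₃ :* (e₃ :* p₃) :* (e₃ :* p₃) :* p)
             refl (V E) (V P) P ⟩
      V E * V P * (V E * V P) * (V E * V P) * P
        ≈⟨ *-congʳ (*-cong (*-cong VEP≈1 VEP≈1) VEP≈1) ⟩
      1# * 1# * 1# * P
        ≈⟨ solve 1 (λ w → :nat 1 :* :nat 1 :* :nat 1 :* w := w) refl P ⟩
      P ∎

    PD≈27Godd : P * D ≈ nat 27 * Godd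
    PD≈27Godd = begin
      P * D
        ≈⟨ *-congʳ VP³l≈P ⟨
      V P * V P * V P * l * D
        ≈⟨ solve 4 (λ p₃ l a v → p₃ :* p₃ :* p₃ :* l :* (:nat 27 :* (a :* (l :* l) :* (v :* v :* v)))
             := :nat 27 :* (a :* (l :* l :* l) :* (v :* v :* v) :* (p₃ :* p₃ :* p₃))) refl (V P) l a v ⟩
      nat 27 * Godd ∎

    U₂-aP³ : U 2 (a * (P * P * P)) ≈ nat 27 * Godd
    U₂-aP³ = begin
      U 2 (a * (P * P * P))  ≈⟨ U-cong 2 aP³≈VPu ⟩
      U 2 (V P * u)          ≈⟨ U-V* 2 2≤2 P u ⟩
      P * U 2 u              ≈⟨ *-congˡ (trans (U-+ 2 1# y) (+-cong (trans (U-cong 2 (sym (V-nat 1))) (U₂-V 1#)) U₂y)) ⟩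
      P * (0# + D)           ≈⟨ *-congˡ (+-identityˡ D) ⟩
      P * D                  ≈⟨ PD≈27Godd ⟩
      nat 27 * Godd          ∎

    -- Class 1 is class 2 after multiplication by q, and 27 q l³/b³ is `x`, so 27 q `Geven` is the
    -- generating function times `x`. The borrowed 27 is the one that `PD≈27Godd` returns.
    U₁-Geven : ∀ {f} → Poly f → PolyMultiple (nat 3 * Godd) (U 1 (Geven * f))
    U₁-Geven {f} p =
      let (g , p′ , eq) = U₂-ux p
      in g , p′ , 27-cancel _ _ (begin
        nat 27 * U 1 (Geven * f)
          ≈⟨ *-congˡ {nat 27} (U₂-q* (Geven * f)) ⟨
        nat 27 * U 2 (q * (Geven * f))
          ≈⟨ U-nat* 2 2≤2 27 (q * (Geven * f)) ⟨
        U 2 (nat 27 * (q * (Geven * f)))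
          ≈⟨ U-cong 2 (solve 6 (λ q a l v p f → :nat 27 :* (q :* (a :* l :* (v :* v :* v) :* p :* f))
               := a :* p :* (:nat 27 :* (q :* l) :* (v :* v :* v) :* f)) refl q a (l * l * l) v (P * P * P) f) ⟩
        U 2 (a * (P * P * P) * (x * f))
          ≈⟨ U-cong 2 (trans (*-congʳ {x * f} aP³≈VPu)
               (solve 4 (λ p u x f → p :* u :* (x :* f) := p :* (u :* x :* f)) refl (V P) u x f)) ⟩
        U 2 (V P * (u * x * f))
          ≈⟨ trans (U-V* 2 2≤2 P (u * x * f)) (*-congˡ {P} eq) ⟩
        P * (nat 3 * D * g)
          ≈⟨ solve 3 (λ p d g → p :* (:nat 3 :* d :* g) := p :* d :* (:nat 3 :* g)) refl P D g ⟩
        P * D * (nat 3 * g)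
          ≈⟨ *-congʳ {nat 3 * g} PD≈27Godd ⟩
        nat 27 * Godd * (nat 3 * g)
          ≈⟨ solve 2 (λ d g → :nat 27 :* d :* (:nat 3 :* g) := :nat 27 :* (:nat 3 :* d :* g)) refl Godd g ⟩
        nat 27 * (nat 3 * Godd * g) ∎)

    -- The relations l³ = V l · M and 3M = b² z turn everything but `u * z` into a series in q³; the
    -- 3 is the one attached to `M`.
    3Godd≈V*uz : nat 3 * Godd ≈ V (l * (P * P * P)) * (u * z)
    3Godd≈V*uz = begin
      nat 3 * (a * (l * l * l) * (v * v * v) * (V P * V P * V P))
        ≈⟨ *-congˡ {nat 3} (*-congʳ (*-congʳ (*-cong (sym bu≈a) l³≈VlM))) ⟩
      nat 3 * (b * u * (V l * M) * (v * v * v) * (V P * V P * V P))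
        ≈⟨ solve 6 (λ b u l m v p → :nat 3 :* (b :* u :* (l :* m) :* (v :* v :* v) :* p) := l :* p :* (u :* (b :* (:nat 3 :* m) :* (v :* v :* v))))
             refl b u (V l) M v (V P * V P * V P) ⟩
      V l * (V P * V P * V P) * (u * (b * (nat 3 * M) * (v * v * v)))
        ≈⟨ *-congˡ (*-congˡ {u} (*-congʳ (*-congˡ {b} 3M≈b²z))) ⟩
      V l * (V P * V P * V P) * (u * (b * (b * b * z) * (v * v * v)))
        ≈⟨ *-congˡ (*-congˡ {u} (sym (÷b³ z _ (solve 2 (λ b z → b :* b :* b :* z := b :* (b :* b :* z)) refl b z)))) ⟩
      V l * (V P * V P * V P) * (u * z)
        ≈⟨ *-congʳ (trans (V-⊛ l (P * P * P)) (*-congˡ (V-cube P))) ⟨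
      V (l * (P * P * P)) * (u * z) ∎

    -- The constant is 81 = 9 · 27 / 3, with 9 from `U₂-uz`, 27 from `D` and the 3 from
    -- `3Godd≈V*uz`.
    U₂-Godd : ∀ {f} → Poly f → PolyMultiple (nat 81 * Geven) (U 2 (Godd * f))
    U₂-Godd {f} p =
      let (g , p′ , eq) = U₂-uz p
      in g , p′ , 3-cancel _ _ (begin
        nat 3 * U 2 (Godd * f)
          ≈⟨ U-nat* 2 2≤2 3 (Godd * f) ⟨
        U 2 (nat 3 * (Godd * f))
          ≈⟨ U-cong 2 (trans (sym (*-assoc (nat 3) Godd f)) (trans (*-congʳ {f} 3Godd≈V*uz) (*-assoc _ (u * z) f))) ⟩
        U 2 (V (l * (P * P * P)) * (u * z * f))
          ≈⟨ trans (U-V* 2 2≤2 (l * (P * P * P)) (u * z * f)) (*-congˡ {l * (P * P * P)} eq) ⟩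
        l * (P * P * P) * (nat 9 * D * g)
          ≈⟨ solve 5 (λ a l v p g → l :* p :* (:nat 9 :* (:nat 27 :* (a :* (l :* l) :* (v :* v :* v))) :* g)
               := :nat 3 :* (:nat 81 :* (a :* (l :* l :* l) :* (v :* v :* v) :* p) :* g)) refl a l v (P * P * P) g ⟩
        nat 3 * (nat 81 * Geven * g) ∎)

    -- Expansions modulo 9

    record NoU₂Mod9 (f : Carrier) : Set where
      constructor noU₂
      field
        {f₀ f₁ rest} : Carrier
        eq : f ≈ V f₀ + nat 3 * (q * V f₁) + nat 9 * rest

    record OnlyU₀Mod9 (f : Carrier) : Set where
      constructor onlyU₀
      field
        {f₀ rest} : Carrier
        eq : f ≈ V f₀ + nat 9 * rest

    only⇒noU₂ : ∀ {f} → OnlyU₀Mod9 f → NoU₂Mod9 f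
    only⇒noU₂ (onlyU₀ {f₀} {g} eq) = noU₂ {f₁ = 0#} (trans eq (trans
      (solve 3 (λ a g q → a :+ :nat 9 :* g := a :+ :nat 3 :* (q :* :nat 0) :+ :nat 9 :* g) refl (V f₀) g q)
      (+-congʳ (+-congˡ (*-congˡ {nat 3} (*-congˡ {q} (sym (V-nat 0))))))))

    -- The coefficient 3 of the class 1 part is essential: the q² term of a product then carries 9.
    noU₂-* : ∀ {f g} → NoU₂Mod9 f → NoU₂Mod9 g → NoU₂Mod9 (f * g)
    noU₂-* (noU₂ {f₀} {f₁} {r} eq) (noU₂ {g₀} {g₁} {s} eq′) = noU₂ {f₁ = f₀ * g₁ + f₁ * g₀} (trans (*-cong eq eq′) (trans
      (solve 7 (λ f₀ f₁ r g₀ g₁ s q → (f₀ :+ :nat 3 :* (q :* f₁) :+ :nat 9 :* r) :* (g₀ :+ :nat 3 :* (q :* g₁) :+ :nat 9 :* s)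
         := f₀ :* g₀ :+ :nat 3 :* (q :* (f₀ :* g₁ :+ f₁ :* g₀))
            :+ :nat 9 :* ((q :* f₁) :* (q :* g₁) :+ r :* (g₀ :+ :nat 3 :* (q :* g₁) :+ :nat 9 :* s) :+ (f₀ :+ :nat 3 :* (q :* f₁)) :* s))
         refl (V f₀) (V f₁) r (V g₀) (V g₁) s q)
      (+-congʳ (+-cong (sym (V-⊛ f₀ g₀)) (*-congˡ {nat 3} (*-congˡ {q} (sym
        (trans (V-⊕ (f₀ * g₁) (f₁ * g₀)) (+-cong (V-⊛ f₀ g₁) (V-⊛ f₁ g₀))))))))))

    only-* : ∀ {f g} → OnlyU₀Mod9 f → OnlyU₀Mod9 g → OnlyU₀Mod9 (f * g)
    only-* (onlyU₀ {f₀} {r} eq) (onlyU₀ {g₀} {s} eq′) = onlyU₀ (trans (*-cong eq eq′) (trans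
      (solve 4 (λ f₀ r g₀ s → (f₀ :+ :nat 9 :* r) :* (g₀ :+ :nat 9 :* s)
         := f₀ :* g₀ :+ :nat 9 :* (r :* (g₀ :+ :nat 9 :* s) :+ f₀ :* s)) refl (V f₀) r (V g₀) s)
      (+-congʳ (sym (V-⊛ f₀ g₀)))))

    only-+ : ∀ {f g} → OnlyU₀Mod9 f → OnlyU₀Mod9 g → OnlyU₀Mod9 (f + g)
    only-+ (onlyU₀ {f₀} {r} eq) (onlyU₀ {g₀} {s} eq′) = onlyU₀ (trans (+-cong eq eq′) (trans
      (solve 4 (λ f₀ r g₀ s → (f₀ :+ :nat 9 :* r) :+ (g₀ :+ :nat 9 :* s) := (f₀ :+ g₀) :+ :nat 9 :* (r :+ s))
           refl (V f₀) r (V g₀) s)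
      (+-congʳ (sym (V-⊕ f₀ g₀)))))

    only-V : ∀ f → OnlyU₀Mod9 (V f)
    only-V f = onlyU₀ {rest = 0#} (solve 1 (λ f → f := f :+ :nat 9 :* :nat 0) refl (V f))

    only-9 : ∀ {f} g → f ≈ nat 9 * g → OnlyU₀Mod9 f
    only-9 g eq = onlyU₀ {f₀ = 0#} (trans eq (trans (solve 1 (λ g → :nat 9 :* g := :nat 0 :+ :nat 9 :* g)
         refl g) (+-congʳ (sym (V-nat 0)))))

    only-resp : ∀ {f g} → f ≈ g → OnlyU₀Mod9 f → OnlyU₀Mod9 g
    only-resp f≈g (onlyU₀ eq) = onlyU₀ (trans (sym f≈g) eq)

    noU₂-resp : ∀ {f g} → f ≈ g → NoU₂Mod9 f → NoU₂Mod9 g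
    noU₂-resp f≈g (noU₂ {f₁ = f₁} eq) = noU₂ {f₁ = f₁} (trans (sym f≈g) eq)

    -- `x` carries a factor 27, so modulo 9 only the constant term remains.
    Poly⇒only : ∀ {f} → Poly f → OnlyU₀Mod9 f
    Poly⇒only zero = only-resp (V-nat 0) (only-V 0#)
    Poly⇒only one  = only-resp (V-nat 1) (only-V 1#)
    Poly⇒only (p ⊞ p′) = only-+ (Poly⇒only p) (Poly⇒only p′)
    Poly⇒only (x⊠_ {f} p) = only-9 (nat 3 * (q * (l * l * l) * (v * v * v) * f))
      (solve 4 (λ q l v f → :nat 27 :* (q :* l) :* v :* f := :nat 9 :* (:nat 3 :* (q :* l :* v :* f)))
           refl q (l * l * l) (v * v * v) f)
    Poly⇒only (resp f≈g p) = only-resp f≈g (Poly⇒only p)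

    c : Carrier
    c = q * V l

    noU₂-a : NoU₂Mod9 a
    noU₂-a = noU₂ {f₁ = nat 2 * l} {rest = 0#} (trans a-dissection (trans
      (solve 3 (λ a q l → a :+ :nat 6 :* (q :* l) := a :+ :nat 3 :* (q :* (:nat 2 :* l)) :+ :nat 9 :* :nat 0) refl (V a) q (V l))
      (+-congʳ (+-congˡ (*-congˡ {nat 3} (*-congˡ {q} (sym (V-nat* 2 l))))))))

    noU₂-M : NoU₂Mod9 M
    noU₂-M = noU₂ {f₁ = a * l} (trans
      (solve 3 (λ a q l → let c = :nat 3 :* (q :* l) in a :* a :+ a :* c :+ c :* c
         := a :* a :+ :nat 3 :* (q :* (a :* l)) :+ :nat 9 :* ((q :* l) :* (q :* l))) refl (V a) q (V l))
      (+-congʳ (+-cong (sym (V-sq a)) (*-congˡ {nat 3} (*-congˡ {q} (sym (V-⊛ a l)))))))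

    -- Isolates in `M` the whole part of 1/`b` that is not a series in q³.
    v≈MW : v ≈ M * V (v * v * v)
    v≈MW = b-cancel _ _ (begin
      b * v                             ≈⟨ bv≈1 ⟩
      1#                                ≈⟨ trans (sym (V-nat 1)) (V-cong (solve 0 (:nat 1 := :nat 1 :* :nat 1 :* :nat 1) refl)) ⟩
      V (1# * 1# * 1#)                  ≈⟨ V-cong (*-cong (*-cong bv≈1 bv≈1) bv≈1) ⟨
      V (b * v * (b * v) * (b * v))     ≈⟨ V-cong (solve 2 (λ b v → b :* v :* (b :* v) :* (b :* v) := b :* b :* b :* (v :* v :* v))
           refl b v) ⟩
      V (b * b * b * (v * v * v))       ≈⟨ V-⊛ (b * b * b) (v * v * v) ⟩
      V (b * b * b) * V (v * v * v)     ≈⟨ *-congʳ bM≈Vb³ ⟨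
      b * M * V (v * v * v)             ≈⟨ *-assoc b M _ ⟩
      b * (M * V (v * v * v))           ∎)

    noU₂-v : NoU₂Mod9 v
    noU₂-v = noU₂-resp (sym v≈MW) (noU₂-* noU₂-M (only⇒noU₂ (only-V (v * v * v))))

    vVP≈P³ : v * V P ≈ P * P * P
    vVP≈P³ = begin
      P * P * P * V E * V P    ≈⟨ *-assoc (P * P * P) (V E) (V P) ⟩
      P * P * P * (V E * V P)  ≈⟨ *-congˡ {P * P * P} VEP≈1 ⟩
      P * P * P * 1#           ≈⟨ *-identityʳ _ ⟩
      P * P * P                ∎

    l³≈vV : l * l * l ≈ v * V (E ^ 9 * P)
    l³≈vV = begin
      l * l * l                     ≈⟨ solve 2 (λ e p → e :* e :* e :* p :* (e :* e :* e :* p) :* (e :* e :* e :* p) := (p :* p :* p) :* ((e :* e :* e) :* (e :* e :* e) :* (e :* e :* e)))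
           refl (V E) P ⟩
      P * P * P * (V E * V E * V E * (V E * V E * V E) * (V E * V E * V E))
                                    ≈⟨ *-cong (sym vVP≈P³) (sym (trans (V-cube (E * E * E)) (*-cong (*-cong (V-cube E) (V-cube E)) (V-cube E)))) ⟩
      v * V P * V (E * E * E * (E * E * E) * (E * E * E))
                                    ≈⟨ solve 3 (λ v p e → v :* p :* e := v :* (e :* p)) refl v (V P) _ ⟩
      v * (V (E * E * E * (E * E * E) * (E * E * E)) * V P)
                                    ≈⟨ *-congˡ (V-⊛ _ P) ⟨
      v * V (E * E * E * (E * E * E) * (E * E * E) * P)
                                    ≈⟨ *-congˡ (V-cong (solve 2 (λ e p → e :* e :* e :* (e :* e :* e) :* (e :* e :* e) :* p := e :^ 9 :* p)
                                         refl E P)) ⟩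
      v * V (E ^ 9 * P)             ∎

    -- Up to series in q³ every factor of `Geven` is `a` or `v`, because P³ = v V P and l³ = v
    -- V(E⁹P).
    noU₂-Geven : NoU₂Mod9 Geven
    noU₂-Geven = noU₂-* (noU₂-* (noU₂-* noU₂-a
        (noU₂-resp (sym l³≈vV) (noU₂-* noU₂-v (only⇒noU₂ (only-V _)))))
        (noU₂-* (noU₂-* noU₂-v noU₂-v) noU₂-v))
        (noU₂-resp vVP≈P³ (noU₂-* noU₂-v (only⇒noU₂ (only-V P))))

    -- With A = `V a`, the linear terms of A + 6c and A² + 3Ac + 9c² combine to (6 + 3)A²c, which
    -- vanishes modulo 9.
    only-aM : OnlyU₀Mod9 (a * M)
    only-aM = onlyU₀ (trans (*-congʳ a-dissection) (trans
      (solve 2 (λ a c → (a :+ :nat 6 :* c) :* (a :* a :+ a :* (:nat 3 :* c) :+ :nat 3 :* c :* (:nat 3 :* c))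
         := a :* a :* a :+ :nat 9 :* (a :* a :* c :+ :nat 3 :* (a :* c :* c) :+ :nat 6 :* (c :* c :* c))) refl (V a) c)
      (+-congʳ (sym (V-cube a)))))

    -- The cube of A² + 3h is A⁶ modulo 9, where A = `V a`.
    only-M³ : OnlyU₀Mod9 (M * M * M)
    only-M³ = onlyU₀ (trans
      (solve 2 (λ a c → let m = a :* a :+ a :* (:nat 3 :* c) :+ :nat 3 :* c :* (:nat 3 :* c) ; h = a :* c :+ :nat 3 :* (c :* c) in m :* m :* m
         := (a :* a) :* (a :* a) :* (a :* a) :+ :nat 9 :* ((a :* a) :* (a :* a) :* h :+ :nat 3 :* (a :* a :* h :* h) :+ :nat 3 :* (h :* h :* h))) refl (V a) c)
      (+-congʳ (sym (trans (V-cube (a * a)) (*-cong (*-cong (V-sq a) (V-sq a)) (V-sq a))))))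

    -- Up to series in q³ the product is a v⁴, that is a M⁴, and exactly four factors `M` allow the
    -- splitting (aM)(M³).
    only-Godd : OnlyU₀Mod9 Godd
    only-Godd = only-resp (begin
      a * M * (M * M * M) * (V w * V w * V w * V w * V (E ^ 9 * P) * V (P * P * P))
        ≈⟨ solve 5 (λ a m w e p → a :* m :* (m :* m :* m) :* (w :* w :* w :* w :* e :* p)
             := a :* (m :* w :* e) :* (m :* w :* (m :* w) :* (m :* w)) :* p) refl a M (V w) (V (E ^ 9 * P)) (V (P * P * P)) ⟩
      a * (M * V w * V (E ^ 9 * P)) * (M * V w * (M * V w) * (M * V w)) * V (P * P * P)
        ≈⟨ *-cong (*-cong (*-congˡ (*-congʳ v≈MW)) (*-cong (*-cong v≈MW v≈MW) v≈MW)) (sym (V-cube P)) ⟨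
      a * (v * V (E ^ 9 * P)) * (v * v * v) * (V P * V P * V P)
        ≈⟨ *-congʳ (*-congʳ (*-congˡ l³≈vV)) ⟨
      Godd ∎)
      (only-* (only-* only-aM only-M³)
              (only-* (only-* (only-* (only-* (only-* (only-V w) (only-V w)) (only-V w)) (only-V w)) (only-V _)) (only-V _)))
      where
      w : Carrier
      w = v * v * v

    Multiple : Carrier → Carrier → Set
    Multiple d w = ∃ λ f → w ≈ d * f

    U₂-Geven : ∀ {f} → Poly f → Multiple (nat 9) (U 2 (Geven * f))
    U₂-Geven {f} p =
      let noU₂ {f₀} {f₁} {rest} eq = noU₂-* noU₂-Geven (only⇒noU₂ (Poly⇒only p))
      in U 2 rest , (begin
      U 2 (Geven * f)
        ≈⟨ U-cong 2 eq ⟩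
      U 2 (V f₀) + U 2 (nat 3 * (q * V f₁)) + U 2 (nat 9 * rest)
        ≈⟨ +-cong (+-cong (U₂-V f₀) (trans (U-nat* 2 2≤2 3 (q * V f₁)) (*-congˡ {nat 3} (U₂-qV f₁)))) (U-nat* 2 2≤2 9 rest) ⟩
      0# + nat 3 * 0# + nat 9 * U 2 rest
        ≈⟨ solve 1 (λ r → :nat 0 :+ :nat 3 :* :nat 0 :+ :nat 9 :* r := :nat 9 :* r) refl (U 2 rest) ⟩
      nat 9 * U 2 rest ∎)

    U₁-Godd : ∀ {f} → Poly f → Multiple (nat 9) (U 1 (Godd * f))
    U₁-Godd {f} p =
      let onlyU₀ {f₀} {rest} eq = only-* only-Godd (Poly⇒only p)
      in U 1 rest , (begin
      U 1 (Godd * f)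
        ≈⟨ U-cong 1 eq ⟩
      U 1 (V f₀) + U 1 (nat 9 * rest)
        ≈⟨ +-cong (U₁-V f₀) (U-nat* 1 1≤2 9 rest) ⟩
      0# + nat 9 * U 1 rest
        ≈⟨ +-identityˡ _ ⟩
      nat 9 * U 1 rest ∎)

    -- Induction along the two families of progressions

    record Stage (e : ℕ) (G F : Carrier) : Set where
      constructor stage
      field
        {f}  : Carrier
        poly : Poly f
        eq   : F ≈ nat (3 ℕ.^ e) * (G * f)

    3^-* : ∀ m n w → nat (3 ℕ.^ m) * (nat (3 ℕ.^ n) * w) ≈ nat (3 ℕ.^ (n ℕ.+ m)) * w
    3^-* m n w = trans (sym (*-assoc (nat (3 ℕ.^ m)) (nat (3 ℕ.^ n)) w)) (*-congʳ {w}
      (trans (sym (nat-* (3 ℕ.^ m) (3 ℕ.^ n)))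
             (reflexive (≡.cong nat (≡.trans (≡.sym (ℕₚ.^-distribˡ-+-* 3 m n)) (≡.cong (3 ℕ.^_) (ℕₚ.+-comm m n)))))))

    next : ∀ r → r ℕ.≤ 2 → ∀ {e G F F′} d H (s : Stage e G F) → F′ ≈ U r F →
           PolyMultiple (nat (3 ℕ.^ d) * H) (U r (G * Stage.f s)) → Stage (d ℕ.+ e) H F′
    next r r≤2 {e} {G} {F} {F′} d H (stage {f} _ eq) F′≈ (g , p , step) = stage {f = g} p (begin
      F′                                          ≈⟨ F′≈ ⟩
      U r F                                       ≈⟨ U-cong r eq ⟩
      U r (nat (3 ℕ.^ e) * (G * f))               ≈⟨ U-nat* r r≤2 (3 ℕ.^ e) (G * f) ⟩
      nat (3 ℕ.^ e) * U r (G * f)                 ≈⟨ *-congˡ {nat (3 ℕ.^ e)} (trans step (*-assoc (nat (3 ℕ.^ d)) H g)) ⟩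
      nat (3 ℕ.^ e) * (nat (3 ℕ.^ d) * (H * g))   ≈⟨ 3^-* e d (H * g) ⟩
      nat (3 ℕ.^ (d ℕ.+ e)) * (H * g)             ∎)

    extra : ∀ r → r ℕ.≤ 2 → ∀ {e G F} (s : Stage e G F) → Multiple (nat 9) (U r (G * Stage.f s)) →
            Multiple (nat (3 ℕ.^ (2 ℕ.+ e))) (U r F)
    extra r r≤2 {e} {G} {F} (stage {f} _ eq) (g , step) = g , (begin
      U r F                              ≈⟨ U-cong r eq ⟩
      U r (nat (3 ℕ.^ e) * (G * f))      ≈⟨ U-nat* r r≤2 (3 ℕ.^ e) (G * f) ⟩
      nat (3 ℕ.^ e) * U r (G * f)        ≈⟨ *-congˡ {nat (3 ℕ.^ e)} step ⟩
      nat (3 ℕ.^ e) * (nat 9 * g)        ≈⟨ 3^-* e 2 g ⟩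
      nat (3 ℕ.^ (2 ℕ.+ e)) * g          ∎)

    module _
      (odd even : ℕ → Carrier)
      (odd-zero : odd 0 ≈ U 2 (a * (P * P * P)))
      (odd-suc  : ∀ k → odd (suc k) ≈ U 1 (even k))
      (even-U₂  : ∀ k → even k ≈ U 2 (odd k))
      where

      odd-stage  : ∀ k → Stage (5 ℕ.* k ℕ.+ 3) Godd (odd k)
      even-stage : ∀ k → Stage (5 ℕ.* k ℕ.+ 7) Geven (even k)
      odd-stage zero = stage one (trans odd-zero (trans U₂-aP³ (*-congˡ {nat 27} (sym (*-identityʳ Godd)))))
      odd-stage (suc k) = ≡.subst (λ e → Stage e Godd (odd (suc k))) (lemma k)
        (next 1 1≤2 1 Godd (even-stage k) (odd-suc k) (U₁-Geven (Stage.poly (even-stage k))))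
        where
        lemma : ∀ k → 1 ℕ.+ (5 ℕ.* k ℕ.+ 7) ≡ 5 ℕ.* suc k ℕ.+ 3
        lemma = ℕ-Solver.solve-∀
      even-stage k = ≡.subst (λ e → Stage e Geven (even k)) (lemma k)
        (next 2 2≤2 4 Geven (odd-stage k) (even-U₂ k) (U₂-Godd (Stage.poly (odd-stage k))))
        where
        lemma : ∀ k → 4 ℕ.+ (5 ℕ.* k ℕ.+ 3) ≡ 5 ℕ.* k ℕ.+ 7
        lemma = ℕ-Solver.solve-∀

      odd-multiple : ∀ k → Multiple (nat (3 ℕ.^ (5 ℕ.* k ℕ.+ 3))) (odd k)
      odd-multiple k = let stage {f} _ eq = odd-stage k in Godd * f , eq

      even-multiple : ∀ k → Multiple (nat (3 ℕ.^ (5 ℕ.* k ℕ.+ 7))) (even k)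
      even-multiple k = let stage {f} _ eq = even-stage k in Geven * f , eq

      U₁-odd-multiple : ∀ k → Multiple (nat (3 ℕ.^ (5 ℕ.* k ℕ.+ 5))) (U 1 (odd k))
      U₁-odd-multiple k = ≡.subst (λ e → Multiple (nat (3 ℕ.^ e)) (U 1 (odd k))) (lemma k)
        (extra 1 1≤2 (odd-stage k) (U₁-Godd (Stage.poly (odd-stage k))))
        where
        lemma : ∀ k → 2 ℕ.+ (5 ℕ.* k ℕ.+ 3) ≡ 5 ℕ.* k ℕ.+ 5
        lemma = ℕ-Solver.solve-∀

      U₂-even-multiple : ∀ k → Multiple (nat (3 ℕ.^ (5 ℕ.* k ℕ.+ 9))) (U 2 (even k))
      U₂-even-multiple k = ≡.subst (λ e → Multiple (nat (3 ℕ.^ e)) (U 2 (even k))) (lemma k)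
        (extra 2 2≤2 (even-stage k) (U₂-Geven (Stage.poly (even-stage k))))
        where
        lemma : ∀ k → 2 ℕ.+ (5 ℕ.* k ℕ.+ 7) ≡ 5 ℕ.* k ℕ.+ 9
        lemma = ℕ-Solver.solve-∀

-- Cubic theta functions

module Coefficients (R : CommutativeRing 0ℓ 0ℓ) where
  private
    module R = CommutativeRing R
    module Rₙ = IntegerSolver R
  open PowerSeries R
  open CommutativeRing ring[[X]]
  open IntegerSolver ring[[X]]

  -- `nat k` in the series ring is a sum of copies of the unit series; this gives access to its
  -- coefficients.
  nat≈const : ∀ k → nat k ≈ const (Rₙ.nat k)
  nat≈const zero    .at zero    = R.refl
  nat≈const zero    .at (suc _) = R.refl
  nat≈const (suc k) = trans (nat-suc k) (trans (+-congˡ {1#} (nat≈const k)) (trans (sym (const-+ R.1# (Rₙ.nat k))) (const-cong (R.sym (Rₙ.nat-suc k)))))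

  nat*-at : ∀ k f n → (nat k * f) n R.≈ Rₙ.nat k R.* f n
  nat*-at k f n = R.trans (at (*-congʳ {f} (nat≈const k)) n) (const-⊛ (Rₙ.nat k) f n)

  nat-cancel : ∀ k → (∀ x y → Rₙ.nat k R.* x R.≈ Rₙ.nat k R.* y → x R.≈ y) →
               ∀ f g → nat k * f ≈ nat k * g → f ≈ g
  nat-cancel k cancel f g eq .at n =
    cancel (f n) (g n) (R.trans (R.sym (nat*-at k f n)) (R.trans (at eq n) (nat*-at k g n)))

  -- Orders of vanishing add: at least n + 1 for `f` and at least 1 for `g`.
  vanishing-⊛ : ∀ f g n → (∀ m → m ℕ.≤ n → f m R.≈ R.0#) → g 0 R.≈ R.0# → (f * g) (suc n) R.≈ R.0#
  vanishing-⊛ f g n f≈0 g₀ = R.trans (⊛-tailʳ f g n)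
    (R.trans (R.+-cong (R.trans (⊛-congᵇ n f≈0 (λ _ _ → R.refl)) (⊛-zeroˡ (tail g) n))
                       (R.trans (R.*-congˡ g₀) (R.zeroʳ _)))
             (R.+-identityˡ _))

  -- Coefficient n + 1 of `V f` is zero or stems from the index (n + 1)/3, which is at most n.
  vanishing-V : ∀ f n → (∀ m → m ℕ.≤ n → f m R.≈ R.0#) → V f (suc n) R.≈ R.0#
  vanishing-V f zero          f≈0 = R.refl
  vanishing-V f (suc zero)    f≈0 = R.refl
  vanishing-V f (suc (suc n)) f≈0 = R.trans
    (V-congᵇ n (λ m m≤n → f≈0 (suc m) (s≤s (ℕₚ.m≤n⇒m≤1+n m≤n))))
    (R.trans (at (V-cong (nat≈const 0)) n) (R.trans (at (V-const R.0#) n) (const-0 n)))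
    where
    const-0 : ∀ n → const R.0# n R.≈ R.0#
    const-0 zero    = R.refl
    const-0 (suc _) = R.refl

module PrimitiveCubeRoots (R : CommutativeRing 0ℓ 0ℓ) where
  private
    module R = CommutativeRing R
    module Rₙ = IntegerSolver R
  open PowerSeries R
  open Coefficients R
  open CommutativeRing ring[[X]] hiding (zero)
  open import Algebra.Properties.Semiring.Exp R.semiring using () renaming (_^_ to _^ᵣ_; ^-homo-* to ^ᵣ-homo)

  Root : R.Carrier → Set
  Root c = R.1# R.+ c R.+ c R.* c R.≈ R.0#

  root-square : ∀ {c} → Root c → Root (c R.* c)
  root-square {c} root = R.trans
    (Rₙ.solve 1 (λ c → Rₙ.:nat 1 Rₙ.:+ c Rₙ.:* c Rₙ.:+ (c Rₙ.:* c) Rₙ.:* (c Rₙ.:* c)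
      Rₙ.:= (Rₙ.:nat 1 Rₙ.:+ c Rₙ.:+ c Rₙ.:* c) Rₙ.:* (Rₙ.:nat 1 Rₙ.:- c Rₙ.:+ c Rₙ.:* c)) R.refl c)
    (R.trans (R.*-congʳ root) (R.zeroˡ _))

  root-cube : ∀ {c} → Root c → c ^ᵣ 3 R.≈ R.1#
  root-cube {c} root = R.trans
    (Rₙ.solve 1 (λ c → c Rₙ.:^ 3 Rₙ.:= Rₙ.:nat 1 Rₙ.:+ (c Rₙ.:- Rₙ.:nat 1) Rₙ.:* (Rₙ.:nat 1 Rₙ.:+ c Rₙ.:+ c Rₙ.:* c)) R.refl c)
    (R.trans (R.+-congˡ (R.trans (R.*-congˡ root) (R.zeroʳ _))) (R.+-identityʳ _))

  root-pow : ∀ {c} → Root c → ∀ n → c ^ᵣ (n ℕ.* 3) R.≈ R.1#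
  root-pow root zero        = R.refl
  root-pow {c} root (suc n) =
    R.trans (^ᵣ-homo c 3 (n ℕ.* 3)) (R.trans (R.*-cong (root-cube root) (root-pow root n)) (R.*-identityˡ _))

  const-root : ∀ {c} → Root c → 1# + const c + const c * const c ≈ 0#
  const-root {c} root = trans
    (trans (+-cong (sym (const-+ R.1# c)) (sym (const-* c c))) (sym (const-+ (R.1# R.+ c) (c R.* c))))
    (trans (const-cong root) (sym (nat≈const 0)))

module CubicTheta
  (R : CommutativeRing 0ℓ 0ℓ)
  (E P : PowerSeries.Series R)
  (EP≈1 : PowerSeries._≋_ R (PowerSeries._⊛_ R E P) (PowerSeries.const R (CommutativeRing.1# R)))
  where
  private
    module R = CommutativeRing R
    module Rₙ = IntegerSolver R
  open PowerSeries R
  open Dissection R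
  open Coefficients R
  open PrimitiveCubeRoots R
  open EtaQuotients R E P EP≈1
  open CommutativeRing ring[[X]] hiding (zero)
  open IntegerSolver ring[[X]]
  open import Algebra.Properties.Semiring.Exp semiring using (_^_; ^-congˡ)
  open import Relation.Binary.Reasoning.Setoid setoid

  -- Lattice counting enters only through the hypotheses on residue classes, and the infinite
  -- product through `norm`. The single value `b-at-1` selects the right solution of the functional
  -- equation.
  module Identities
    (ω : R.Carrier)
    (ω-root : Root ω)
    (3-cancel : ∀ x y → Rₙ.nat 3 R.* x R.≈ Rₙ.nat 3 R.* y → x R.≈ y)
    (E₀ : E 0 R.≈ R.1#) (P₀ : P 0 R.≈ R.1#)
    (norm : E * σ ω E * σ (ω R.* ω) E * V (V E) ≈ V E ^ 4)
    (a : Carrier)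
    (a₀ : ∀ n → a (n ℕ.* 3) R.≈ a n)
    (a₁ : ∀ n → a (1 ℕ.+ n ℕ.* 3) R.≈ R.- (Rₙ.nat 2 R.* b (1 ℕ.+ n ℕ.* 3)))
    (a₂ : ∀ n → a (2 ℕ.+ n ℕ.* 3) R.≈ R.0#)
    (b₀ : ∀ n → b (n ℕ.* 3) R.≈ a n)
    (b₂ : ∀ n → b (2 ℕ.+ n ℕ.* 3) R.≈ R.0#)
    (b-at-1 : b 1 R.≈ R.- Rₙ.nat 3)
    where

    q κ C W : Carrier
    q = var
    κ n = R.- b (1 ℕ.+ n ℕ.* 3)
    C = q * V κ
    W = const ω

    C₀ : ∀ n → C (n ℕ.* 3) R.≈ R.0#
    C₀ zero    = var-⊛-zero (V κ)
    C₀ (suc n) = R.trans (var-⊛-suc (V κ) (2 ℕ.+ n ℕ.* 3)) (U₂V κ n)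

    C₁ : ∀ n → C (1 ℕ.+ n ℕ.* 3) R.≈ κ n
    C₁ n = R.trans (var-⊛-suc (V κ) (n ℕ.* 3)) (V-multiple κ n)

    C₂ : ∀ n → C (2 ℕ.+ n ℕ.* 3) R.≈ R.0#
    C₂ n = R.trans (var-⊛-suc (V κ) (1 ℕ.+ n ℕ.* 3)) (U₁V κ n)

    b+C≈Va : b + C ≈ V a
    b+C≈Va = residues-split
      (λ n → R.trans (R.+-cong (b₀ n) (C₀ n)) (R.trans (R.+-identityʳ _) (R.sym (V-multiple a n))))
      (λ n → R.trans (R.+-congˡ (C₁ n)) (R.trans (R.-‿inverseʳ _) (R.sym (U₁V a n))))
      (λ n → R.trans (R.+-cong (b₂ n) (C₂ n)) (R.trans (R.+-identityʳ _) (R.sym (U₂V a n))))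

    a≈Va+2C : a ≈ V a + nat 2 * C
    a≈Va+2C = residues-split
      (λ n → R.trans (a₀ n) (R.sym (R.trans (R.+-cong (V-multiple a n) (2C (n ℕ.* 3) (C₀ n)))
         (Rₙ.solve 1 (λ a → a Rₙ.:+ Rₙ.:nat 2 Rₙ.:* Rₙ.:nat 0 Rₙ.:= a) R.refl (a n)))))
      (λ n → R.trans (a₁ n) (R.sym (R.trans (R.+-cong (U₁V a n) (2C (1 ℕ.+ n ℕ.* 3) (C₁ n)))
         (Rₙ.solve 1 (λ b → Rₙ.:nat 0 Rₙ.:+ Rₙ.:nat 2 Rₙ.:* (Rₙ.:- b) Rₙ.:= Rₙ.:- (Rₙ.:nat 2 Rₙ.:* b))
              R.refl (b (1 ℕ.+ n ℕ.* 3))))))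
      (λ n → R.trans (a₂ n) (R.sym (R.trans (R.+-cong (U₂V a n) (2C (2 ℕ.+ n ℕ.* 3) (C₂ n)))
         (Rₙ.solve 0 (Rₙ.:nat 0 Rₙ.:+ Rₙ.:nat 2 Rₙ.:* Rₙ.:nat 0 Rₙ.:= Rₙ.:nat 0) R.refl))))
      where
      2C : ∀ m {x} → C m R.≈ x → (nat 2 * C) m R.≈ Rₙ.nat 2 R.* x
      2C m eq = R.trans (nat*-at 2 C m) (R.*-congˡ eq)

    σC : ∀ c → Root c → σ c C ≈ const c * C
    σC c eq = trans (σ-⊛ c q (V κ)) (trans (*-cong (σ-var c) (σ-V c (root-cube eq) κ)) (*-assoc (const c) q (V κ)))

    σb : ∀ c → Root c → σ c b ≈ σ c E * σ c E * σ c E * V P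
    σb c eq = trans (σ-⊛ c (E * E * E) (V P)) (*-cong (trans (σ-⊛ c (E * E) E) (*-congʳ {σ c E} (σ-⊛ c E E))) (σ-V c (root-cube eq) P))

    σb-dissection : ∀ c → Root c → σ c b ≈ V a - const c * C
    σb-dissection c eq = begin
      σ c b
        ≈⟨ solve 2 (λ b c → b := b :+ c :- c) refl (σ c b) (const c * C) ⟩
      σ c b + const c * C - const c * C
        ≈⟨ +-congʳ (+-congˡ (σC c eq)) ⟨
      σ c b + σ c C - const c * C
        ≈⟨ +-congʳ (trans (sym (σ-⊕ c b C)) (trans (σ-cong c b+C≈Va) (σ-V c (root-cube eq) a))) ⟩
      V a - const c * C ∎

    E-norm : E * σ ω E * σ (ω R.* ω) E ≈ V E ^ 4 * V (V P)
    E-norm = begin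
      E * σ ω E * σ (ω R.* ω) E
        ≈⟨ *-identityʳ _ ⟨
      E * σ ω E * σ (ω R.* ω) E * 1#
        ≈⟨ *-congˡ VVEP≈1 ⟨
      E * σ ω E * σ (ω R.* ω) E * (V (V E) * V (V P))
        ≈⟨ *-assoc _ (V (V E)) (V (V P)) ⟨
      E * σ ω E * σ (ω R.* ω) E * V (V E) * V (V P)
        ≈⟨ *-congʳ norm ⟩
      V E ^ 4 * V (V P) ∎

    -- With A = `V a`, the factors A - C, A - ωC and A - ω²C are b(q), b(ωq) and b(ω²q), since A is
    -- a series in q³ and C is q times such a series. Their product is evaluated by `E-norm`.
    Va³-C³≈Vb³ : V a * V a * V a - C * C * C ≈ V (b * b * b)
    Va³-C³≈Vb³ = begin
      V a * V a * V a - C * C * C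
        -- To the solver w is a free variable, so the factorisation carries a correction by a
        -- multiple of 1 + w + w², which vanishes at ω.
        ≈⟨ solve 3 (λ a c w → a :* a :* a :- c :* c :* c
             := (a :- c) :* (a :- w :* c) :* (a :- w :* w :* c)
                :+ (:nat 1 :+ w :+ w :* w) :* (a :* a :* c :- w :* a :* c :* c :+ (w :- :nat 1) :* c :* c :* c)) refl (V a) C W ⟩
      (V a - C) * (V a - W * C) * (V a - W * W * C) + (1# + W + W * W) * rest
        ≈⟨ trans (+-congˡ (trans (*-congʳ {rest} (const-root ω-root)) (zeroˡ rest))) (+-identityʳ _) ⟩
      (V a - C) * (V a - W * C) * (V a - W * W * C)
        ≈⟨ *-cong (*-cong
             (trans (+-congʳ (sym b+C≈Va)) (solve 2 (λ b c → b :+ c :- c := b) refl b C))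
             (trans (sym (σb-dissection ω ω-root)) (σb ω ω-root)))
             (trans (+-congˡ (-‿cong (*-congʳ {C} (sym (const-* ω ω))))) (trans (sym (σb-dissection (ω R.* ω) (root-square ω-root))) (σb (ω R.* ω) (root-square ω-root)))) ⟩
      b * (σ ω E * σ ω E * σ ω E * V P) * (σ (ω R.* ω) E * σ (ω R.* ω) E * σ (ω R.* ω) E * V P)
        ≈⟨ solve 4 (λ e₀ e₁ e₂ p → e₀ :* e₀ :* e₀ :* p :* (e₁ :* e₁ :* e₁ :* p) :* (e₂ :* e₂ :* e₂ :* p)
             := (e₀ :* e₁ :* e₂) :^ 3 :* p :^ 3) refl E (σ ω E) (σ (ω R.* ω) E) (V P) ⟩
      (E * σ ω E * σ (ω R.* ω) E) ^ 3 * V P ^ 3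
        ≈⟨ *-congʳ (^-congˡ 3 E-norm) ⟩
      (V E ^ 4 * V (V P)) ^ 3 * V P ^ 3
        ≈⟨ solve 3 (λ e p p₉ → (e :^ 4 :* p₉) :^ 3 :* p :^ 3
             := (e :* p) :^ 3 :* (e :* e :* e :* p₉ :* (e :* e :* e :* p₉) :* (e :* e :* e :* p₉))) refl (V E) (V P) (V (V P)) ⟩
      (V E * V P) ^ 3 * (V E * V E * V E * V (V P) * (V E * V E * V E * V (V P)) * (V E * V E * V E * V (V P)))
        ≈⟨ *-cong (^-congˡ 3 VEP≈1) (*-cong (*-cong (sym Vb) (sym Vb)) (sym Vb)) ⟩
      1# ^ 3 * (V b * V b * V b)
        ≈⟨ solve 1 (λ b → :nat 1 :^ 3 :* b := b) refl (V b * V b * V b) ⟩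
      V b * V b * V b
        ≈⟨ V-cube b ⟨
      V (b * b * b) ∎
      where
      rest : Carrier
      rest = V a * V a * C - W * V a * C * C + (W - 1#) * C * C * C

    VC³ : C * C * C ≈ V (q * (κ * κ * κ))
    VC³ = begin
      C * C * C
        ≈⟨ solve 2 (λ q k → q :* k :* (q :* k) :* (q :* k) := q :* q :* q :* (k :* k :* k)) refl q (V κ) ⟩
      q * q * q * (V κ * V κ * V κ)
        ≈⟨ *-cong V-q (V-cube κ) ⟨
      V q * V (κ * κ * κ)
        ≈⟨ V-⊛ q (κ * κ * κ) ⟨
      V (q * (κ * κ * κ)) ∎

    -- All three terms of A³ = V b³ + C³, with A = `V a`, lie in the image of `V`, and `V` is
    -- injective.
    a³≈b³+qκ³ : a * a * a ≈ b * b * b + q * (κ * κ * κ)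
    a³≈b³+qκ³ = V-injective _ _ (begin
      V (a * a * a)
        ≈⟨ V-cube a ⟩
      V a * V a * V a
        ≈⟨ solve 2 (λ s t → s := s :- t :+ t) refl (V a * V a * V a) (C * C * C) ⟩
      V a * V a * V a - C * C * C + C * C * C
        ≈⟨ +-cong Va³-C³≈Vb³ VC³ ⟩
      V (b * b * b) + V (q * (κ * κ * κ))
        ≈⟨ V-⊕ (b * b * b) (q * (κ * κ * κ)) ⟨
      V (b * b * b + q * (κ * κ * κ)) ∎)

    -- For a = A + 2C and b = A - C one has b(a³ - b³) = 9C(A³ - C³); a factor q is then cancelled.
    bκ³≈9VκVb³ : b * (κ * κ * κ) ≈ nat 9 * (V κ * V (b * b * b))
    bκ³≈9VκVb³ = var-cancel _ _ (begin
      q * (b * (κ * κ * κ))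
        ≈⟨ solve 3 (λ q b k → q :* (b :* k) := b :* (b :* b :* b :+ q :* k :- b :* b :* b)) refl q b (κ * κ * κ) ⟩
      b * (b * b * b + q * (κ * κ * κ) - b * b * b)
        ≈⟨ *-congˡ (+-congʳ (sym a³≈b³+qκ³)) ⟩
      b * (a * a * a - b * b * b)
        ≈⟨ *-cong b≈ (+-cong (*-cong (*-cong a≈Va+2C a≈Va+2C) a≈Va+2C) (-‿cong (*-cong (*-cong b≈ b≈) b≈))) ⟩
      (V a - C) * ((V a + nat 2 * C) * (V a + nat 2 * C) * (V a + nat 2 * C) - (V a - C) * (V a - C) * (V a - C))
        ≈⟨ solve 3 (λ a q k → let c = q :* k in (a :- c) :* ((a :+ :nat 2 :* c) :* (a :+ :nat 2 :* c) :* (a :+ :nat 2 :* c) :- (a :- c) :* (a :- c) :* (a :- c))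
             := q :* (:nat 9 :* (k :* (a :* a :* a :- c :* c :* c)))) refl (V a) q (V κ) ⟩
      q * (nat 9 * (V κ * (V a * V a * V a - C * C * C)))
        ≈⟨ *-congˡ {q} (*-congˡ {nat 9} (*-congˡ Va³-C³≈Vb³)) ⟩
      q * (nat 9 * (V κ * V (b * b * b))) ∎)
      where
      b≈ : b ≈ V a - C
      b≈ = trans (solve 2 (λ b c → b := b :+ c :- c) refl b C) (+-congʳ b+C≈Va)

    -- `e` is the quotient κ/l, which should be the constant 3, and `g` is its deviation.
    l⁻¹ e g : Carrier
    l⁻¹ = E * (V P * V P * V P)
    e = κ * l⁻¹
    g = e - nat 3

    ll⁻¹≈1 : l * l⁻¹ ≈ 1#
    ll⁻¹≈1 = begin
      l * l⁻¹
        ≈⟨ solve 4 (λ e p e₃ p₃ → e₃ :* e₃ :* e₃ :* p :* (e :* (p₃ :* p₃ :* p₃)) := (e₃ :* p₃) :^ 3 :* (e :* p))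
             refl E P (V E) (V P) ⟩
      (V E * V P) ^ 3 * (E * P)
        ≈⟨ *-cong (^-congˡ 3 VEP≈1) EP≈1 ⟩
      1# ^ 3 * 1#
        ≈⟨ solve 0 (:nat 1 :^ 3 :* :nat 1 := :nat 1) refl ⟩
      1# ∎

    Vll⁻¹≈1 : V l * V l⁻¹ ≈ 1#
    Vll⁻¹≈1 = trans (sym (V-⊛ l l⁻¹)) (trans (V-cong ll⁻¹≈1) (V-const R.1#))

    -- `l` satisfies the functional equation of `κ` without the factor 9, so dividing the two leaves
    -- an equation for the quotient alone; the constant 3 solves it as 27 = 9 · 3.
    e³≈9Ve : e * e * e ≈ nat 9 * V e
    e³≈9Ve = b-cancel _ _ (begin
      b * (e * e * e)
        ≈⟨ solve 3 (λ b k m → b :* (k :* m :* (k :* m) :* (k :* m)) := b :* (k :* k :* k) :* (m :* m :* m)) refl b κ l⁻¹ ⟩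
      b * (κ * κ * κ) * (l⁻¹ * l⁻¹ * l⁻¹)
        ≈⟨ *-congʳ bκ³≈9VκVb³ ⟩
      nat 9 * (V κ * V (b * b * b)) * (l⁻¹ * l⁻¹ * l⁻¹)
        ≈⟨ trans (sym (*-identityʳ _)) (*-congˡ (sym Vll⁻¹≈1)) ⟩
      nat 9 * (V κ * V (b * b * b)) * (l⁻¹ * l⁻¹ * l⁻¹) * (V l * V l⁻¹)
        ≈⟨ solve 5 (λ k b m l n → :nat 9 :* (k :* b) :* m :* (l :* n) := :nat 9 :* (k :* n) :* (l :* b) :* m)
             refl (V κ) (V (b * b * b)) (l⁻¹ * l⁻¹ * l⁻¹) (V l) (V l⁻¹) ⟩
      nat 9 * (V κ * V l⁻¹) * (V l * V (b * b * b)) * (l⁻¹ * l⁻¹ * l⁻¹)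
        ≈⟨ *-congʳ (*-cong (*-congˡ {nat 9} (sym (V-⊛ κ l⁻¹))) (sym l³b≈VlVb³)) ⟩
      nat 9 * V e * (l * l * l * b) * (l⁻¹ * l⁻¹ * l⁻¹)
        ≈⟨ solve 4 (λ e l b m → :nat 9 :* e :* (l :* l :* l :* b) :* (m :* m :* m) := b :* (:nat 9 :* e) :* (l :* m) :^ 3)
             refl (V e) l b l⁻¹ ⟩
      b * (nat 9 * V e) * (l * l⁻¹) ^ 3
        ≈⟨ *-congˡ (^-congˡ 3 ll⁻¹≈1) ⟩
      b * (nat 9 * V e) * 1# ^ 3
        ≈⟨ solve 1 (λ w → w :* :nat 1 :^ 3 := w) refl (b * (nat 9 * V e)) ⟩
      b * (nat 9 * V e) ∎)

    g-equation : nat 27 * g + g * (g * (g + nat 9)) ≈ nat 9 * V g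
    g-equation = begin
      nat 27 * g + g * (g * (g + nat 9))
        ≈⟨ solve 1 (λ e → let g = e :- :nat 3 in :nat 27 :* g :+ g :* (g :* (g :+ :nat 9)) := e :* e :* e :- :nat 27) refl e ⟩
      e * e * e - nat 27
        ≈⟨ +-congʳ e³≈9Ve ⟩
      nat 9 * V e - nat 27
        ≈⟨ +-congʳ (*-congˡ {nat 9} (trans (V-cong (solve 1 (λ e → e := e :- :nat 3 :+ :nat 3)
             refl e)) (trans (V-⊕ g (nat 3)) (+-congˡ (V-nat 3))))) ⟩
      nat 9 * (V g + nat 3) - nat 27
        ≈⟨ solve 1 (λ g → :nat 9 :* (g :+ :nat 3) :- :nat 27 := :nat 9 :* g) refl (V g) ⟩
      nat 9 * V g ∎

    e-at-0 : e 0 R.≈ Rₙ.nat 3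
    e-at-0 = R.trans (R.*-cong (R.-‿cong b-at-1) (R.*-cong E₀ (R.*-cong (R.*-cong P₀ P₀) P₀)))
      (Rₙ.solve 0 ((Rₙ.:- (Rₙ.:- Rₙ.:nat 3)) Rₙ.:* (Rₙ.:nat 1 Rₙ.:* (Rₙ.:nat 1 Rₙ.:* Rₙ.:nat 1 Rₙ.:* Rₙ.:nat 1)) Rₙ.:= Rₙ.:nat 3) R.refl)

    g-at-0 : g 0 R.≈ R.0#
    g-at-0 = R.trans (R.+-cong e-at-0 (R.-‿cong (at (nat≈const 3) 0))) (R.-‿inverseʳ _)

    27-cancel : ∀ x → Rₙ.nat 27 R.* x R.≈ R.0# → x R.≈ R.0#
    27-cancel x eq = 3-cancel _ _ (3-cancel _ _ (3-cancel _ _ (R.trans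
      (Rₙ.solve 1 (λ f → Rₙ.:nat 3 Rₙ.:* (Rₙ.:nat 3 Rₙ.:* (Rₙ.:nat 3 Rₙ.:* f)) Rₙ.:= Rₙ.:nat 27 Rₙ.:* f) R.refl x)
      (R.trans eq (Rₙ.solve 0 (Rₙ.:nat 0 Rₙ.:= Rₙ.:nat 3 Rₙ.:* (Rₙ.:nat 3 Rₙ.:* (Rₙ.:nat 3 Rₙ.:* Rₙ.:nat 0))) R.refl)))))

    -- The lowest non-constant term c qⁿ of e would contribute 27 c qⁿ to e³ but nothing to 9 V e.
    g-vanishes : ∀ n m → m ℕ.≤ n → g m R.≈ R.0#
    g-vanishes zero    zero z≤n = g-at-0
    g-vanishes (suc n) m m≤1+n with ℕₚ.m≤n⇒m<n∨m≡n m≤1+n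
    ... | inj₁ (s≤s m≤n) = g-vanishes n m m≤n
    ... | inj₂ ≡.refl = 27-cancel (g (suc n)) (R.trans (R.sym (R.+-identityʳ _)) (R.trans
            (R.+-cong (R.sym (nat*-at 27 g (suc n)))
                      (R.sym (vanishing-⊛ g (g * (g + nat 9)) n (g-vanishes n) (R.trans (R.*-congʳ g-at-0) (R.zeroˡ _)))))
            (R.trans (at g-equation (suc n)) (R.trans (nat*-at 9 (V g) (suc n))
              (R.trans (R.*-congˡ (vanishing-V g n (g-vanishes n))) (R.zeroʳ _))))))

    κ≈3l : κ ≈ nat 3 * l
    κ≈3l = begin
      κ                ≈⟨ *-identityʳ κ ⟨
      κ * 1#           ≈⟨ *-congˡ ll⁻¹≈1 ⟨
      κ * (l * l⁻¹)    ≈⟨ solve 3 (λ k l m → k :* (l :* m) := (k :* m :- :nat 3 :+ :nat 3) :* l) refl κ l l⁻¹ ⟩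
      (g + nat 3) * l  ≈⟨ *-congʳ {l} (trans (+-congʳ g≈0) (+-identityˡ (nat 3))) ⟩
      nat 3 * l        ∎
      where
      g≈0 : g ≈ 0#
      g≈0 .at n = g-vanishes n n ℕₚ.≤-refl

    C≈3qVl : C ≈ nat 3 * (q * V l)
    C≈3qVl = trans (*-congˡ {q} (trans (V-cong κ≈3l) (V-nat* 3 l)))
                   (solve 2 (λ q l → q :* (:nat 3 :* l) := :nat 3 :* (q :* l)) refl q (V l))

    a-dissection : a ≈ V a + nat 6 * (q * V l)
    a-dissection = trans a≈Va+2C (+-congˡ (trans (*-congˡ {nat 2} C≈3qVl)
                     (solve 1 (λ c → :nat 2 :* (:nat 3 :* c) := :nat 6 :* c) refl (q * V l))))

    b-dissection : b + nat 3 * (q * V l) ≈ V a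
    b-dissection = trans (+-congˡ (sym C≈3qVl)) b+C≈Va

    a³≈b³+27ql³ : a * a * a ≈ b * b * b + nat 27 * (q * (l * l * l))
    a³≈b³+27ql³ = trans a³≈b³+qκ³ (+-congˡ (trans (*-congˡ {q} (*-cong (*-cong κ≈3l κ≈3l) κ≈3l))
                    (solve 2 (λ q l → q :* (:nat 3 :* l :* (:nat 3 :* l) :* (:nat 3 :* l)) := :nat 27 :* (q :* (l :* l :* l)))
                         refl q l)))

-- Partitions and Euler's product

Σ≤-cong : ∀ n {f g : ℕ → ℕ} → (∀ i → i ℕ.≤ n → f i ≡ g i) → Σ≤ n f ≡ Σ≤ n g
Σ≤-cong zero    p = p 0 z≤n
Σ≤-cong (suc n) p = ≡.cong₂ ℕ._+_ (Σ≤-cong n (λ i i≤n → p i (ℕₚ.m≤n⇒m≤1+n i≤n))) (p (suc n) ℕₚ.≤-refl)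

Σ≤-suc : ∀ n f → Σ≤ (suc n) f ≡ f 0 ℕ.+ Σ≤ n (λ i → f (suc i))
Σ≤-suc zero    f = ≡.refl
Σ≤-suc (suc n) f = ≡.trans (≡.cong (ℕ._+ f (2 ℕ.+ n)) (Σ≤-suc n f)) (ℕₚ.+-assoc (f 0) _ _)

Σ≤-truncate : ∀ n k (f : ℕ → ℕ) → (∀ i → n ℕ.< i → f i ≡ 0) → Σ≤ (k ℕ.+ n) f ≡ Σ≤ n f
Σ≤-truncate n zero    f p = ≡.refl
Σ≤-truncate n (suc k) f p =
  ≡.trans (≡.cong₂ ℕ._+_ (Σ≤-truncate n k f p) (p (suc k ℕ.+ n) (s≤s (ℕₚ.m≤n+m n k)))) (ℕₚ.+-identityʳ _)

module _ (m : ℕ) where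
  private
    term : ℕ → ℕ → ℕ
    term n j = if does (j ℕ.* suc m ≤? n) then pBounded m (n ℕ.∸ j ℕ.* suc m) else 0

    term-vanishes : ∀ n j → n ℕ.< j ℕ.* suc m → term n j ≡ 0
    term-vanishes n j n<j rewrite dec-false (j ℕ.* suc m ≤? n) (ℕₚ.<⇒≱ n<j) = ≡.refl

    term-suc : ∀ n j → term (suc m ℕ.+ n) (suc j) ≡ term n j
    term-suc n j with j ℕ.* suc m ≤? n
    ... | yes j≤n rewrite dec-true (suc m ℕ.+ j ℕ.* suc m ≤? suc m ℕ.+ n) (ℕₚ.+-monoʳ-≤ (suc m) j≤n)
                        | dec-true (j ℕ.* suc m ≤? n) j≤n =
      ≡.cong (pBounded m) (ℕₚ.[m+n]∸[m+o]≡n∸o (suc m) n (j ℕ.* suc m))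
    ... | no  j≰n rewrite dec-false (suc m ℕ.+ j ℕ.* suc m ≤? suc m ℕ.+ n) (λ p → j≰n (ℕₚ.+-cancelˡ-≤ (suc m) _ _ p))
                        | dec-false (j ℕ.* suc m ≤? n) j≰n = ≡.refl

  pBounded-< : ∀ n → n ℕ.< suc m → pBounded (suc m) n ≡ pBounded m n
  pBounded-< n n<1+m = ≡.trans (≡.cong (λ k → Σ≤ k (term n)) (≡.sym (ℕₚ.+-identityʳ n)))
    (Σ≤-truncate 0 n (term n) λ i 0<i → term-vanishes n i (ℕₚ.<-≤-trans n<1+m (ℕₚ.m≤n*m (suc m) i ⦃ ℕ.>-nonZero 0<i ⦄)))

  -- Either no part equals m + 1 or one such part is removed; on the defining sum the latter shifts
  -- the multiplicity by one.
  pBounded-+ : ∀ n → pBounded (suc m) (suc m ℕ.+ n) ≡ pBounded m (suc m ℕ.+ n) ℕ.+ pBounded (suc m) n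
  pBounded-+ n = ≡.trans (Σ≤-suc (m ℕ.+ n) (term (suc m ℕ.+ n))) (≡.cong (pBounded m (suc m ℕ.+ n) ℕ.+_)
    (≡.trans (Σ≤-cong (m ℕ.+ n) (λ j _ → term-suc n j))
             (Σ≤-truncate n m (term n) λ i n<i → term-vanishes n i (ℕₚ.<-≤-trans n<i (ℕₚ.m≤m*n i (suc m))))))

pBounded-stable : ∀ k n → pBounded (k ℕ.+ n) n ≡ p n
pBounded-stable zero    n = ≡.refl
pBounded-stable (suc k) n = ≡.trans (pBounded-< (k ℕ.+ n) n (s≤s (ℕₚ.m≤n+m n k))) (pBounded-stable k n)

module Pochhammer (K : CommutativeRing 0ℓ 0ℓ) where
  open CommutativeRing K
  open import Algebra.Properties.Semiring.Exp semiring using (_^_)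

  poch : Carrier → ℕ → Carrier
  poch q zero    = 1#
  poch q (suc n) = poch q n * (1# - q ^ suc n)

module EulerProduct (R : CommutativeRing 0ℓ 0ℓ) where
  private
    module R = CommutativeRing R
    module Rₙ = IntegerSolver R
  open PowerSeries R
  open Dissection R
  open Coefficients R
  open PrimitiveCubeRoots R
  open CommutativeRing ring[[X]] hiding (zero)
  open IntegerSolver ring[[X]]
  open Pochhammer ring[[X]]
  open import Algebra.Properties.Ring R.ring using (-0#≈0#)
  open import Algebra.Properties.Semiring.Exp R.semiring using () renaming (_^_ to _^ᵣ_)
  open import Algebra.Properties.Semiring.Exp semiring using (_^_; ^-congˡ; ^-assocʳ)
  open import Relation.Binary.Reasoning.Setoid setoid

  pow-⊛-+ : ∀ k f n → (var ^ k * f) (k ℕ.+ n) R.≈ f n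
  pow-⊛-+ zero    f n = at (*-identityˡ f) n
  pow-⊛-+ (suc k) f n = R.trans (at (*-assoc var (var ^ k) f) (suc k ℕ.+ n))
    (R.trans (var-⊛-suc (var ^ k * f) (k ℕ.+ n)) (pow-⊛-+ k f n))

  pow-⊛-< : ∀ k f n → n ℕ.< k → (var ^ k * f) n R.≈ R.0#
  pow-⊛-< (suc k) f zero    _         = R.trans (at (*-assoc var (var ^ k) f) 0) (var-⊛-zero (var ^ k * f))
  pow-⊛-< (suc k) f (suc n) (s≤s n<k) = R.trans (at (*-assoc var (var ^ k) f) (suc n))
    (R.trans (var-⊛-suc (var ^ k * f) n) (pow-⊛-< k f n n<k))

  factor-< : ∀ f k n → n ℕ.< k → (f * (1# - var ^ k)) n R.≈ f n
  factor-< f k n n<k = R.trans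
    (at (solve 2 (λ f q → f :* (:nat 1 :- q) := f :- q :* f) refl f (var ^ k)) n)
    (R.trans (R.+-congˡ (R.trans (R.-‿cong (pow-⊛-< k f n n<k)) -0#≈0#)) (R.+-identityʳ _))

  -- `E` takes coefficient n from the n-th partial product: later factors no longer change it, so
  -- this is (q;q)_∞ without a limit.
  P E : Carrier
  P n = Rₙ.nat (p n)
  E n = poch var n n

  Pₙ : ℕ → Carrier
  Pₙ m n = Rₙ.nat (pBounded m n)

  poch-stable : ∀ k n → poch var (k ℕ.+ n) n R.≈ E n
  poch-stable zero    n = R.refl
  poch-stable (suc k) n = R.trans (factor-< (poch var (k ℕ.+ n)) (suc (k ℕ.+ n)) n (s≤s (ℕₚ.m≤n+m n k))) (poch-stable k n)

  E≈[]poch : ∀ N → E ≈[ N ] poch var N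
  E≈[]poch N n n≤N = R.trans (R.sym (poch-stable (N ℕ.∸ n) n)) (R.reflexive (≡.cong (λ k → poch var k n) (ℕₚ.m∸n+n≡m n≤N)))

  P≈[]Pₙ : ∀ N → P ≈[ N ] Pₙ N
  P≈[]Pₙ N n n≤N = R.reflexive (≡.cong Rₙ.nat (≡.trans (≡.sym (pBounded-stable (N ℕ.∸ n) n)) (≡.cong (λ k → pBounded k n) (ℕₚ.m∸n+n≡m n≤N))))

  Pₙ-recurrence : ∀ m → Pₙ (suc m) ≈ Pₙ m + var ^ suc m * Pₙ (suc m)
  Pₙ-recurrence m .at n with suc m ≤? n
  ... | no  m≮n = R.trans (R.reflexive (≡.cong Rₙ.nat (pBounded-< m n n<1+m)))
                    (R.sym (R.trans (R.+-congˡ (pow-⊛-< (suc m) (Pₙ (suc m)) n n<1+m)) (R.+-identityʳ _)))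
    where
    n<1+m : n ℕ.< suc m
    n<1+m = ℕₚ.≰⇒> m≮n
  ... | yes m<n = ≡.subst (λ n → Pₙ (suc m) n R.≈ Pₙ m n R.+ (var ^ suc m * Pₙ (suc m)) n) (ℕₚ.m+[n∸m]≡n m<n) (go (n ℕ.∸ suc m))
    where
    go : ∀ k → Pₙ (suc m) (suc m ℕ.+ k) R.≈ Pₙ m (suc m ℕ.+ k) R.+ (var ^ suc m * Pₙ (suc m)) (suc m ℕ.+ k)
    go k = R.trans (R.reflexive (≡.cong Rₙ.nat (pBounded-+ m k)))
             (R.trans (Rₙ.nat-+ (pBounded m (suc m ℕ.+ k)) (pBounded (suc m) k)) (R.+-congˡ (R.sym (pow-⊛-+ (suc m) (Pₙ (suc m)) k))))

  poch*Pₙ≈1 : ∀ m → poch var m * Pₙ m ≈ 1#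
  poch*Pₙ≈1 zero = trans (*-identityˡ _) (pointwise λ { zero → R.refl ; (suc n) → R.refl })
  poch*Pₙ≈1 (suc m) = begin
    poch var m * (1# - var ^ suc m) * Pₙ (suc m)
      ≈⟨ solve 3 (λ e q p → e :* (:nat 1 :- q) :* p := e :* (p :- q :* p)) refl (poch var m) (var ^ suc m) (Pₙ (suc m)) ⟩
    poch var m * (Pₙ (suc m) - var ^ suc m * Pₙ (suc m))
      ≈⟨ *-congˡ (+-congʳ (Pₙ-recurrence m)) ⟩
    poch var m * (Pₙ m + var ^ suc m * Pₙ (suc m) - var ^ suc m * Pₙ (suc m))
      ≈⟨ solve 3 (λ e p t → e :* (p :+ t :- t) := e :* p) refl (poch var m) (Pₙ m) (var ^ suc m * Pₙ (suc m)) ⟩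
    poch var m * Pₙ m
      ≈⟨ poch*Pₙ≈1 m ⟩
    1# ∎

  EP≈1 : E * P ≈ 1#
  EP≈1 .at n = R.trans (⊛-cong[] n (E≈[]poch n) (P≈[]Pₙ n) n ℕₚ.≤-refl) (at (poch*Pₙ≈1 n) n)

  sum-snoc : ∀ n (f : ℕ → R.Carrier) → sum (suc n) f R.≈ sum n f R.+ f n
  sum-snoc zero    f = R.+-comm _ _
  sum-snoc (suc n) f = R.trans (R.+-congˡ (sum-snoc n (λ i → f (suc i)))) (R.sym (R.+-assoc _ _ _))

  nat-Σ≤ : ∀ n f → Rₙ.nat (Σ≤ n f) R.≈ sum (suc n) (λ i → Rₙ.nat (f i))
  nat-Σ≤ zero    f = R.sym (R.+-identityʳ _)
  nat-Σ≤ (suc n) f = R.trans (Rₙ.nat-+ (Σ≤ n f) (f (suc n)))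
    (R.trans (R.+-congʳ (nat-Σ≤ n f)) (R.sym (sum-snoc (suc n) (λ i → Rₙ.nat (f i)))))

  nat-convolution : ∀ (f g : ℕ → ℕ) n → Rₙ.nat (Σ≤ n (λ i → f i ℕ.* g (n ℕ.∸ i))) R.≈ ((λ i → Rₙ.nat (f i)) * (λ i → Rₙ.nat (g i))) n
  nat-convolution f g n = R.trans (nat-Σ≤ n _)
    (R.trans (sum-cong (suc n) (λ i _ → Rₙ.nat-* (f i) (g (n ℕ.∸ i)))) (R.sym (⊛-sum _ _ n)))

  nat-p3 : ∀ n → Rₙ.nat (p3 n) R.≈ (P * P * P) n
  nat-p3 n = R.trans (R.reflexive (≡.cong Rₙ.nat (Σ≤-cong n (λ i _ → Σ≤-*ˡ (n ℕ.∸ i) i))))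
    (R.trans (nat-convolution p (λ m → Σ≤ m (λ j → p j ℕ.* p (m ℕ.∸ j))) n)
    (R.trans (at (*-congˡ {P} (pointwise (nat-convolution p p))) n) (R.sym (at (*-assoc P P P) n))))
    where
    Σ≤-*ˡ′ : ∀ m k c (f : ℕ → ℕ) → Σ≤ k (λ j → c ℕ.* f j) ≡ c ℕ.* Σ≤ k f
    Σ≤-*ˡ′ m zero    c f = ≡.refl
    Σ≤-*ˡ′ m (suc k) c f = ≡.trans (≡.cong (ℕ._+ c ℕ.* f (suc k)) (Σ≤-*ˡ′ m k c f)) (≡.sym (ℕₚ.*-distribˡ-+ c _ _))
    Σ≤-*ˡ : ∀ m i → Σ≤ m (λ j → p i ℕ.* p j ℕ.* p (m ℕ.∸ j)) ≡ p i ℕ.* Σ≤ m (λ j → p j ℕ.* p (m ℕ.∸ j))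
    Σ≤-*ˡ m i = ≡.trans (Σ≤-cong m (λ j _ → ℕₚ.*-assoc (p i) (p j) (p (m ℕ.∸ j)))) (Σ≤-*ˡ′ m m (p i) _)

  nat-cφ3 : ∀ n → Rₙ.nat (cφ3 n) R.≈ ((λ i → Rₙ.nat (θ i)) * (P * P * P)) n
  nat-cφ3 n = R.trans (nat-convolution θ p3 n) (at (*-congˡ {λ i → Rₙ.nat (θ i)} (pointwise nat-p3)) n)

  V-1 : ∀ f → V (1# - f) ≈ 1# - V f
  V-1 f = begin
    V (1# - f)              ≈⟨ solve 2 (λ a b → a := a :+ b :- b) refl (V (1# - f)) (V f) ⟩
    V (1# - f) + V f - V f  ≈⟨ +-congʳ (trans (sym (V-⊕ (1# - f) f)) (trans (V-cong (solve 1 (λ f → :nat 1 :- f :+ f := :nat 1)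
         refl f)) (V-const R.1#))) ⟩
    1# - V f                ∎

  V-pow : ∀ m → V (var ^ m) ≈ (var ^ m) ^ 3
  V-pow zero    = trans (V-const R.1#) (solve 0 (:nat 1 := :nat 1 :^ 3) refl)
  V-pow (suc m) = trans (V-⊛ var (var ^ m)) (trans (*-cong V-var (V-pow m))
                    (solve 2 (λ q r → q :^ 3 :* r :^ 3 := (q :* r) :^ 3) refl var (var ^ m)))

  σ-pow : ∀ c m → σ c (var ^ m) ≈ const (c ^ᵣ m) * var ^ m
  σ-pow c zero    = trans (σ-const c R.1#) (sym (*-identityˡ 1#))
  σ-pow c (suc m) = begin
    σ c (var * var ^ m)                        ≈⟨ σ-⊛ c var (var ^ m) ⟩
    σ c var * σ c (var ^ m)                    ≈⟨ *-cong (σ-var c) (σ-pow c m) ⟩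
    const c * var * (const (c ^ᵣ m) * var ^ m)
      ≈⟨ solve 4 (λ c q d r → c :* q :* (d :* r) := c :* d :* (q :* r)) refl (const c) var (const (c ^ᵣ m)) (var ^ m) ⟩
    const c * const (c ^ᵣ m) * (var * var ^ m) ≈⟨ *-congʳ (const-* c (c ^ᵣ m)) ⟨
    const (c ^ᵣ suc m) * var ^ suc m           ∎

  σ-factor : ∀ c d m → c ^ᵣ m R.≈ d → σ c (1# - var ^ m) ≈ 1# - const d * var ^ m
  σ-factor c d m eq = begin
    σ c (1# - var ^ m)
      ≈⟨ solve 2 (λ a b → a := a :+ b :- b) refl (σ c (1# - var ^ m)) (σ c (var ^ m)) ⟩
    σ c (1# - var ^ m) + σ c (var ^ m) - σ c (var ^ m)
      ≈⟨ +-cong (trans (sym (σ-⊕ c (1# - var ^ m) (var ^ m)))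
                  (trans (σ-cong c (solve 1 (λ f → :nat 1 :- f :+ f := :nat 1) refl (var ^ m))) (σ-const c R.1#)))
                (-‿cong (trans (σ-pow c m) (*-congʳ (const-cong eq)))) ⟩
    1# - const d * var ^ m ∎

  norm-factor : ∀ {c} → Root c → ∀ r → (1# - r) * (1# - const c * r) * (1# - const (c R.* c) * r) ≈ 1# - r ^ 3
  norm-factor {c} root r = begin
    (1# - r) * (1# - const c * r) * (1# - const (c R.* c) * r)
      ≈⟨ *-congˡ (+-congˡ (-‿cong (*-congʳ {r} (const-* c c)))) ⟩
    (1# - r) * (1# - const c * r) * (1# - const c * const c * r)
      ≈⟨ solve 2 (λ w r → (:nat 1 :- r) :* (:nat 1 :- w :* r) :* (:nat 1 :- w :* w :* r)
           := :nat 1 :- r :^ 3 :+ (:nat 1 :+ w :+ w :* w) :* (w :* r :* r :- r :- (w :- :nat 1) :* r :* r :* r)) refl (const c) r ⟩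
    1# - r ^ 3 + (1# + const c + const c * const c) * rest
      ≈⟨ +-congˡ (*-congʳ {rest} (const-root root)) ⟩
    1# - r ^ 3 + 0# * rest
      ≈⟨ trans (+-congˡ (zeroˡ rest)) (+-identityʳ _) ⟩
    1# - r ^ 3 ∎
    where
    rest : Carrier
    rest = const c * r * r - r - (const c - 1#) * r * r * r

  module Norm (ω : R.Carrier) (ω-root : Root ω) where

    ω² : R.Carrier
    ω² = ω R.* ω

    -- For 3 ∤ m the norm of 1 - q^m is 1 - q^(3m). For m = 3j the factor is fixed by both rotations
    -- and contributes its cube, which the factors V(V B) and (V B)³ account for. Stopping at 3N
    -- keeps the factors in complete triples.
    poch-norm : ∀ N → let T = poch var (N ℕ.* 3) in
                T * σ ω T * σ ω² T * V (V (poch var N)) ≈ V T * V (poch var N) ^ 3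
    poch-norm zero = begin
      1# * σ ω 1# * σ ω² 1# * V (V 1#)
        ≈⟨ *-cong (*-cong (*-congˡ (σ-const ω R.1#)) (σ-const ω² R.1#)) (trans (V-cong (V-const R.1#)) (V-const R.1#)) ⟩
      1# * 1# * 1# * 1#
        ≈⟨ solve 0 (:nat 1 :* :nat 1 :* :nat 1 :* :nat 1 := :nat 1 :* :nat 1 :^ 3) refl ⟩
      1# * 1# ^ 3
        ≈⟨ *-cong (V-const R.1#) (^-congˡ 3 (V-const R.1#)) ⟨
      V 1# * V 1# ^ 3 ∎
    poch-norm (suc N) = begin
      T * f₁ * f₂ * f₃ * σ ω (T * f₁ * f₂ * f₃) * σ ω² (T * f₁ * f₂ * f₃) * V (V (B * g))
        ≈⟨ *-cong (*-cong (*-congˡ (σ⁴ ω)) (σ⁴ ω²)) (trans (V-cong (V-⊛ B g)) (V-⊛ (V B) (V g))) ⟩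
      T * f₁ * f₂ * f₃ * (σ ω T * σ ω f₁ * σ ω f₂ * σ ω f₃) * (σ ω² T * σ ω² f₁ * σ ω² f₂ * σ ω² f₃) * (V (V B) * V (V g))
        ≈⟨ regroup T (σ ω T) (σ ω² T) (V (V B)) f₁ (σ ω f₁) (σ ω² f₁) f₂ (σ ω f₂) (σ ω² f₂) f₃ (σ ω f₃) (σ ω² f₃) (V (V g)) ⟩
      T * σ ω T * σ ω² T * V (V B) * (f₁ * σ ω f₁ * σ ω² f₁) * (f₂ * σ ω f₂ * σ ω² f₂) * (f₃ * σ ω f₃ * σ ω² f₃ * V (V g))
        ≈⟨ *-cong (*-cong (*-cong (poch-norm N) F₁) F₂) F₃ ⟩
      V T * V B ^ 3 * V f₁ * V f₂ * (V f₃ * V g ^ 3)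
        ≈⟨ solve 6 (λ t b f₁ f₂ f₃ g → t :* b :^ 3 :* f₁ :* f₂ :* (f₃ :* g :^ 3) := t :* f₁ :* f₂ :* f₃ :* (b :* g) :^ 3)
             refl (V T) (V B) (V f₁) (V f₂) (V f₃) (V g) ⟩
      V T * V f₁ * V f₂ * V f₃ * (V B * V g) ^ 3
        ≈⟨ *-cong V⁴ (^-congˡ 3 (V-⊛ B g)) ⟨
      V (T * f₁ * f₂ * f₃) * V (B * g) ^ 3 ∎
      where
      T B f₁ f₂ f₃ g r₁ r₂ r₃ : Carrier
      T  = poch var (N ℕ.* 3)
      B  = poch var N
      r₁ = var ^ (1 ℕ.+ N ℕ.* 3)
      r₂ = var ^ (2 ℕ.+ N ℕ.* 3)
      r₃ = var ^ (3 ℕ.+ N ℕ.* 3)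
      f₁ = 1# - r₁
      f₂ = 1# - r₂
      f₃ = 1# - r₃
      g  = 1# - var ^ suc N

      regroup : ∀ t₀ t₁ t₂ t₃ a₀ a₁ a₂ b₀ b₁ b₂ c₀ c₁ c₂ c₃ →
        t₀ * a₀ * b₀ * c₀ * (t₁ * a₁ * b₁ * c₁) * (t₂ * a₂ * b₂ * c₂) * (t₃ * c₃)
        ≈ t₀ * t₁ * t₂ * t₃ * (a₀ * a₁ * a₂) * (b₀ * b₁ * b₂) * (c₀ * c₁ * c₂ * c₃)
      regroup t₀ t₁ t₂ t₃ a₀ a₁ a₂ b₀ b₁ b₂ c₀ c₁ c₂ c₃ = begin
        t₀ * a₀ * b₀ * c₀ * (t₁ * a₁ * b₁ * c₁) * (t₂ * a₂ * b₂ * c₂) * (t₃ * c₃)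
          ≈⟨ *-congʳ (*-congʳ (merge t₀ a₀ b₀ c₀ t₁ a₁ b₁ c₁)) ⟩
        t₀ * t₁ * (a₀ * a₁) * (b₀ * b₁) * (c₀ * c₁) * (t₂ * a₂ * b₂ * c₂) * (t₃ * c₃)
          ≈⟨ *-congʳ (merge (t₀ * t₁) (a₀ * a₁) (b₀ * b₁) (c₀ * c₁) t₂ a₂ b₂ c₂) ⟩
        t₀ * t₁ * t₂ * (a₀ * a₁ * a₂) * (b₀ * b₁ * b₂) * (c₀ * c₁ * c₂) * (t₃ * c₃)
          ≈⟨ solve 6 (λ t a b c t₃ c₃ → t :* a :* b :* c :* (t₃ :* c₃) := t :* t₃ :* a :* b :* (c :* c₃))
               refl (t₀ * t₁ * t₂) (a₀ * a₁ * a₂) (b₀ * b₁ * b₂) (c₀ * c₁ * c₂) t₃ c₃ ⟩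
        t₀ * t₁ * t₂ * t₃ * (a₀ * a₁ * a₂) * (b₀ * b₁ * b₂) * (c₀ * c₁ * c₂ * c₃) ∎
        where
        merge : ∀ t a b c t′ a′ b′ c′ → t * a * b * c * (t′ * a′ * b′ * c′) ≈ t * t′ * (a * a′) * (b * b′) * (c * c′)
        merge = solve 8 (λ t a b c t′ a′ b′ c′ → t :* a :* b :* c :* (t′ :* a′ :* b′ :* c′) := t :* t′ :* (a :* a′) :* (b :* b′) :* (c :* c′)) refl

      σ⁴ : ∀ c → σ c (T * f₁ * f₂ * f₃) ≈ σ c T * σ c f₁ * σ c f₂ * σ c f₃
      σ⁴ c = trans (σ-⊛ c (T * f₁ * f₂) f₃) (*-congʳ (trans (σ-⊛ c (T * f₁) f₂) (*-congʳ (σ-⊛ c T f₁))))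

      V⁴ : V (T * f₁ * f₂ * f₃) ≈ V T * V f₁ * V f₂ * V f₃
      V⁴ = trans (V-⊛ (T * f₁ * f₂) f₃) (*-congʳ (trans (V-⊛ (T * f₁) f₂) (*-congʳ (V-⊛ T f₁))))

      V-factor : ∀ m → V (1# - var ^ m) ≈ 1# - (var ^ m) ^ 3
      V-factor m = trans (V-1 (var ^ m)) (+-congˡ (-‿cong (V-pow m)))

      F₁ : f₁ * σ ω f₁ * σ ω² f₁ ≈ V f₁
      F₁ = trans (*-cong (*-congˡ (σ-factor ω ω (1 ℕ.+ N ℕ.* 3) (pow ω-root))) (σ-factor ω² ω² (1 ℕ.+ N ℕ.* 3) (pow (root-square ω-root))))
             (trans (norm-factor ω-root r₁) (sym (V-factor (1 ℕ.+ N ℕ.* 3))))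
        where
        pow : ∀ {c} → Root c → c R.* c ^ᵣ (N ℕ.* 3) R.≈ c
        pow eq = R.trans (R.*-congˡ (root-pow eq N)) (R.*-identityʳ _)

      F₂ : f₂ * σ ω f₂ * σ ω² f₂ ≈ V f₂
      F₂ = trans (*-cong (*-congˡ (σ-factor ω ω² (2 ℕ.+ N ℕ.* 3) (pow ω-root))) (σ-factor ω² (ω² R.* ω²) (2 ℕ.+ N ℕ.* 3) (pow (root-square ω-root))))
             (trans (norm-factor (root-square ω-root) r₂) (sym (V-factor (2 ℕ.+ N ℕ.* 3))))
        where
        pow : ∀ {c} → Root c → c R.* (c R.* c ^ᵣ (N ℕ.* 3)) R.≈ c R.* c
        pow eq = R.*-congˡ (R.trans (R.*-congˡ (root-pow eq N)) (R.*-identityʳ _))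

      F₃ : f₃ * σ ω f₃ * σ ω² f₃ * V (V g) ≈ V f₃ * V g ^ 3
      F₃ = begin
        f₃ * σ ω f₃ * σ ω² f₃ * V (V g)
          ≈⟨ *-cong (*-cong (*-congˡ (fixed ω ω-root)) (fixed ω² (root-square ω-root))) (V-cong Vg) ⟩
        f₃ * f₃ * f₃ * V f₃
          ≈⟨ solve 2 (λ f v → f :* f :* f :* v := v :* f :^ 3) refl f₃ (V f₃) ⟩
        V f₃ * f₃ ^ 3
          ≈⟨ *-congˡ (^-congˡ 3 Vg) ⟨
        V f₃ * V g ^ 3 ∎
        where
        fixed : ∀ c → Root c → σ c f₃ ≈ f₃
        fixed c eq = trans (σ-factor c R.1# (3 ℕ.+ N ℕ.* 3) (root-pow eq (suc N))) (+-congˡ (-‿cong (*-identityˡ r₃)))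
        Vg : V g ≈ f₃
        Vg = trans (V-factor (suc N)) (+-congˡ (-‿cong (^-assocʳ var (suc N) 3)))

    norm : E * σ ω E * σ ω² E * V (V E) ≈ V E ^ 4
    norm .at n = R.trans (lhs n ℕₚ.≤-refl) (R.trans (at (poch-norm n) n) (R.trans (R.sym (rhs n ℕₚ.≤-refl))
                   (at (solve 1 (λ v → v :* v :^ 3 := v :^ 4) refl (V E)) n)))
      where
      T B : Carrier
      T = poch var (n ℕ.* 3)
      B = poch var n
      E≈T : E ≈[ n ] T
      E≈T m m≤n = E≈[]poch (n ℕ.* 3) m (ℕₚ.≤-trans m≤n (ℕₚ.m≤m*n n 3))
      E≈B : E ≈[ n ] B
      E≈B = E≈[]poch n
      lhs : E * σ ω E * σ ω² E * V (V E) ≈[ n ] T * σ ω T * σ ω² T * V (V B)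
      lhs = ⊛-cong[] n (⊛-cong[] n (⊛-cong[] n E≈T (σ-cong[] ω n E≈T)) (σ-cong[] ω² n E≈T)) (V-cong[] n (V-cong[] n E≈B))
      cube : ∀ {f g} → f ≈[ n ] g → f ^ 3 ≈[ n ] g ^ 3
      cube p = ⊛-cong[] n p (⊛-cong[] n p (⊛-cong[] n p (λ _ _ → R.refl)))
      rhs : V E * V E ^ 3 ≈[ n ] V T * V B ^ 3
      rhs = ⊛-cong[] n (V-cong[] n E≈T) (cube (V-cong[] n E≈B))

-- Jacobi's triple product

module JacobiProduct (K : CommutativeRing 0ℓ 0ℓ) where
  private
    module K = CommutativeRing K
    module Kₙ = IntegerSolver K
  open PowerSeries K
  open Dissection K
  open Coefficients K
  open PrimitiveCubeRoots K
  open Pochhammer K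
  open CommutativeRing ring[[X]] hiding (zero)
  open IntegerSolver ring[[X]]
  open import Algebra.Properties.Semiring.Exp K.semiring using () renaming (_^_ to _^ₖ_; ^-congˡ to ^ₖ-congˡ; ^-homo-* to ^ₖ-homo; ^-assocʳ to ^ₖ-assocʳ)
  open import Algebra.Properties.Semiring.Exp semiring using (_^_)

  -- The coefficient of var^(N + k) tends to q^(k(k−1)/2) / (q;q)_∞ as N grows.
  jacobi : K.Carrier → ℕ → Carrier
  jacobi q zero    = 1#
  jacobi q (suc N) = jacobi q N * ((1# + const (q ^ₖ N) * var) * (var + const (q ^ₖ suc N)))

  σ-linear : ∀ w c d → σ w (const c + const d * var) ≈ const c + const w * (const d * var)
  σ-linear w c d = trans (σ-⊕ w (const c) (const d * var)) (+-cong (σ-const w c)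
    (trans (σ-⊛ w (const d) var) (trans (*-cong (σ-const w d) (σ-var w))
      (solve 3 (λ w d x → d :* (w :* x) := w :* (d :* x)) refl (const w) (const d) var))))

  σ-monic : ∀ w d → σ w (var + const d) ≈ const w * var + const d
  σ-monic w d = trans (σ-⊕ w var (const d)) (+-cong (σ-var w) (σ-const w d))

  σ-1# : ∀ w → σ w 1# ≈ 1#
  σ-1# w = σ-const w K.1#

  module _ (q : K.Carrier) where
    open import Relation.Binary.Reasoning.Setoid setoid

    -- `jacobi q N` is X^N times the product of (1 + q^i X)(1 + q^(i+1)/X) over i < N. Replacing X
    -- by qX moves both products by one factor, so that only end factors change.
    jacobi-functional : ∀ N → σ q (jacobi q N) * (var + const (q ^ₖ N)) ≈ const (q ^ₖ N) * ((1# + const (q ^ₖ N) * var) * jacobi q N)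
    jacobi-functional zero = trans (*-congʳ (σ-1# q))
      (solve 1 (λ x → :nat 1 :* (x :+ :nat 1) := :nat 1 :* ((:nat 1 :+ :nat 1 :* x) :* :nat 1)) refl var)
    jacobi-functional (suc N) = begin
      σ q (G * ((1# + c * var) * (var + e))) * (var + e)
        ≈⟨ *-congʳ (trans (σ-⊛ q G _) (*-congˡ (trans (σ-⊛ q (1# + c * var) (var + e)) (*-cong (σ-linear q K.1# (q ^ₖ N)) (σ-monic q (q ^ₖ suc N)))))) ⟩
      σ q G * ((1# + q̂ * (c * var)) * (q̂ * var + e)) * (var + e)
        ≈⟨ *-congʳ (*-congˡ (*-congˡ (+-congˡ e≈))) ⟩
      σ q G * ((1# + q̂ * (c * var)) * (q̂ * var + q̂ * c)) * (var + e)
        ≈⟨ solve 5 (λ s q c e x → s :* ((:nat 1 :+ q :* (c :* x)) :* (q :* x :+ q :* c)) :* (x :+ e)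
             := s :* (x :+ c) :* (q :* (:nat 1 :+ q :* c :* x) :* (x :+ e))) refl (σ q G) q̂ c e var ⟩
      σ q G * (var + c) * (q̂ * (1# + q̂ * c * var) * (var + e))
        ≈⟨ *-congʳ (jacobi-functional N) ⟩
      c * ((1# + c * var) * G) * (q̂ * (1# + q̂ * c * var) * (var + e))
        ≈⟨ solve 5 (λ g q c e x → c :* ((:nat 1 :+ c :* x) :* g) :* (q :* (:nat 1 :+ q :* c :* x) :* (x :+ e))
             := (q :* c) :* ((:nat 1 :+ q :* c :* x) :* (g :* ((:nat 1 :+ c :* x) :* (x :+ e))))) refl G q̂ c e var ⟩
      q̂ * c * ((1# + q̂ * c * var) * (G * ((1# + c * var) * (var + e))))
        ≈⟨ *-cong e≈ (*-congʳ (+-congˡ (*-congʳ {var} e≈))) ⟨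
      e * ((1# + e * var) * (G * ((1# + c * var) * (var + e)))) ∎
      where
      G q̂ c e : Carrier
      G = jacobi q N
      q̂ = const q
      c = const (q ^ₖ N)
      e = const (q ^ₖ suc N)
      e≈ : e ≈ q̂ * c
      e≈ = const-* q (q ^ₖ N)

  module _ (q : K.Carrier) (q-cancel : ∀ f g → q K.* f K.≈ q K.* g → f K.≈ g) where
    open import Relation.Binary.Reasoning.Setoid K.setoid

    pow-cancel : ∀ k f g → q ^ₖ k K.* f K.≈ q ^ₖ k K.* g → f K.≈ g
    pow-cancel zero    f g eq = K.trans (K.sym (K.*-identityˡ f)) (K.trans eq (K.*-identityˡ g))
    pow-cancel (suc k) f g eq = pow-cancel k f g (q-cancel _ _ (K.trans (K.sym (K.*-assoc q _ f)) (K.trans eq (K.*-assoc q _ g))))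

    -- Coefficient j + 1 of the functional equation.
    coeff-relation : ∀ N j → let g = jacobi q N in
      q ^ₖ j K.* g j K.+ q ^ₖ N K.* (q ^ₖ suc j K.* g (suc j)) K.≈ q ^ₖ N K.* (g (suc j) K.+ q ^ₖ N K.* g j)
    coeff-relation N j = begin
      q ^ₖ j K.* g j K.+ q ^ₖ N K.* (q ^ₖ suc j K.* g (suc j))
        ≈⟨ K.+-cong (var-⊛-suc (σ q g) j) (const-⊛ c (σ q g) (suc j)) ⟨
      (var * σ q g + const c * σ q g) (suc j)
        ≈⟨ at (solve 3 (λ x s c → x :* s :+ c :* s := s :* (x :+ c)) refl var (σ q g) (const c)) (suc j) ⟩
      (σ q g * (var + const c)) (suc j)
        ≈⟨ at (jacobi-functional q N) (suc j) ⟩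
      (const c * ((1# + const c * var) * g)) (suc j)
        ≈⟨ const-⊛ c _ (suc j) ⟩
      c K.* ((1# + const c * var) * g) (suc j)
        ≈⟨ K.*-congˡ (at (solve 3 (λ x g c → (:nat 1 :+ c :* x) :* g := g :+ c :* (x :* g)) refl var g (const c)) (suc j)) ⟩
      c K.* (g (suc j) K.+ (const c * (var * g)) (suc j))
        ≈⟨ K.*-congˡ (K.+-congˡ (K.trans (const-⊛ c _ (suc j)) (K.*-congˡ (var-⊛-suc g j)))) ⟩
      c K.* (g (suc j) K.+ c K.* g j) ∎
      where
      g = jacobi q N
      c = q ^ₖ N

    -- Common powers of q are cancelled, q^N here and q^j in `coeff-down`. Afterwards the error
    -- terms carry at least q^N, and the limiting ratio of neighbouring coefficients can be read
    -- off.
    coeff-up : ∀ N i → let g = jacobi q N in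
      g (suc (N ℕ.+ i)) K.+ q ^ₖ N K.* g (N ℕ.+ i) K.≈ q ^ₖ i K.* g (N ℕ.+ i) K.+ q ^ₖ suc (N ℕ.+ i) K.* g (suc (N ℕ.+ i))
    coeff-up N i = K.sym (pow-cancel N _ _ (begin
      q ^ₖ N K.* (q ^ₖ i K.* g (N ℕ.+ i) K.+ q ^ₖ suc (N ℕ.+ i) K.* g (suc (N ℕ.+ i)))
        ≈⟨ K.distribˡ _ _ _ ⟩
      q ^ₖ N K.* (q ^ₖ i K.* g (N ℕ.+ i)) K.+ q ^ₖ N K.* (q ^ₖ suc (N ℕ.+ i) K.* g (suc (N ℕ.+ i)))
        ≈⟨ K.+-congʳ (K.trans (K.sym (K.*-assoc _ _ _)) (K.*-congʳ (K.sym (^ₖ-homo q N i)))) ⟩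
      q ^ₖ (N ℕ.+ i) K.* g (N ℕ.+ i) K.+ q ^ₖ N K.* (q ^ₖ suc (N ℕ.+ i) K.* g (suc (N ℕ.+ i)))
        ≈⟨ coeff-relation N (N ℕ.+ i) ⟩
      q ^ₖ N K.* (g (suc (N ℕ.+ i)) K.+ q ^ₖ N K.* g (N ℕ.+ i)) ∎))
      where g = jacobi q N

    coeff-down : ∀ j i → let N = j ℕ.+ suc i ; g = jacobi q N in
      g j K.+ q ^ₖ suc N K.* g (suc j) K.≈ q ^ₖ suc i K.* g (suc j) K.+ q ^ₖ (suc i ℕ.+ N) K.* g j
    coeff-down j i = pow-cancel j _ _ (begin
      q ^ₖ j K.* (g j K.+ q ^ₖ suc N K.* g (suc j))
        ≈⟨ Kₙ.solve 5 (λ a b c d q → a Kₙ.:* (b Kₙ.:+ q Kₙ.:* c Kₙ.:* d) Kₙ.:= a Kₙ.:* b Kₙ.:+ c Kₙ.:* (q Kₙ.:* a Kₙ.:* d))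
             K.refl (q ^ₖ j) (g j) (q ^ₖ N) (g (suc j)) q ⟩
      q ^ₖ j K.* g j K.+ q ^ₖ N K.* (q ^ₖ suc j K.* g (suc j))
        ≈⟨ coeff-relation N j ⟩
      q ^ₖ N K.* (g (suc j) K.+ q ^ₖ N K.* g j)
        ≈⟨ K.*-cong (^ₖ-homo q j (suc i)) K.refl ⟩
      q ^ₖ j K.* q ^ₖ suc i K.* (g (suc j) K.+ q ^ₖ N K.* g j)
        ≈⟨ Kₙ.solve 5 (λ a b c d e → a Kₙ.:* b Kₙ.:* (c Kₙ.:+ d Kₙ.:* e) Kₙ.:= a Kₙ.:* (b Kₙ.:* c Kₙ.:+ b Kₙ.:* d Kₙ.:* e))
             K.refl (q ^ₖ j) (q ^ₖ suc i) (g (suc j)) (q ^ₖ N) (g j) ⟩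
      q ^ₖ j K.* (q ^ₖ suc i K.* g (suc j) K.+ q ^ₖ suc i K.* q ^ₖ N K.* g j)
        ≈⟨ K.*-congˡ (K.+-congˡ (K.*-congʳ (^ₖ-homo q (suc i) N))) ⟨
      q ^ₖ j K.* (q ^ₖ suc i K.* g (suc j) K.+ q ^ₖ (suc i ℕ.+ N) K.* g j) ∎)
      where
      N = j ℕ.+ suc i
      g = jacobi q N

    -- q^(i(i+1)/2).
    powers : ℕ → K.Carrier
    powers zero    = K.1#
    powers (suc i) = powers i K.* q ^ₖ suc i

    -- The products of 1 - q^(N+k) and of 1 - q^(N+1-k) over 1 ≤ k ≤ i. For i = N they are numerator
    -- and denominator of the Gaussian binomial coefficient of 2N over N.
    rising falling : ℕ → ℕ → K.Carrier
    rising N zero     = K.1#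
    rising N (suc i)  = rising N i K.* (K.1# K.- q ^ₖ (suc i ℕ.+ N))
    falling N zero    = K.1#
    falling N (suc i) = falling N i K.* (K.1# K.- q ^ₖ (N ℕ.∸ i))

    falling-suc : ∀ N i → falling (suc N) (suc i) K.≈ falling N i K.* (K.1# K.- q ^ₖ suc N)
    falling-suc N zero    = K.refl
    falling-suc N (suc i) = K.trans (K.*-congʳ (falling-suc N i))
      (Kₙ.solve 3 (λ a b c → a Kₙ.:* b Kₙ.:* c Kₙ.:= a Kₙ.:* c Kₙ.:* b) K.refl (falling N i) _ _)

    falling≈poch : ∀ N → falling N N K.≈ poch q N
    falling≈poch zero    = K.refl
    falling≈poch (suc N) = K.trans (falling-suc N N) (K.*-congʳ (falling≈poch N))

    coeff-zero : ∀ N → jacobi q N 0 K.≈ powers N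
    coeff-zero zero    = K.refl
    coeff-zero (suc N) = K.*-cong (coeff-zero N) (K.trans
      (K.*-cong (K.+-congˡ (K.zeroʳ _)) (K.+-identityˡ _))
      (K.trans (K.*-congʳ (K.+-identityʳ _)) (K.*-identityˡ _)))

    -- A walk from the centre down to coefficient 0, which is known explicitly; cross-multiplied, so
    -- that nothing has to be inverted.
    coeff-ratio : ∀ N i → i ℕ.≤ N → let g = jacobi q N in
      powers i K.* falling N i K.* g N K.≈ rising N i K.* g (N ℕ.∸ i)
    coeff-ratio N zero    _   = K.*-congʳ (K.*-identityˡ _)
    coeff-ratio N (suc i) i<N = begin
      powers i K.* q ^ₖ suc i K.* (falling N i K.* (K.1# K.- q ^ₖ (N ℕ.∸ i))) K.* g N
        ≈⟨ Kₙ.solve 5 (λ a b c d e → a Kₙ.:* b Kₙ.:* (c Kₙ.:* d) Kₙ.:* e Kₙ.:= a Kₙ.:* c Kₙ.:* e Kₙ.:* (b Kₙ.:* d))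
             K.refl (powers i) (q ^ₖ suc i) (falling N i) (K.1# K.- q ^ₖ (N ℕ.∸ i)) (g N) ⟩
      powers i K.* falling N i K.* g N K.* (q ^ₖ suc i K.* (K.1# K.- q ^ₖ (N ℕ.∸ i)))
        ≈⟨ K.*-congʳ (coeff-ratio N i (ℕₚ.<⇒≤ i<N)) ⟩
      rising N i K.* g (N ℕ.∸ i) K.* (q ^ₖ suc i K.* (K.1# K.- q ^ₖ (N ℕ.∸ i)))
        ≈⟨ K.trans (K.*-assoc _ _ _) (K.trans (K.*-congˡ step) (K.sym (K.*-assoc _ _ _))) ⟩
      rising N i K.* (K.1# K.- q ^ₖ (suc i ℕ.+ N)) K.* g (N ℕ.∸ suc i) ∎
      where
      g = jacobi q N
      j = N ℕ.∸ suc i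
      j+1+i : j ℕ.+ suc i ≡ N
      j+1+i = ℕₚ.m∸n+n≡m i<N
      1+j : N ℕ.∸ i ≡ suc j
      1+j = ℕₚ.+-cancelʳ-≡ i _ _ (≡.trans (ℕₚ.m∸n+n≡m (ℕₚ.<⇒≤ i<N)) (≡.trans (≡.sym j+1+i) (ℕₚ.+-suc j i)))
      down : g j K.+ q ^ₖ suc N K.* g (suc j) K.≈ q ^ₖ suc i K.* g (suc j) K.+ q ^ₖ (suc i ℕ.+ N) K.* g j
      down = ≡.subst (λ N → jacobi q N j K.+ q ^ₖ suc N K.* jacobi q N (suc j) K.≈ q ^ₖ suc i K.* jacobi q N (suc j) K.+ q ^ₖ (suc i ℕ.+ N) K.* jacobi q N j)
               j+1+i (coeff-down j i)
      step : g (N ℕ.∸ i) K.* (q ^ₖ suc i K.* (K.1# K.- q ^ₖ (N ℕ.∸ i))) K.≈ (K.1# K.- q ^ₖ (suc i ℕ.+ N)) K.* g j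
      step = begin
        g (N ℕ.∸ i) K.* (q ^ₖ suc i K.* (K.1# K.- q ^ₖ (N ℕ.∸ i)))
          ≡⟨ ≡.cong (λ k → g k K.* (q ^ₖ suc i K.* (K.1# K.- q ^ₖ k))) 1+j ⟩
        g (suc j) K.* (q ^ₖ suc i K.* (K.1# K.- q ^ₖ suc j))
          ≈⟨ Kₙ.solve 3 (λ g a b → g Kₙ.:* (a Kₙ.:* (Kₙ.:nat 1 Kₙ.:- b)) Kₙ.:= a Kₙ.:* g Kₙ.:- b Kₙ.:* a Kₙ.:* g)
               K.refl (g (suc j)) (q ^ₖ suc i) (q ^ₖ suc j) ⟩
        q ^ₖ suc i K.* g (suc j) K.- q ^ₖ suc j K.* q ^ₖ suc i K.* g (suc j)
          ≈⟨ K.+-congˡ (K.-‿cong (K.*-congʳ (K.trans (K.sym (^ₖ-homo q (suc j) (suc i))) (K.reflexive (≡.cong (λ k → q ^ₖ suc k) j+1+i))))) ⟩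
        q ^ₖ suc i K.* g (suc j) K.- q ^ₖ suc N K.* g (suc j)
          ≈⟨ Kₙ.solve 4 (λ s t u g → s Kₙ.:- t Kₙ.:= (s Kₙ.:+ u Kₙ.:* g) Kₙ.:- t Kₙ.:- u Kₙ.:* g)
               K.refl (q ^ₖ suc i K.* g (suc j)) (q ^ₖ suc N K.* g (suc j)) (q ^ₖ (suc i ℕ.+ N)) (g j) ⟩
        q ^ₖ suc i K.* g (suc j) K.+ q ^ₖ (suc i ℕ.+ N) K.* g j K.- q ^ₖ suc N K.* g (suc j) K.- q ^ₖ (suc i ℕ.+ N) K.* g j
          ≈⟨ K.+-congʳ (K.+-congʳ down) ⟨
        g j K.+ q ^ₖ suc N K.* g (suc j) K.- q ^ₖ suc N K.* g (suc j) K.- q ^ₖ (suc i ℕ.+ N) K.* g j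
          ≈⟨ Kₙ.solve 3 (λ g t u → g Kₙ.:+ t Kₙ.:- t Kₙ.:- u Kₙ.:* g Kₙ.:= (Kₙ.:nat 1 Kₙ.:- u) Kₙ.:* g)
               K.refl (g j) (q ^ₖ suc N K.* g (suc j)) (q ^ₖ (suc i ℕ.+ N)) ⟩
        (K.1# K.- q ^ₖ (suc i ℕ.+ N)) K.* g j ∎

    powers-cancel : ∀ i f g → powers i K.* f K.≈ powers i K.* g → f K.≈ g
    powers-cancel zero    f g eq = K.trans (K.sym (K.*-identityˡ f)) (K.trans eq (K.*-identityˡ g))
    powers-cancel (suc i) f g eq = pow-cancel (suc i) f g (powers-cancel i _ _
      (K.trans (K.sym (K.*-assoc _ _ f)) (K.trans eq (K.*-assoc _ _ g))))

    -- The central coefficient is the Gaussian binomial coefficient of 2N over N, which tends to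
    -- 1/(q;q)_∞.
    central-coeff : ∀ N → poch q N K.* jacobi q N N K.≈ rising N N
    central-coeff N = powers-cancel N _ _ (begin
      powers N K.* (poch q N K.* g N)        ≈⟨ K.*-congˡ (K.*-congʳ (falling≈poch N)) ⟨
      powers N K.* (falling N N K.* g N)     ≈⟨ K.*-assoc _ _ _ ⟨
      powers N K.* falling N N K.* g N       ≈⟨ coeff-ratio N N ℕₚ.≤-refl ⟩
      rising N N K.* g (N ℕ.∸ N)             ≡⟨ ≡.cong (λ k → rising N N K.* g k) (ℕₚ.n∸n≡0 N) ⟩
      rising N N K.* g 0                     ≈⟨ K.*-congˡ (coeff-zero N) ⟩
      rising N N K.* powers N                ≈⟨ K.*-comm _ _ ⟩
      powers N K.* rising N N                ∎)
      where g = jacobi q N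

  module _ (w : K.Carrier) (w-root : Root w) (q q₃ : K.Carrier) (q₃≈q³ : q₃ K.≈ q ^ₖ 3) where
    open import Relation.Binary.Reasoning.Setoid setoid

    private
      W T : Carrier
      W = const w
      T = 1# + W + W * W

      drop-T : ∀ f g → f + T * g ≈ f
      drop-T f g = trans (+-congˡ (trans (*-congʳ {g} (const-root w-root)) (zeroˡ g))) (+-identityʳ f)

      q₃-pow : ∀ N → const (q ^ₖ N) ^ 3 ≈ const (q₃ ^ₖ N)
      q₃-pow N = trans (solve 1 (λ c → c :^ 3 := c :* (c :* c)) refl c) (trans (*-congˡ (sym (const-* (q ^ₖ N) (q ^ₖ N))))
        (trans (sym (const-* (q ^ₖ N) (q ^ₖ N K.* q ^ₖ N))) (const-cong (K.trans
          (Kₙ.solve 1 (λ c → c Kₙ.:* (c Kₙ.:* c) Kₙ.:= c Kₙ.:^ 3) K.refl (q ^ₖ N))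
          (K.trans (^ₖ-assocʳ q N 3) (K.trans (K.reflexive (≡.cong (q ^ₖ_) (ℕₚ.*-comm N 3)))
            (K.trans (K.sym (^ₖ-assocʳ q 3 N)) (^ₖ-congˡ N (K.sym q₃≈q³)))))))))
        where c = const (q ^ₖ N)

    -- The three rotations of a linear factor multiply to 1 + r³ or X³ + e³, the corresponding
    -- factor for X³ and q³. Here `V` and `σ` act on the outer variable X, not on q.
    jacobi-triple : ∀ N → let g = jacobi q N in g * σ w g * σ (w K.* w) g ≈ V (jacobi q₃ N)
    jacobi-triple zero = begin
      1# * σ w 1# * σ (w K.* w) 1#  ≈⟨ *-cong (*-congˡ (σ-1# w)) (σ-1# (w K.* w)) ⟩
      1# * 1# * 1#                  ≈⟨ trans (*-identityʳ _) (*-identityʳ _) ⟩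
      1#                            ≈⟨ V-const K.1# ⟨
      V 1#                          ∎
    jacobi-triple (suc N) = begin
      G * (f * h) * σ w (G * (f * h)) * σ (w K.* w) (G * (f * h))
        ≈⟨ *-cong (*-congˡ (σ³ w)) (σ³ (w K.* w)) ⟩
      G * (f * h) * (σ w G * (σ w f * σ w h)) * (σ (w K.* w) G * (σ (w K.* w) f * σ (w K.* w) h))
        ≈⟨ solve 9 (λ g₀ g₁ g₂ f₀ f₁ f₂ h₀ h₁ h₂ → g₀ :* (f₀ :* h₀) :* (g₁ :* (f₁ :* h₁)) :* (g₂ :* (f₂ :* h₂))
             := g₀ :* g₁ :* g₂ :* (f₀ :* f₁ :* f₂ :* (h₀ :* h₁ :* h₂))) refl G (σ w G) (σ (w K.* w) G) f (σ w f) (σ (w K.* w) f) h (σ w h) (σ (w K.* w) h) ⟩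
      G * σ w G * σ (w K.* w) G * (f * σ w f * σ (w K.* w) f * (h * σ w h * σ (w K.* w) h))
        ≈⟨ *-cong (jacobi-triple N) (*-cong F H) ⟩
      V (jacobi q₃ N) * (V f₃ * V h₃)
        ≈⟨ trans (V-⊛ (jacobi q₃ N) (f₃ * h₃)) (*-congˡ (V-⊛ f₃ h₃)) ⟨
      V (jacobi q₃ N * (f₃ * h₃)) ∎
      where
      G c e f h f₃ h₃ : Carrier
      G = jacobi q N
      c = const (q ^ₖ N)
      e = const (q ^ₖ suc N)
      f = 1# + c * var
      h = var + e
      f₃ = 1# + const (q₃ ^ₖ N) * var
      h₃ = var + const (q₃ ^ₖ suc N)

      σ³ : ∀ c → σ c (G * (f * h)) ≈ σ c G * (σ c f * σ c h)
      σ³ c = trans (σ-⊛ c G (f * h)) (*-congˡ (σ-⊛ c f h))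

      F : f * σ w f * σ (w K.* w) f ≈ V f₃
      F = begin
        f * σ w f * σ (w K.* w) f
          ≈⟨ *-cong (*-congˡ (σ-linear w K.1# (q ^ₖ N))) (trans (σ-linear (w K.* w) K.1# (q ^ₖ N)) (+-congˡ (*-congʳ (const-* w w)))) ⟩
        f * (1# + W * (c * var)) * (1# + W * W * (c * var))
          ≈⟨ solve 3 (λ w c x → let r = c :* x in (:nat 1 :+ r) :* (:nat 1 :+ w :* r) :* (:nat 1 :+ w :* w :* r)
               := :nat 1 :+ c :^ 3 :* x :^ 3 :+ (:nat 1 :+ w :+ w :* w) :* (r :+ w :* r :* r :+ (w :- :nat 1) :* r :* r :* r)) refl W c var ⟩
        1# + c ^ 3 * var ^ 3 + T * (c * var + W * (c * var) * (c * var) + (W - 1#) * (c * var) * (c * var) * (c * var))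
          ≈⟨ drop-T _ _ ⟩
        1# + c ^ 3 * var ^ 3
          ≈⟨ +-congˡ (*-cong (q₃-pow N) (sym V-var)) ⟩
        1# + const (q₃ ^ₖ N) * V var
          ≈⟨ +-cong (V-const K.1#) (trans (V-⊛ (const (q₃ ^ₖ N)) var) (*-congʳ (V-const _))) ⟨
        V 1# + V (const (q₃ ^ₖ N) * var)
          ≈⟨ V-⊕ 1# (const (q₃ ^ₖ N) * var) ⟨
        V f₃ ∎

      H : h * σ w h * σ (w K.* w) h ≈ V h₃
      H = begin
        h * σ w h * σ (w K.* w) h
          ≈⟨ *-cong (*-congˡ (σ-monic w (q ^ₖ suc N))) (trans (σ-monic (w K.* w) (q ^ₖ suc N)) (+-congʳ (*-congʳ {var} (const-* w w)))) ⟩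
        h * (W * var + e) * (W * W * var + e)
          ≈⟨ solve 3 (λ w e x → (x :+ e) :* (w :* x :+ e) :* (w :* w :* x :+ e)
               := x :^ 3 :+ e :^ 3 :+ (:nat 1 :+ w :+ w :* w) :* ((w :- :nat 1) :* x :* x :* x :+ w :* x :* x :* e :+ x :* e :* e)) refl W e var ⟩
        var ^ 3 + e ^ 3 + T * ((W - 1#) * var * var * var + W * var * var * e + var * e * e)
          ≈⟨ drop-T _ _ ⟩
        var ^ 3 + e ^ 3
          ≈⟨ +-cong V-var (trans (V-const _) (sym (q₃-pow (suc N)))) ⟨
        V var + V (const (q₃ ^ₖ suc N))
          ≈⟨ V-⊕ var (const (q₃ ^ₖ suc N)) ⟨
        V h₃ ∎

-- Theta series of the hexagonal lattice

-- n(n - 1)/2, one step behind the usual triangular numbers.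
triangular : ℕ → ℕ
triangular zero    = 0
triangular (suc n) = n ℕ.+ triangular n

-- exponent N i = k(k−1)/2 for k = i − N.
exponent : ℕ → ℕ → ℕ
exponent N i = triangular (i ℕ.∸ N) ℕ.+ triangular (suc (N ℕ.∸ i))

exponent-+ : ∀ N k → exponent N (N ℕ.+ k) ≡ triangular k
exponent-+ N k rewrite ℕₚ.m+n∸m≡n N k | ℕₚ.m≤n⇒m∸n≡0 (ℕₚ.m≤m+n N k) = ℕₚ.+-identityʳ _

exponent-∸ : ∀ i k → exponent (i ℕ.+ k) i ≡ triangular (suc k)
exponent-∸ i k rewrite ℕₚ.m+n∸m≡n i k | ℕₚ.m≤n⇒m∸n≡0 (ℕₚ.m≤m+n i k) = ≡.refl

2*triangular : ∀ n → + 2 ℤ.* + triangular n ≡ + n ℤ.* + n ℤ.- + n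
2*triangular zero    = ≡.refl
2*triangular (suc n) = ≡.trans (lemma₁ (+ n) (+ triangular n)) (≡.trans (≡.cong (λ t → + 2 ℤ.* + n ℤ.+ t) (2*triangular n)) (lemma₂ (+ n)))
  where
  lemma₁ : ∀ n t → + 2 ℤ.* (n ℤ.+ t) ≡ + 2 ℤ.* n ℤ.+ + 2 ℤ.* t
  lemma₁ = solve-∀
  lemma₂ : ∀ n → + 2 ℤ.* n ℤ.+ (n ℤ.* n ℤ.- n) ≡ (+ 1 ℤ.+ n) ℤ.* (+ 1 ℤ.+ n) ℤ.- (+ 1 ℤ.+ n)
  lemma₂ = solve-∀

2*exponent : ∀ N i → let k = + i ℤ.- + N in + 2 ℤ.* + exponent N i ≡ k ℤ.* k ℤ.- k
2*exponent N i with ℕₚ.≤-total N i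
... | inj₁ N≤i with k , ≡.refl ← ℕₚ.m≤n⇒∃[o]m+o≡n N≤i = ≡.trans (≡.cong (λ e → + 2 ℤ.* + e) (exponent-+ N k))
        (≡.trans (2*triangular k) (lemma (+ N) (+ k)))
  where
  lemma : ∀ n k → k ℤ.* k ℤ.- k ≡ (n ℤ.+ k ℤ.- n) ℤ.* (n ℤ.+ k ℤ.- n) ℤ.- (n ℤ.+ k ℤ.- n)
  lemma = solve-∀
... | inj₂ i≤N with k , ≡.refl ← ℕₚ.m≤n⇒∃[o]m+o≡n i≤N = ≡.trans (≡.cong (λ e → + 2 ℤ.* + e) (exponent-∸ i k))
        (≡.trans (2*triangular (suc k)) (lemma (+ i) (+ k)))
  where
  lemma : ∀ i k → (+ 1 ℤ.+ k) ℤ.* (+ 1 ℤ.+ k) ℤ.- (+ 1 ℤ.+ k) ≡ (i ℤ.- (i ℤ.+ k)) ℤ.* (i ℤ.- (i ℤ.+ k)) ℤ.- (i ℤ.- (i ℤ.+ k))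
  lemma = solve-∀

-- The shifted indices k, m, h sum to 0, so the linear terms of the three exponents cancel and k² +
-- m² + h² = 2Q(k, m). Doubling over ℤ avoids halves and truncated subtraction.
exponent-sum : ∀ N i j l → i ℕ.+ (j ℕ.+ l) ≡ N ℕ.* 3 →
               + (exponent N i ℕ.+ (exponent N j ℕ.+ exponent N l)) ≡ Q (+ i ℤ.- + N) (+ j ℤ.- + N)
exponent-sum N i j l eq = ℤₚ.*-cancelˡ-≡ (+ 2) _ _ (begin
  + 2 ℤ.* (+ exponent N i ℤ.+ (+ exponent N j ℤ.+ + exponent N l))
    ≡⟨ distrib (+ exponent N i) (+ exponent N j) (+ exponent N l) ⟩
  + 2 ℤ.* + exponent N i ℤ.+ (+ 2 ℤ.* + exponent N j ℤ.+ + 2 ℤ.* + exponent N l)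
    ≡⟨ ≡.cong₂ ℤ._+_ (2*exponent N i) (≡.cong₂ ℤ._+_ (2*exponent N j) (2*exponent N l)) ⟩
  f (+ i) ℤ.+ (f (+ j) ℤ.+ f (+ l))
    ≡⟨ ≡.cong (λ l → f (+ i) ℤ.+ (f (+ j) ℤ.+ f l)) l≡ ⟩
  f (+ i) ℤ.+ (f (+ j) ℤ.+ f (+ N ℤ.* + 3 ℤ.- + i ℤ.- + j))
    ≡⟨ lemma (+ i) (+ j) (+ N) ⟩
  + 2 ℤ.* Q (+ i ℤ.- + N) (+ j ℤ.- + N) ∎)
  where
  open ≡.≡-Reasoning
  f : ℤ → ℤ
  f i = (i ℤ.- + N) ℤ.* (i ℤ.- + N) ℤ.- (i ℤ.- + N)
  distrib : ∀ a b c → + 2 ℤ.* (a ℤ.+ (b ℤ.+ c)) ≡ + 2 ℤ.* a ℤ.+ (+ 2 ℤ.* b ℤ.+ + 2 ℤ.* c)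
  distrib = solve-∀
  isolate : ∀ i j l → l ≡ i ℤ.+ (j ℤ.+ l) ℤ.- i ℤ.- j
  isolate = solve-∀
  l≡ : + l ≡ + N ℤ.* + 3 ℤ.- + i ℤ.- + j
  l≡ = ≡.trans (isolate (+ i) (+ j) (+ l)) (≡.cong (λ s → s ℤ.- + i ℤ.- + j) (≡.trans (≡.cong +_ eq) (ℤₚ.pos-* N 3)))
  lemma : ∀ i j n → let k = i ℤ.- n ; m = j ℤ.- n ; h = n ℤ.* + 3 ℤ.- i ℤ.- j ℤ.- n in
          (k ℤ.* k ℤ.- k) ℤ.+ ((m ℤ.* m ℤ.- m) ℤ.+ (h ℤ.* h ℤ.- h)) ≡ + 2 ℤ.* (k ℤ.* k ℤ.+ m ℤ.* m ℤ.+ k ℤ.* m)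
  lemma = solve-∀

Q-sym : ∀ k m → Q k m ≡ Q m k
Q-sym = lemma
  where
  lemma : ∀ k m → k ℤ.* k ℤ.+ m ℤ.* m ℤ.+ k ℤ.* m ≡ m ℤ.* m ℤ.+ k ℤ.* k ℤ.+ m ℤ.* k
  lemma = solve-∀

-- From 4Q = 3k² + (k + 2m)²: a larger k would give 4n ≥ 3(n + 1)² > 4n.
Q-boundˡ : ∀ k m n → Q k m ≡ + n → ∣ k ∣ ℕ.≤ n
Q-boundˡ k m n eq with ∣ k ∣ ≤? n
... | yes k≤n = k≤n
... | no  k≰n = ⊥-elim (ℕₚ.<-irrefl ≡.refl (begin-strict
  4 ℕ.* n
    <⟨ s≤s (ℕₚ.m≤m+n (4 ℕ.* n) _) ⟩
  suc (4 ℕ.* n ℕ.+ (n ℕ.* 2 ℕ.+ n ℕ.* n ℕ.* 3 ℕ.+ 2))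
    ≡⟨ expand n ⟩
  suc n ℕ.* suc n ℕ.* 3
    ≤⟨ ℕₚ.*-monoˡ-≤ 3 (ℕₚ.*-mono-≤ n<k n<k) ⟩
  ∣ k ∣ ℕ.* ∣ k ∣ ℕ.* 3
    ≤⟨ ℕₚ.m≤m+n _ _ ⟩
  ∣ k ∣ ℕ.* ∣ k ∣ ℕ.* 3 ℕ.+ ∣ h ∣ ℕ.* ∣ h ∣
    ≡⟨ ℤₚ.+-injective squares ⟨
  4 ℕ.* n ∎))
  where
  open ℕₚ.≤-Reasoning
  n<k : suc n ℕ.≤ ∣ k ∣
  n<k = ℕₚ.≰⇒> k≰n
  h : ℤ
  h = k ℤ.+ + 2 ℤ.* m
  expand : ∀ n → suc (4 ℕ.* n ℕ.+ (n ℕ.* 2 ℕ.+ n ℕ.* n ℕ.* 3 ℕ.+ 2)) ≡ suc n ℕ.* suc n ℕ.* 3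
  expand = ℕ-Solver.solve-∀
  complete : ∀ k m → + 4 ℤ.* (k ℤ.* k ℤ.+ m ℤ.* m ℤ.+ k ℤ.* m) ≡ k ℤ.* k ℤ.* + 3 ℤ.+ (k ℤ.+ + 2 ℤ.* m) ℤ.* (k ℤ.+ + 2 ℤ.* m)
  complete = solve-∀
  square : ∀ i → i ℤ.* i ≡ + (∣ i ∣ ℕ.* ∣ i ∣)
  square (+ n)    = ≡.sym (ℤₚ.pos-* n n)
  square -[1+ n ] = ≡.refl
  squares : + (4 ℕ.* n) ≡ + (∣ k ∣ ℕ.* ∣ k ∣ ℕ.* 3 ℕ.+ ∣ h ∣ ℕ.* ∣ h ∣)
  squares = ≡.trans (ℤₚ.pos-* 4 n) (≡.trans (≡.cong (+ 4 ℤ.*_) (≡.sym eq)) (≡.trans (complete k m)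
    (≡.cong₂ ℤ._+_ (≡.trans (≡.cong (ℤ._* + 3) (square k)) (≡.sym (ℤₚ.pos-* (∣ k ∣ ℕ.* ∣ k ∣) 3))) (square h))))

Q-boundʳ : ∀ k m n → Q k m ≡ + n → ∣ m ∣ ℕ.≤ n
Q-boundʳ k m n eq = Q-boundˡ m k n (≡.trans (Q-sym m k) eq)

-- Finite sums

module Sums (K : CommutativeRing 0ℓ 0ℓ) where
  open CommutativeRing K hiding (zero)
  open PowerSeries K using (sum)
  open import Algebra.Properties.CommutativeSemigroup +-commutativeSemigroup using (interchange)

  sum-zero : ∀ n {f : ℕ → Carrier} → (∀ i → i ℕ.< n → f i ≈ 0#) → sum n f ≈ 0#
  sum-zero zero    p = refl
  sum-zero (suc n) p = trans (+-cong (p 0 (s≤s z≤n)) (sum-zero n (λ i i<n → p (suc i) (s≤s i<n)))) (+-identityˡ _)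

  sum-split : ∀ m n (f : ℕ → Carrier) → sum (m ℕ.+ n) f ≈ sum m f + sum n (λ i → f (m ℕ.+ i))
  sum-split zero    n f = sym (+-identityˡ _)
  sum-split (suc m) n f = trans (+-congˡ (sum-split m n (λ i → f (suc i)))) (sym (+-assoc _ _ _))

  sum-+ : ∀ n (f g : ℕ → Carrier) → sum n (λ i → f i + g i) ≈ sum n f + sum n g
  sum-+ zero    f g = sym (+-identityˡ _)
  sum-+ (suc n) f g = trans (+-congˡ (sum-+ n (λ i → f (suc i)) (λ i → g (suc i)))) (interchange _ _ _ _)

  sum-*ˡ : ∀ n c (f : ℕ → Carrier) → c * sum n f ≈ sum n (λ i → c * f i)
  sum-*ˡ zero    c f = zeroʳ c
  sum-*ˡ (suc n) c f = trans (distribˡ c _ _) (+-congˡ (sum-*ˡ n c (λ i → f (suc i))))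

  sum-*ʳ : ∀ n c (f : ℕ → Carrier) → sum n f * c ≈ sum n (λ i → f i * c)
  sum-*ʳ zero    c f = zeroˡ c
  sum-*ʳ (suc n) c f = trans (distribʳ c _ _) (+-congˡ (sum-*ʳ n c (λ i → f (suc i))))

  sum-swap : ∀ m n (f : ℕ → ℕ → Carrier) → sum m (λ i → sum n (λ j → f i j)) ≈ sum n (λ j → sum m (λ i → f i j))
  sum-swap zero    n f = sym (sum-zero n (λ _ _ → refl))
  sum-swap (suc m) n f = trans (+-congˡ (sum-swap m n (λ i → f (suc i)))) (sym (sum-+ n (f 0) (λ j → sum m (λ i → f (suc i) j))))

  sum-window : ∀ s k n (f : ℕ → Carrier) → s ℕ.+ k ℕ.≤ n →
               (∀ i → i ℕ.< n → i ℕ.< s → f i ≈ 0#) → (∀ i → i ℕ.< n → s ℕ.+ k ℕ.≤ i → f i ≈ 0#) →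
               sum n f ≈ sum k (λ i → f (s ℕ.+ i))
  sum-window s k n f s+k≤n low high with r , ≡.refl ← ℕₚ.m≤n⇒∃[o]m+o≡n s+k≤n =
    trans (sum-split (s ℕ.+ k) r f)
      (trans (+-cong (sum-split s k f)
                     (sum-zero r (λ i i<r → high (s ℕ.+ k ℕ.+ i) (ℕₚ.+-monoʳ-< (s ℕ.+ k) i<r) (ℕₚ.m≤m+n (s ℕ.+ k) i))))
      (trans (+-identityʳ _)
      (trans (+-congʳ (sum-zero s (λ i i<s → low i (ℕₚ.<-≤-trans i<s (ℕₚ.≤-trans (ℕₚ.m≤m+n s k) s+k≤n)) i<s)))
             (+-identityˡ _))))

  [_] : {A : Set} → Dec A → Carrier
  [ d ] = if does d then 1# else 0#

  []-false : {A : Set} (d : Dec A) → ¬ A → [ d ] ≈ 0#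
  []-false d ¬a = reflexive (≡.cong (if_then 1# else 0#) (dec-false d ¬a))

  []-true : {A : Set} (d : Dec A) → A → [ d ] ≈ 1#
  []-true d a = reflexive (≡.cong (if_then 1# else 0#) (dec-true d a))

  []-cong : {A B : Set} (d : Dec A) (e : Dec B) → (A → B) → (B → A) → [ d ] ≈ [ e ]
  []-cong (yes a) e f g = sym ([]-true e (f a))
  []-cong (no ¬a) e f g = sym ([]-false e (λ b → ¬a (g b)))

-- A vector of norm m has coordinates at most m in absolute value, so only 2m + 1 indices around N =
-- s + m matter.
index-in-window : ∀ s m i n k → + n ≡ Q (+ i ℤ.- + (s ℕ.+ m)) k → n ≡ m → s ℕ.≤ i × i ℕ.< s ℕ.+ suc (m ℕ.+ m)
index-in-window s m i n k eq ≡.refl = low , ≡.subst (suc i ℕ.≤_) shift (s≤s high)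
  where
  N = s ℕ.+ m
  bound : ∣ i ⊖ N ∣ ℕ.≤ m
  bound = ≡.subst (λ z → ∣ z ∣ ℕ.≤ m) (ℤₚ.m-n≡m⊖n i N) (Q-boundˡ (+ i ℤ.- + N) k m (≡.sym eq))
  low : s ℕ.≤ i
  low with ℕₚ.≤-total i N
  ... | inj₁ i≤N = ℕₚ.+-cancelʳ-≤ m s i (ℕₚ.≤-trans (ℕₚ.m≤n+m∸n N i) (ℕₚ.+-monoʳ-≤ i (≡.subst (ℕ._≤ m) (ℤₚ.∣⊖∣-≤ i≤N) bound)))
  ... | inj₂ N≤i = ℕₚ.≤-trans (ℕₚ.m≤m+n s m) N≤i
  high : i ℕ.≤ N ℕ.+ m
  high with ℕₚ.≤-total i N
  ... | inj₁ i≤N = ℕₚ.≤-trans i≤N (ℕₚ.m≤m+n N m)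
  ... | inj₂ N≤i = ℕₚ.≤-trans (ℕₚ.m≤n+m∸n i N) (ℕₚ.+-monoʳ-≤ N (≡.subst (ℕ._≤ m) (≡.trans (≡.cong ∣_∣ (ℤₚ.⊖-swap i N)) (≡.trans (ℤₚ.∣-i∣≡∣i∣ (N ⊖ i)) (ℤₚ.∣⊖∣-≤ N≤i))) bound))
  shift : suc (N ℕ.+ m) ≡ s ℕ.+ suc (m ℕ.+ m)
  shift = ≡.trans (≡.cong suc (ℕₚ.+-assoc s m m)) (≡.sym (ℕₚ.+-suc s (m ℕ.+ m)))

-- Constant term of the product of three theta functions

module ThetaProduct (R : CommutativeRing 0ℓ 0ℓ)
  (ω : CommutativeRing.Carrier R)
  (ω-root : PrimitiveCubeRoots.Root R ω)
  where
  private
    module R = CommutativeRing R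
  open PowerSeries R
  open Dissection R
  open Coefficients R
  open EulerProduct R
  open PrimitiveCubeRoots R
  open CommutativeRing ring[[X]] hiding (zero)
  open IntegerSolver ring[[X]]
  open Pochhammer ring[[X]]
  open JacobiProduct ring[[X]]
  open Sums R
  open import Algebra.Properties.Ring R.ring using (-0#≈0#)
  open import Algebra.Properties.Semiring.Exp R.semiring using () renaming (_^_ to _^ᵣ_)
  open import Algebra.Properties.Semiring.Exp semiring using (_^_; ^-congˡ; ^-homo-*)
  open import Algebra.Properties.CommutativeSemiring.Exp commutativeSemiring using (^-distrib-*)
  private
    module L = PowerSeries ring[[X]]
    module LS = Sums ring[[X]]

  module _ (q q′ : Carrier) (q≈ : q ≈ var * q′) (q-cancel : ∀ f g → q * f ≈ q * g → f ≈ g) where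

    pow-small : ∀ k f n → n ℕ.< k → (q ^ k * f) n R.≈ R.0#
    pow-small k f n n<k = R.trans (at (trans (*-congʳ {f} (trans (^-congˡ k q≈) (^-distrib-* var q′ k))) (*-assoc (var ^ k) (q′ ^ k) f)) n)
      (pow-⊛-< k (q′ ^ k * f) n n<k)

    rising≈1 : ∀ N i → rising q q-cancel N i ≈[ N ] 1#
    rising≈1 N zero    m m≤N = R.refl
    rising≈1 N (suc i) m m≤N = R.trans
      (at (solve 2 (λ r t → r :* (:nat 1 :- t) := r :- t :* r) refl (rising q q-cancel N i) (q ^ (suc i ℕ.+ N))) m)
      (R.trans (R.+-cong (rising≈1 N i m m≤N)
                 (R.trans (R.-‿cong (pow-small (suc i ℕ.+ N) _ m (s≤s (ℕₚ.≤-trans m≤N (ℕₚ.m≤n+m N i))))) -0#≈0#))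
               (R.+-identityʳ _))

    -- The central coefficient is `rising` over `poch q N`, and `rising` is 1 modulo X^(N+1) because
    -- X divides q. The general q serves both `var` and `V var`.
    central-limit : ∀ N (f : Carrier) → poch q N * f ≈ 1# → jacobi q N N ≈[ N ] f
    central-limit N f inv m m≤N = R.trans
      (at (trans (sym (*-identityʳ c)) (trans (*-congˡ {c} (sym inv)) (solve 3 (λ c e f → c :* (e :* f) := e :* c :* f)
           refl c (poch q N) f))) m)
      (R.trans (⊛-cong[] N (λ k k≤N → R.trans (at (central-coeff q q-cancel N) k) (rising≈1 N N k k≤N)) (λ _ _ → R.refl) m m≤N)
               (at (*-identityˡ f) m))
      where
      c : Carrier
      c = jacobi q N N

  V-cancel : ∀ f g → V var * f ≈ V var * g → f ≈ g
  V-cancel f g eq = var-cancel f g (var-cancel _ _ (var-cancel _ _ (trans (assoc f) (trans eq (sym (assoc g))))))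
    where
    assoc : ∀ f → var * (var * (var * f)) ≈ V var * f
    assoc f = trans (solve 2 (λ q f → q :* (q :* (q :* f)) := q :* q :* q :* f) refl var f) (*-congʳ (sym V-q))

  V-pow-var : ∀ m → V (var ^ m) ≈ V var ^ m
  V-pow-var zero    = V-const R.1#
  V-pow-var (suc m) = trans (V-⊛ var (var ^ m)) (*-congˡ (V-pow-var m))

  V-poch : ∀ N → V (poch var N) ≈ poch (V var) N
  V-poch zero    = V-const R.1#
  V-poch (suc N) = trans (V-⊛ (poch var N) (1# - var ^ suc N))
    (*-cong (V-poch N) (trans (V-1 (var ^ suc N)) (+-congˡ (-‿cong (V-pow-var (suc N))))))

  central-P : ∀ N → jacobi var N N ≈[ N ] P
  central-P N m m≤N = R.trans (central-limit var 1# (sym (*-identityʳ var)) var-cancel N (Pₙ N) (poch*Pₙ≈1 N) m m≤N)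
    (R.sym (P≈[]Pₙ N m m≤N))

  central-VP : ∀ N → jacobi (V var) N N ≈[ N ] V P
  central-VP N m m≤N = R.trans
    (central-limit (V var) (var * var) (trans V-q (*-assoc var var var)) V-cancel N (V (Pₙ N))
      (trans (*-congʳ (sym (V-poch N))) (trans (sym (V-⊛ (poch var N) (Pₙ N))) (trans (V-cong (poch*Pₙ≈1 N)) (V-const R.1#)))) m m≤N)
    (R.sym (V-cong[] N (P≈[]Pₙ N) m m≤N))

  weight : ℕ → ℕ → R.Carrier
  weight j l = ω ^ᵣ j R.* (ω R.* ω) ^ᵣ l

  triangleTerm : ℕ → ℕ → ℕ → Carrier
  triangleTerm N i j =
    let l = N ℕ.* 3 ℕ.∸ i ℕ.∸ j in const (weight j l) * var ^ (exponent N i ℕ.+ (exponent N j ℕ.+ exponent N l))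

  -- The coefficient of X^(3N) in g(X) g(ωX) g(ω²X) for g = `jacobi var N`, with each coefficient of
  -- g replaced by its limit stripped of the factor `P`.
  triangle : ℕ → Carrier
  triangle N = L.sum (suc (N ℕ.* 3)) (λ i → L.sum (suc (N ℕ.* 3 ℕ.∸ i)) (triangleTerm N i))

  module _ (N n : ℕ) (n<N : n ℕ.< N) where
    private
      g : ℕ → Carrier
      g = jacobi var N
      κ : Carrier
      κ = g N

    -- Induction outwards from the centre: the two error terms of `coeff-up` are invisible up to n
    -- because n < N.
    coeff-above : ∀ i → g (N ℕ.+ i) ≈[ n ] var ^ triangular i * κ
    coeff-above zero    m m≤n = R.trans (R.reflexive (≡.cong (λ k → g k m) (ℕₚ.+-identityʳ N))) (R.sym (at (*-identityˡ κ) m))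
    coeff-above (suc i) m m≤n = R.trans (R.reflexive (≡.cong (λ k → g k m) (ℕₚ.+-suc N i)))
      (R.trans (R.sym (R.trans (R.+-congˡ (pow-⊛-< N (g (N ℕ.+ i)) m (ℕₚ.≤-<-trans m≤n n<N))) (R.+-identityʳ _)))
      (R.trans (at (coeff-up var var-cancel N i) m)
      (R.trans (R.+-congˡ (pow-⊛-< (suc (N ℕ.+ i)) (g (suc (N ℕ.+ i))) m (s≤s (ℕₚ.≤-trans m≤n (ℕₚ.≤-trans (ℕₚ.<⇒≤ n<N) (ℕₚ.m≤m+n N i))))))
      (R.trans (R.+-identityʳ _)
      (R.trans (⊛-cong[] n (λ _ _ → R.refl) (coeff-above i) m m≤n)
               (at (trans (sym (*-assoc (var ^ i) (var ^ triangular i) κ)) (*-congʳ (sym (^-homo-* var i (triangular i))))) m))))))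

    coeff-below : ∀ i j → j ℕ.+ i ≡ N → g j ≈[ n ] var ^ triangular (suc i) * κ
    coeff-below zero    j eq m m≤n = R.trans (R.reflexive (≡.cong (λ k → g k m) (≡.trans (≡.sym (ℕₚ.+-identityʳ j)) eq))) (R.sym (at (*-identityˡ κ) m))
    coeff-below (suc i) j eq m m≤n = R.trans
      (R.sym (R.trans (R.+-congˡ (pow-⊛-< (suc N) (g (suc j)) m (s≤s (ℕₚ.≤-trans m≤n (ℕₚ.<⇒≤ n<N))))) (R.+-identityʳ _)))
      (R.trans (at down m)
      (R.trans (R.+-congˡ (pow-⊛-< (suc i ℕ.+ N) (g j) m (ℕₚ.<-≤-trans (ℕₚ.≤-<-trans m≤n n<N) (ℕₚ.m≤n+m N (suc i)))))
      (R.trans (R.+-identityʳ _)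
      (R.trans (⊛-cong[] n (λ _ _ → R.refl) (coeff-below i (suc j) (≡.trans (≡.sym (ℕₚ.+-suc j i)) eq)) m m≤n)
               (at (trans (sym (*-assoc (var ^ suc i) (var ^ triangular (suc i)) κ)) (*-congʳ (sym (^-homo-* var (suc i) (triangular (suc i)))))) m)))))
      where
      down : g j + var ^ suc N * g (suc j) ≈ var ^ suc i * g (suc j) + var ^ (suc i ℕ.+ N) * g j
      down = ≡.subst (λ N → jacobi var N j + var ^ suc N * jacobi var N (suc j) ≈ var ^ suc i * jacobi var N (suc j) + var ^ (suc i ℕ.+ N) * jacobi var N j)
               eq (coeff-down var var-cancel j i)

    coeff-approx : ∀ i → g i ≈[ n ] var ^ exponent N i * κ
    coeff-approx i m m≤n with ℕₚ.≤-total N i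
    ... | inj₁ N≤i with k , N+k≡i ← ℕₚ.m≤n⇒∃[o]m+o≡n N≤i =
      ≡.subst (λ i → g i m R.≈ (var ^ exponent N i * κ) m) N+k≡i
        (R.trans (coeff-above k m m≤n) (R.reflexive (≡.cong (λ e → (var ^ e * κ) m) (≡.sym (exponent-+ N k)))))
    ... | inj₂ i≤N with k , i+k≡N ← ℕₚ.m≤n⇒∃[o]m+o≡n i≤N =
      R.trans (coeff-below k i i+k≡N m m≤n)
        (R.reflexive (≡.cong (λ e → (var ^ e * κ) m) (≡.trans (≡.sym (exponent-∸ i k)) (≡.cong (λ N → exponent N i) i+k≡N))))

    sum-cong[] : ∀ k {f h : ℕ → Carrier} → (∀ i → f i ≈[ n ] h i) → L.sum k f ≈[ n ] L.sum k h
    sum-cong[] zero    p m m≤n = R.refl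
    sum-cong[] (suc k) p m m≤n = R.+-cong (p 0 m m≤n) (sum-cong[] k (λ i → p (suc i)) m m≤n)

    const-pow : ∀ c k → const c ^ k ≈ const (c ^ᵣ k)
    const-pow c zero    = refl
    const-pow c (suc k) = trans (*-congˡ (const-pow c k)) (sym (const-* c (c ^ᵣ k)))

    term-approx : ∀ i j → let l = N ℕ.* 3 ℕ.∸ i ℕ.∸ j in
      g i * (L.σ (const ω) g j * L.σ (const ω * const ω) g l) ≈[ n ] triangleTerm N i j * (κ * κ * κ)
    term-approx i j m m≤n = R.trans
      (⊛-cong[] n (coeff-approx i) (⊛-cong[] n (⊛-cong[] n (λ _ _ → R.refl) (coeff-approx j)) (⊛-cong[] n (λ _ _ → R.refl) (coeff-approx l))) m m≤n)
      (at (trans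
        (solve 6 (λ a b c s t k → a :* k :* (s :* (b :* k) :* (t :* (c :* k))) := s :* t :* (a :* (b :* c)) :* (k :* k :* k)) refl
          (var ^ exponent N i) (var ^ exponent N j) (var ^ exponent N l) (const ω ^ j) ((const ω * const ω) ^ l) κ)
        (*-congʳ {κ * κ * κ} (*-cong
          (trans (*-cong (const-pow ω j) (trans (^-congˡ l (sym (const-* ω ω))) (const-pow (ω R.* ω) l))) (sym (const-* (ω ^ᵣ j) ((ω R.* ω) ^ᵣ l))))
          (trans (*-congˡ {var ^ exponent N i} (sym (^-homo-* var (exponent N j) (exponent N l)))) (sym (^-homo-* var (exponent N i) (exponent N j ℕ.+ exponent N l))))))) m)
      where
      l = N ℕ.* 3 ℕ.∸ i ℕ.∸ j

    -- Each of the three factors is shifted by X^N, so the constant term sits at X^(3N).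
    triple-coefficient : L.sum (suc (N ℕ.* 3)) (λ i → L.sum (suc (N ℕ.* 3 ℕ.∸ i)) (λ j →
                           g i * (L.σ (const ω) g j * L.σ (const ω * const ω) g (N ℕ.* 3 ℕ.∸ i ℕ.∸ j))))
                         ≈ jacobi (V var) N N
    triple-coefficient = begin
      L.sum (suc M) (λ i → L.sum (suc (M ℕ.∸ i)) (λ j → g i * (h j * k (M ℕ.∸ i ℕ.∸ j))))
        ≈⟨ L.sum-cong (suc M) (λ i _ → trans (*-congˡ {g i} (L.⊛-sum h k (M ℕ.∸ i))) (LS.sum-*ˡ (suc (M ℕ.∸ i)) (g i) (λ j → h j * k (M ℕ.∸ i ℕ.∸ j)))) ⟨
      L.sum (suc M) (λ i → g i * (h L.⊛ k) (M ℕ.∸ i))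
        ≈⟨ L.⊛-sum g (h L.⊛ k) M ⟨
      (g L.⊛ (h L.⊛ k)) M
        ≈⟨ L.⊛-assoc g h k M ⟨
      ((g L.⊛ h) L.⊛ k) M
        ≈⟨ L.at (jacobi-triple (const ω) (const-root ω-root) var (V var) V-var N) M ⟩
      L.V (jacobi (V var) N) M
        ≈⟨ L.V-multiple (jacobi (V var) N) N ⟩
      jacobi (V var) N N ∎
      where
      open import Relation.Binary.Reasoning.Setoid setoid
      M = N ℕ.* 3
      h k : ℕ → Carrier
      h = L.σ (const ω) g
      k = L.σ (const ω * const ω) g

    triangle*P³ : triangle N * (P * P * P) ≈[ n ] V P
    triangle*P³ m m≤n = R.trans
      (⊛-cong[] n (λ _ _ → R.refl) (⊛-cong[] n (⊛-cong[] n P≈κ P≈κ) P≈κ) m m≤n)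
      (R.trans (at factor m)
      (R.trans (R.sym (sum-cong[] (suc (N ℕ.* 3)) (λ i → sum-cong[] (suc (N ℕ.* 3 ℕ.∸ i)) (term-approx i)) m m≤n))
      (R.trans (at triple-coefficient m) (central-VP N m (ℕₚ.≤-trans m≤n (ℕₚ.<⇒≤ n<N))))))
      where
      P≈κ : P ≈[ n ] κ
      P≈κ k k≤n = R.sym (central-P N k (ℕₚ.≤-trans k≤n (ℕₚ.<⇒≤ n<N)))
      factor : triangle N * (κ * κ * κ) ≈ L.sum (suc (N ℕ.* 3)) (λ i → L.sum (suc (N ℕ.* 3 ℕ.∸ i)) (λ j → triangleTerm N i j * (κ * κ * κ)))
      factor = trans (LS.sum-*ʳ (suc (N ℕ.* 3)) (κ * κ * κ) (λ i → L.sum (suc (N ℕ.* 3 ℕ.∸ i)) (triangleTerm N i)))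
        (L.sum-cong (suc (N ℕ.* 3)) (λ i _ → LS.sum-*ʳ (suc (N ℕ.* 3 ℕ.∸ i)) (κ * κ * κ) (triangleTerm N i)))

-- Representations by the quadratic form

Represents : ℕ → ℤ × ℤ → Set
Represents n (k , m) = Q k m ≡ + n

represents? : ∀ n → Decidable (Represents n)
represents? n (k , m) = Q k m ℤ.≟ + n

representations : ℕ → List (ℤ × ℤ)
representations n = filter (represents? n) (cartesianProduct (intRange n) (intRange n))

∈-intRange : ∀ n k → ∣ k ∣ ℕ.≤ n → k ∈ intRange n
∈-intRange n k k≤n = ≡.subst (_∈ intRange n) (shift k k≤n) (∈-map⁺ _ (∈-upTo⁺ (bound k k≤n)))
  where
  position : ℤ → ℕ
  position (+ k)    = n ℕ.+ k
  position -[1+ k ] = n ℕ.∸ suc k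
  double : ∀ n → suc (n ℕ.+ n) ≡ 2 ℕ.* n ℕ.+ 1
  double = ℕ-Solver.solve-∀
  bound : ∀ k → ∣ k ∣ ℕ.≤ n → position k ℕ.< 2 ℕ.* n ℕ.+ 1
  bound (+ k)    k≤n = ≡.subst (suc (n ℕ.+ k) ℕ.≤_) (double n) (s≤s (ℕₚ.+-monoʳ-≤ n k≤n))
  bound -[1+ k ] k<n = ≡.subst (suc (n ℕ.∸ suc k) ℕ.≤_) (double n) (s≤s (ℕₚ.≤-trans (ℕₚ.m∸n≤m n (suc k)) (ℕₚ.m≤m+n n n)))
  cancel : ∀ n k → n ℤ.+ k ℤ.- n ≡ k
  cancel = solve-∀
  shift : ∀ k → ∣ k ∣ ℕ.≤ n → + position k ℤ.- + n ≡ k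
  shift (+ k)    _   = cancel (+ n) (+ k)
  shift -[1+ k ] k<n = ≡.trans (≡.cong (ℤ._- + n) (≡.sym (ℤₚ.⊖-≥ k<n))) (≡.trans (≡.cong (ℤ._- + n) (≡.sym (ℤₚ.m-n≡m⊖n n (suc k)))) (cancel (+ n) -[1+ k ]))

∈-representations : ∀ n k m → Represents n (k , m) → (k , m) ∈ representations n
∈-representations n k m rep = ∈-filter⁺ (represents? n)
  (∈-cartesianProduct⁺ (∈-intRange n k (Q-boundˡ k m n rep)) (∈-intRange n m (Q-boundʳ k m n rep))) rep

representations-unique : ∀ n → Unique (representations n)
representations-unique n = Unique.filter⁺ (represents? n) (Unique.cartesianProduct⁺ range-unique range-unique)
  where
  range-unique : Unique (intRange n)
  range-unique = Unique.map⁺ (λ {i} {j} eq → ℤₚ.+-injective (+-cancelʳ (ℤ.- + n) (+ i) (+ j) eq)) (Unique.upTo⁺ (2 ℕ.* n ℕ.+ 1))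

-- Multiplication by √−3 on the hexagonal lattice.
triple : ℤ × ℤ → ℤ × ℤ
triple (k , m) = k ℤ.- m , k ℤ.+ + 2 ℤ.* m

triple-injective : ∀ {x y} → triple x ≡ triple y → x ≡ y
triple-injective {k , m} {k′ , m′} eq = ≡.cong₂ _,_ k≡k′ m≡m′
  where
  recover : ∀ k m → + 3 ℤ.* m ≡ (k ℤ.+ + 2 ℤ.* m) ℤ.- (k ℤ.- m)
  recover = solve-∀
  m≡m′ : m ≡ m′
  m≡m′ = ℤₚ.*-cancelˡ-≡ (+ 3) m m′ (≡.trans (recover k m)
           (≡.trans (≡.cong₂ ℤ._-_ (proj₂ (,-injective eq)) (proj₁ (,-injective eq))) (≡.sym (recover k′ m′))))
  k≡k′ : k ≡ k′
  k≡k′ = +-cancelʳ (ℤ.- m) k k′ (≡.trans (proj₁ (,-injective eq)) (≡.cong (λ m → k′ ℤ.- m) (≡.sym m≡m′)))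

Q-triple : ∀ k m → Q (k ℤ.- m) (k ℤ.+ + 2 ℤ.* m) ≡ + 3 ℤ.* Q k m
Q-triple = lemma
  where
  lemma : ∀ k m → let s = k ℤ.- m ; t = k ℤ.+ + 2 ℤ.* m in
          s ℤ.* s ℤ.+ t ℤ.* t ℤ.+ s ℤ.* t ≡ + 3 ℤ.* (k ℤ.* k ℤ.+ m ℤ.* m ℤ.+ k ℤ.* m)
  lemma = solve-∀

3∣square : ∀ k → + 3 ℤ∣.∣ k ℤ.* k → + 3 ℤ∣.∣ k
3∣square k 3∣k² = ℤ∣.∣ᵤ⇒∣ ([ (λ z → z) , (λ z → z) ]′ (euclidsLemma ∣ k ∣ ∣ k ∣ (from-yes (prime? 3))
  (≡.subst (3 ℕ∣.∣_) (ℤₚ.abs-* k k) (ℤ∣.∣⇒∣ᵤ 3∣k²))))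

-- Since (m - k)² = Q(k, m) - 3km, divisibility of Q by 3 forces m - k = 3v, and (k + v, v) is the
-- preimage.
triple-surjective : ∀ n k m → Q k m ≡ + (n ℕ.* 3) → ∃ λ x → Represents n x × (k , m) ≡ triple x
triple-surjective n k m eq with 3∣square (m ℤ.- k) (ℤ∣.divides (+ n ℤ.- k ℤ.* m) square)
  where
  expand : ∀ k m → (m ℤ.- k) ℤ.* (m ℤ.- k) ≡ (k ℤ.* k ℤ.+ m ℤ.* m ℤ.+ k ℤ.* m) ℤ.- k ℤ.* m ℤ.* + 3
  expand = solve-∀
  collect : ∀ n k m → n ℤ.* + 3 ℤ.- k ℤ.* m ℤ.* + 3 ≡ (n ℤ.- k ℤ.* m) ℤ.* + 3
  collect = solve-∀
  square : (m ℤ.- k) ℤ.* (m ℤ.- k) ≡ (+ n ℤ.- k ℤ.* m) ℤ.* + 3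
  square = ≡.trans (expand k m) (≡.trans (≡.cong (ℤ._- k ℤ.* m ℤ.* + 3) (≡.trans eq (ℤₚ.pos-* n 3))) (collect (+ n) k m))
... | ℤ∣.divides v m-k≡3v = (k ℤ.+ v , v) , ℤₚ.*-cancelˡ-≡ (+ 3) _ _ scaled , pair
  where
  first : ∀ k v → k ≡ k ℤ.+ v ℤ.- v
  first = solve-∀
  second : ∀ k m → m ≡ k ℤ.+ (m ℤ.- k)
  second = solve-∀
  third : ∀ k v → k ℤ.+ v ℤ.* + 3 ≡ k ℤ.+ v ℤ.+ + 2 ℤ.* v
  third = solve-∀
  pair : (k , m) ≡ triple (k ℤ.+ v , v)
  pair = ≡.cong₂ _,_ (first k v) (≡.trans (second k m) (≡.trans (≡.cong (λ t → k ℤ.+ t) m-k≡3v) (third k v)))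
  scaled : + 3 ℤ.* Q (k ℤ.+ v) v ≡ + 3 ℤ.* + n
  scaled = ≡.trans (≡.sym (Q-triple (k ℤ.+ v) v)) (≡.trans (≡.sym (≡.cong (λ x → Q (proj₁ x) (proj₂ x)) pair))
             (≡.trans eq (≡.trans (ℤₚ.pos-* n 3) (ℤₚ.*-comm (+ n) (+ 3)))))

-- Multiplication by √-3 maps the vectors of norm n bijectively onto those of norm 3n;
-- duplicate-free lists with the same members have equal length.
θ-triple : ∀ n → θ (n ℕ.* 3) ≡ θ n
θ-triple n = ≡.trans (↭-length (∼bag⇒↭ (unique∧set⇒bag (representations-unique (n ℕ.* 3))
    (Unique.map⁺ triple-injective (representations-unique n)) (mk⇔ to from))))
  (Listₚ.length-map triple (representations n))
  where
  to : ∀ {x} → x ∈ representations (n ℕ.* 3) → x ∈ map triple (representations n)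
  to {k , m} x∈ =
    let ((k′ , m′) , rep , eq) = triple-surjective n k m (proj₂ (∈-filter⁻ (represents? (n ℕ.* 3)) {xs = cartesianProduct (intRange (n ℕ.* 3)) (intRange (n ℕ.* 3))} x∈))
    in ≡.subst (_∈ map triple (representations n)) (≡.sym eq) (∈-map⁺ triple (∈-representations n k′ m′ rep))
  from : ∀ {x} → x ∈ map triple (representations n) → x ∈ representations (n ℕ.* 3)
  from x∈ with (k , m) , y∈ , ≡.refl ← ∈-map⁻ triple x∈ =
    ∈-representations (n ℕ.* 3) _ _ (≡.trans (Q-triple k m) (≡.trans
      (≡.cong (+ 3 ℤ.*_) (proj₂ (∈-filter⁻ (represents? n) {xs = cartesianProduct (intRange n) (intRange n)} y∈)))
      (≡.trans (ℤₚ.*-comm (+ 3) (+ n)) (≡.sym (ℤₚ.pos-* n 3)))))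

centred : ℕ → ℕ → ℤ
centred n i = + i ℤ.- + n

-- Q(k,m) ≡ (k − m)² ≡ (k + 2m)² mod 3.
Q-mod-3 : ∀ n i j u r a m → Represents (u ℕ.+ m ℕ.* 3) (centred n i , centred n j) → i ℕ.+ 2 ℕ.* j ≡ r ℕ.+ a ℕ.* 3 →
          + 3 ℤ∣.∣ + u ℤ.- + r ℤ.* + r
Q-mod-3 n i j u r a m rep eq = ℤ∣.divides (+ 2 ℤ.* + r ℤ.* + a ℤ.+ + 3 ℤ.* + a ℤ.* + a ℤ.+ rest) (begin
  + u ℤ.- + r ℤ.* + r
    ≡⟨ isolate (+ u) (+ r) (+ m) ⟩
  (+ u ℤ.+ + m ℤ.* + 3) ℤ.- + r ℤ.* + r ℤ.- + m ℤ.* + 3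
    ≡⟨ ≡.cong (λ t → t ℤ.- + r ℤ.* + r ℤ.- + m ℤ.* + 3) (≡.trans (≡.cong (λ t → + u ℤ.+ t) (≡.sym (ℤₚ.pos-* m 3))) (≡.sym rep)) ⟩
  Q (+ i ℤ.- + n) (+ j ℤ.- + n) ℤ.- + r ℤ.* + r ℤ.- + m ℤ.* + 3
    ≡⟨ complete (+ i) (+ j) (+ n) (+ r) (+ m) ⟩
  (+ i ℤ.+ + 2 ℤ.* + j) ℤ.* (+ i ℤ.+ + 2 ℤ.* + j) ℤ.- + r ℤ.* + r ℤ.+ rest ℤ.* + 3
    ≡⟨ ≡.cong (λ t → t ℤ.* t ℤ.- + r ℤ.* + r ℤ.+ rest ℤ.* + 3) eq′ ⟩
  (+ r ℤ.+ + a ℤ.* + 3) ℤ.* (+ r ℤ.+ + a ℤ.* + 3) ℤ.- + r ℤ.* + r ℤ.+ rest ℤ.* + 3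
    ≡⟨ collect (+ r) (+ a) rest ⟩
  (+ 2 ℤ.* + r ℤ.* + a ℤ.+ + 3 ℤ.* + a ℤ.* + a ℤ.+ rest) ℤ.* + 3 ∎)
  where
  open ≡.≡-Reasoning
  rest : ℤ
  rest = (+ i ℤ.- + n) ℤ.* (+ j ℤ.- + n) ℤ.- + 2 ℤ.* + i ℤ.* + j ℤ.- + j ℤ.* + j ℤ.- + m
  isolate : ∀ u r m → u ℤ.- r ℤ.* r ≡ (u ℤ.+ m ℤ.* + 3) ℤ.- r ℤ.* r ℤ.- m ℤ.* + 3
  isolate = solve-∀
  complete : ∀ i j n r m → let k = i ℤ.- n ; l = j ℤ.- n in
    (k ℤ.* k ℤ.+ l ℤ.* l ℤ.+ k ℤ.* l) ℤ.- r ℤ.* r ℤ.- m ℤ.* + 3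
    ≡ (i ℤ.+ + 2 ℤ.* j) ℤ.* (i ℤ.+ + 2 ℤ.* j) ℤ.- r ℤ.* r ℤ.+ (k ℤ.* l ℤ.- + 2 ℤ.* i ℤ.* j ℤ.- j ℤ.* j ℤ.- m) ℤ.* + 3
  complete = solve-∀
  collect : ∀ r a z → (r ℤ.+ a ℤ.* + 3) ℤ.* (r ℤ.+ a ℤ.* + 3) ℤ.- r ℤ.* r ℤ.+ z ℤ.* + 3
    ≡ (+ 2 ℤ.* r ℤ.* a ℤ.+ + 3 ℤ.* a ℤ.* a ℤ.+ z) ℤ.* + 3
  collect = solve-∀
  eq′ : + i ℤ.+ + 2 ℤ.* + j ≡ + r ℤ.+ + a ℤ.* + 3
  eq′ = ≡.trans (≡.cong (λ t → + i ℤ.+ t) (≡.sym (ℤₚ.pos-* 2 j))) (≡.trans (≡.cong +_ eq) (≡.cong (λ t → + r ℤ.+ t) (ℤₚ.pos-* a 3)))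

-- The lattice sum weighted by a cubic character

module LatticeSum (R : CommutativeRing 0ℓ 0ℓ)
  (ω : CommutativeRing.Carrier R)
  (ω-root : PrimitiveCubeRoots.Root R ω)
  where
  private
    module R = CommutativeRing R
    module Rₙ = IntegerSolver R
  open PowerSeries R
  open Dissection R
  open Coefficients R
  open EulerProduct R
  open PrimitiveCubeRoots R
  open ThetaProduct R ω ω-root
  open EtaQuotients R E P EP≈1 using (b)
  open CommutativeRing ring[[X]] hiding (zero)
  open IntegerSolver ring[[X]]
  open Sums R
  open import Algebra.Properties.Semiring.Exp R.semiring using () renaming (_^_ to _^ᵣ_; ^-congˡ to ^ᵣ-congˡ; ^-assocʳ to ^ᵣ-assocʳ; ^-homo-* to ^ᵣ-homo)
  open import Algebra.Properties.Semiring.Exp semiring using (_^_; ^-congˡ)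
  private
    module L = PowerSeries ring[[X]]

  pow-residue : ∀ r a → ω ^ᵣ (r ℕ.+ a ℕ.* 3) R.≈ ω ^ᵣ r
  pow-residue r a = R.trans (^ᵣ-homo ω r (a ℕ.* 3)) (R.trans (R.*-congˡ (root-pow ω-root a)) (R.*-identityʳ _))

  -- The weight is ω^(i − j), as i + 2j ≡ i − j mod 3.
  latticeTerm : ℕ → ℕ → ℕ → R.Carrier
  latticeTerm m i j = ω ^ᵣ (i ℕ.+ 2 ℕ.* j) R.* [ represents? m (centred m i , centred m j) ]

  box : ℕ → (ℕ → ℕ → R.Carrier) → R.Carrier
  box m f = sum (suc (m ℕ.+ m)) (λ i → sum (suc (m ℕ.+ m)) (f i))

  lattice : Carrier
  lattice m = box m (latticeTerm m)

  box-cong : ∀ m {f g : ℕ → ℕ → R.Carrier} → (∀ i j → f i j R.≈ g i j) → box m f R.≈ box m g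
  box-cong m p = sum-cong (suc (m ℕ.+ m)) (λ i _ → sum-cong (suc (m ℕ.+ m)) (λ j _ → p i j))

  pow-at : ∀ e m → (var ^ e) m R.≈ [ e ℕ.≟ m ]
  pow-at zero    zero    = R.refl
  pow-at zero    (suc m) = R.refl
  pow-at (suc e) zero    = var-⊛-zero (var ^ e)
  pow-at (suc e) (suc m) = R.trans (var-⊛-suc (var ^ e) m) (pow-at e m)

  sum-at : ∀ k (f : ℕ → Carrier) m → L.sum k f m R.≈ sum k (λ i → f i m)
  sum-at zero    f m = R.refl
  sum-at (suc k) f m = R.+-congˡ (sum-at k (λ i → f (suc i)) m)

  module _ (s m : ℕ) (m≤s : m ℕ.≤ s) where
    private
      N M : ℕ
      N = s ℕ.+ m
      M = N ℕ.* 3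
      e : ℕ → ℕ → ℕ
      e i j = exponent N i ℕ.+ (exponent N j ℕ.+ exponent N (M ℕ.∸ i ℕ.∸ j))
      w : ℕ → ℕ → R.Carrier
      w i j = weight j (M ℕ.∸ i ℕ.∸ j)

    term-at : ∀ i j → triangleTerm N i j m R.≈ w i j R.* [ e i j ℕ.≟ m ]
    term-at i j = R.trans (const-⊛ (w i j) (var ^ e i j) m) (R.*-congˡ (pow-at (e i j) m))

    index-sum : ∀ i j → i ℕ.< suc M → j ℕ.< suc (M ℕ.∸ i) → i ℕ.+ (j ℕ.+ (M ℕ.∸ i ℕ.∸ j)) ≡ M
    index-sum i j (s≤s i≤M) (s≤s j≤) = ≡.trans (≡.cong (i ℕ.+_) (ℕₚ.m+[n∸m]≡n j≤)) (ℕₚ.m+[n∸m]≡n i≤M)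

    e≡Q : ∀ i j → i ℕ.< suc M → j ℕ.< suc (M ℕ.∸ i) → + e i j ≡ Q (centred N i) (centred N j)
    e≡Q i j i< j< = exponent-sum N i j _ (index-sum i j i< j<)

    term-outside : ∀ i j → i ℕ.< suc M → j ℕ.< suc (M ℕ.∸ i) →
      ¬ ((s ℕ.≤ i × i ℕ.< s ℕ.+ suc (m ℕ.+ m)) × (s ℕ.≤ j × j ℕ.< s ℕ.+ suc (m ℕ.+ m))) → triangleTerm N i j m R.≈ R.0#
    term-outside i j i< j< outside = R.trans (term-at i j) (R.trans (R.*-congˡ ([]-false (e i j ℕ.≟ m) λ eq → outside
      ( index-in-window s m i _ (centred N j) (e≡Q i j i< j<) eq
      , index-in-window s m j _ (centred N i) (≡.trans (e≡Q i j i< j<) (Q-sym (centred N i) (centred N j))) eq))) (R.zeroʳ _))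

    -- The triangle i + j ≤ 3N contains the whole window because 2(s + 2m) ≤ 3(s + m) for m ≤ s.
    window-fits : ∀ i → i ℕ.< suc (m ℕ.+ m) → s ℕ.+ suc (m ℕ.+ m) ℕ.≤ suc (M ℕ.∸ (s ℕ.+ i))
    window-fits i (s≤s i≤2m) = ≡.subst (ℕ._≤ suc (M ℕ.∸ (s ℕ.+ i))) (≡.sym (ℕₚ.+-suc s (m ℕ.+ m)))
      (s≤s (ℕₚ.m+n≤o⇒m≤o∸n (s ℕ.+ (m ℕ.+ m)) (begin
        s ℕ.+ (m ℕ.+ m) ℕ.+ (s ℕ.+ i)            ≤⟨ ℕₚ.+-monoʳ-≤ (s ℕ.+ (m ℕ.+ m)) (ℕₚ.+-monoʳ-≤ s i≤2m) ⟩
        s ℕ.+ (m ℕ.+ m) ℕ.+ (s ℕ.+ (m ℕ.+ m))    ≡⟨ rearrange s m ⟩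
        s ℕ.+ s ℕ.+ m ℕ.+ m ℕ.+ m ℕ.+ m          ≤⟨ ℕₚ.+-monoʳ-≤ (s ℕ.+ s ℕ.+ m ℕ.+ m ℕ.+ m) m≤s ⟩
        s ℕ.+ s ℕ.+ m ℕ.+ m ℕ.+ m ℕ.+ s          ≡⟨ rearrange′ s m ⟩
        M                                        ∎)))
      where
      open ℕₚ.≤-Reasoning
      rearrange : ∀ s m → s ℕ.+ (m ℕ.+ m) ℕ.+ (s ℕ.+ (m ℕ.+ m)) ≡ s ℕ.+ s ℕ.+ m ℕ.+ m ℕ.+ m ℕ.+ m
      rearrange = ℕ-Solver.solve-∀
      rearrange′ : ∀ s m → s ℕ.+ s ℕ.+ m ℕ.+ m ℕ.+ m ℕ.+ s ≡ (s ℕ.+ m) ℕ.* 3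
      rearrange′ = ℕ-Solver.solve-∀

    index-fits : ∀ i → i ℕ.< suc (m ℕ.+ m) → s ℕ.+ i ℕ.< suc M
    index-fits i i< = s≤s (ℕₚ.≤-trans (ℕₚ.+-monoʳ-≤ s (ℕₚ.≤-pred i<)) (ℕₚ.≤-trans (ℕₚ.≤-trans (ℕₚ.≤-reflexive (≡.sym (ℕₚ.+-assoc s m m))) (ℕₚ.+-monoʳ-≤ N (ℕₚ.m≤n+m m s))) (ℕₚ.≤-trans (ℕₚ.m≤m+n (N ℕ.+ N) N) (ℕₚ.≤-reflexive (lemma N)))))
      where
      lemma : ∀ n → n ℕ.+ n ℕ.+ n ≡ n ℕ.* 3
      lemma = ℕ-Solver.solve-∀

    centred-shift : ∀ i → centred N (s ℕ.+ i) ≡ centred m i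
    centred-shift i = lemma (+ s) (+ i) (+ m)
      where
      lemma : ∀ s i m → s ℤ.+ i ℤ.- (s ℤ.+ m) ≡ i ℤ.- m
      lemma = solve-∀

    weight-shift : ∀ i j → i ℕ.< suc (m ℕ.+ m) → j ℕ.< suc (m ℕ.+ m) → w (s ℕ.+ i) (s ℕ.+ j) R.≈ ω ^ᵣ (i ℕ.+ 2 ℕ.* j)
    weight-shift i j i< j< = R.trans
      (R.*-congˡ (R.trans (^ᵣ-congˡ l (R.*-congˡ (R.sym (R.*-identityʳ ω)))) (^ᵣ-assocʳ ω 2 l)))
      (R.trans (R.sym (^ᵣ-homo ω (s ℕ.+ j) (2 ℕ.* l)))
      (R.trans (R.sym (pow-residue (s ℕ.+ j ℕ.+ 2 ℕ.* l) (s ℕ.+ i ℕ.+ (s ℕ.+ j))))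
      (R.trans (R.reflexive (≡.cong (ω ^ᵣ_) (≡.trans (gather s i j l) (≡.trans (≡.cong (λ t → i ℕ.+ 2 ℕ.* j ℕ.+ s ℕ.* 3 ℕ.+ 2 ℕ.* t) total) (regroup s i j N)))))
        (pow-residue (i ℕ.+ 2 ℕ.* j) (s ℕ.+ 2 ℕ.* N)))))
      where
      l : ℕ
      l = M ℕ.∸ (s ℕ.+ i) ℕ.∸ (s ℕ.+ j)
      total : s ℕ.+ i ℕ.+ (s ℕ.+ j ℕ.+ l) ≡ M
      total = index-sum (s ℕ.+ i) (s ℕ.+ j) (index-fits i i<) (ℕₚ.<-≤-trans (ℕₚ.+-monoʳ-< s j<) (window-fits i i<))
      gather : ∀ s i j l → s ℕ.+ j ℕ.+ 2 ℕ.* l ℕ.+ (s ℕ.+ i ℕ.+ (s ℕ.+ j)) ℕ.* 3 ≡ i ℕ.+ 2 ℕ.* j ℕ.+ s ℕ.* 3 ℕ.+ 2 ℕ.* (s ℕ.+ i ℕ.+ (s ℕ.+ j ℕ.+ l))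
      gather = ℕ-Solver.solve-∀
      regroup : ∀ s i j n → i ℕ.+ 2 ℕ.* j ℕ.+ s ℕ.* 3 ℕ.+ 2 ℕ.* (n ℕ.* 3) ≡ i ℕ.+ 2 ℕ.* j ℕ.+ (s ℕ.+ 2 ℕ.* n) ℕ.* 3
      regroup = ℕ-Solver.solve-∀

    -- Only indices within m of N = s + m contribute to coefficient m, and removing the offset s
    -- carries them onto the box of the lattice sum.
    triangle-at : triangle N m R.≈ lattice m
    triangle-at = R.trans (sum-at (suc M) (λ i → L.sum (suc (M ℕ.∸ i)) (triangleTerm N i)) m)
      (R.trans (sum-cong (suc M) (λ i _ → sum-at (suc (M ℕ.∸ i)) (triangleTerm N i) m))
      (R.trans (sum-window s (suc (m ℕ.+ m)) (suc M) _ (ℕₚ.≤-trans (window-fits 0 (s≤s z≤n)) (s≤s (ℕₚ.m∸n≤m M (s ℕ.+ 0))))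
        (λ i i< i<s → sum-zero _ (λ j j< → term-outside i j i< j< (λ ((s≤i , _) , _) → ℕₚ.<⇒≱ i<s s≤i)))
        (λ i i< high → sum-zero _ (λ j j< → term-outside i j i< j< (λ ((_ , low) , _) → ℕₚ.<⇒≱ low high))))
      (sum-cong (suc (m ℕ.+ m)) λ i i< → R.trans
        (sum-window s (suc (m ℕ.+ m)) (suc (M ℕ.∸ (s ℕ.+ i))) _ (window-fits i i<)
          (λ j j< j<s → term-outside (s ℕ.+ i) j (index-fits i i<) j< (λ (_ , (s≤j , _)) → ℕₚ.<⇒≱ j<s s≤j))
          (λ j j< high → term-outside (s ℕ.+ i) j (index-fits i i<) j< (λ (_ , (_ , low)) → ℕₚ.<⇒≱ low high)))
        (sum-cong (suc (m ℕ.+ m)) λ j j< → R.trans (term-at (s ℕ.+ i) (s ℕ.+ j)) (R.*-cong (weight-shift i j i< j<)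
          (let e≡ = ≡.trans (e≡Q (s ℕ.+ i) (s ℕ.+ j) (index-fits i i<) (ℕₚ.<-≤-trans (ℕₚ.+-monoʳ-< s j<) (window-fits i i<)))
                      (≡.cong₂ Q (centred-shift i) (centred-shift j)) in
           []-cong (e (s ℕ.+ i) (s ℕ.+ j) ℕ.≟ m) (represents? m (centred m i , centred m j))
             (λ eq → ≡.trans (≡.sym e≡) (≡.cong +_ eq)) (λ rep → ℤₚ.+-injective (≡.trans e≡ rep))))))))

  lattice*P³≈VP : lattice * (P * P * P) ≈ V P
  lattice*P³≈VP .at n = R.trans
    (⊛-congᵇ n (λ m m≤n → R.sym (triangle-lattice m m≤n)) (λ _ _ → R.refl))
    (triangle*P³ N n (s≤s (ℕₚ.m≤m+n n n)) n ℕₚ.≤-refl)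
    where
    N : ℕ
    -- Large enough that n < N and that N - m ≥ m for every m ≤ n, so a single N serves all
    -- coefficients up to n.
    N = suc (n ℕ.+ n)
    triangle-lattice : ∀ m → m ℕ.≤ n → triangle N m R.≈ lattice m
    triangle-lattice m m≤n = ≡.subst (λ N → triangle N m R.≈ lattice m)
      (ℕₚ.m∸n+n≡m (ℕₚ.≤-trans m≤n (ℕₚ.m≤n⇒m≤1+n (ℕₚ.m≤m+n n n))))
      (triangle-at (N ℕ.∸ m) m (ℕₚ.≤-trans m≤n (ℕₚ.≤-trans (ℕₚ.m≤n⇒m≤1+n (ℕₚ.≤-reflexive (≡.sym (ℕₚ.m+n∸m≡n n n)))) (ℕₚ.≤-trans (ℕₚ.≤-reflexive (≡.sym (ℕₚ.+-∸-assoc 1 (ℕₚ.m≤m+n n n)))) (ℕₚ.∸-monoʳ-≤ N m≤n)))))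

  lattice≈b : lattice ≈ b
  lattice≈b = begin
    lattice
      ≈⟨ *-identityʳ lattice ⟨
    lattice * 1#
      ≈⟨ *-congˡ {lattice} (trans (^-congˡ 3 EP≈1) (solve 0 (:nat 1 :^ 3 := :nat 1) refl)) ⟨
    lattice * (E * P) ^ 3
      ≈⟨ solve 3 (λ s e p → s :* (e :* p) :^ 3 := e :* e :* e :* (s :* (p :* p :* p))) refl lattice E P ⟩
    E * E * E * (lattice * (P * P * P))
      ≈⟨ *-congˡ {E * E * E} lattice*P³≈VP ⟩
    b ∎
    where open import Relation.Binary.Reasoning.Setoid setoid

  module _ {A : Set} {B : A → Set} (B? : Decidable B) where
    nat-count : ∀ (f : ℕ → A) n → Rₙ.nat (length (filter B? (applyUpTo f n))) R.≈ sum n (λ i → [ B? (f i) ])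
    nat-count f zero = R.refl
    nat-count f (suc n) with does (B? (f 0))
    ... | true  = R.trans (Rₙ.nat-suc (length (filter B? (applyUpTo (λ i → f (suc i)) n)))) (R.+-congˡ (nat-count (λ i → f (suc i)) n))
    ... | false = R.trans (nat-count (λ i → f (suc i)) n) (R.sym (R.+-identityˡ _))

  nat-count₂ : ∀ {A B : Set} {C : A × B → Set} (C? : Decidable C) (f : ℕ → A) (g : ℕ → B) n k →
    Rₙ.nat (length (filter C? (cartesianProduct (applyUpTo f n) (applyUpTo g k)))) R.≈ sum n (λ i → sum k (λ j → [ C? (f i , g j) ]))
  nat-count₂ C? f g zero    k = R.refl
  nat-count₂ C? f g (suc n) k = R.trans (R.reflexive (≡.cong Rₙ.nat (≡.trans
      (≡.cong length (≡.trans (Listₚ.filter-++ C? (map (f 0 ,_) (applyUpTo g k)) _)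
        (≡.cong (λ xs → filter C? xs ++ filter C? (cartesianProduct (applyUpTo (λ i → f (suc i)) n) (applyUpTo g k))) (Listₚ.map-applyUpTo g (f 0 ,_) k))))
      (Listₚ.length-++ (filter C? (applyUpTo (λ j → f 0 , g j) k))))))
    (R.trans (Rₙ.nat-+ (length (filter C? (applyUpTo (λ j → f 0 , g j) k)))
              (length (filter C? (cartesianProduct (applyUpTo (λ i → f (suc i)) n) (applyUpTo g k)))))
      (R.+-cong (nat-count C? (λ j → f 0 , g j) k) (nat-count₂ C? (λ i → f (suc i)) g n k)))

  nat-θ : ∀ m → Rₙ.nat (θ m) R.≈ box m (λ i j → [ represents? m (centred m i , centred m j) ])
  nat-θ m = R.trans (R.reflexive (≡.cong (λ xs → Rₙ.nat (length (filter (represents? m) (cartesianProduct xs xs)))) range))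
    (nat-count₂ (represents? m) (centred m) (centred m) (suc (m ℕ.+ m)) (suc (m ℕ.+ m)))
    where
    double : ∀ m → 2 ℕ.* m ℕ.+ 1 ≡ suc (m ℕ.+ m)
    double = ℕ-Solver.solve-∀
    range : intRange m ≡ applyUpTo (centred m) (suc (m ℕ.+ m))
    range = ≡.trans (Listₚ.map-upTo (centred m) (2 ℕ.* m ℕ.+ 1)) (≡.cong (applyUpTo (centred m)) (double m))

  -- Swapping the coordinates inverts the weight, as the two exponents add up to 3(i + j).
  symmetric-weight : ∀ i j → let r = (i ℕ.+ 2 ℕ.* j) % 3 in
                     (ω ^ᵣ r R.* ω ^ᵣ (j ℕ.+ 2 ℕ.* i)) R.≈ R.1#
  symmetric-weight i j = R.trans (R.*-congʳ (R.sym (R.trans (R.reflexive (≡.cong (ω ^ᵣ_) (m≡m%n+[m/n]*n (i ℕ.+ 2 ℕ.* j) 3))) (pow-residue ((i ℕ.+ 2 ℕ.* j) % 3) ((i ℕ.+ 2 ℕ.* j) / 3)))))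
    (R.trans (R.sym (^ᵣ-homo ω (i ℕ.+ 2 ℕ.* j) (j ℕ.+ 2 ℕ.* i)))
    (R.trans (R.reflexive (≡.cong (ω ^ᵣ_) (lemma i j))) (root-pow ω-root (i ℕ.+ j))))
    where
    lemma : ∀ i j → i ℕ.+ 2 ℕ.* j ℕ.+ (j ℕ.+ 2 ℕ.* i) ≡ (i ℕ.+ j) ℕ.* 3
    lemma = ℕ-Solver.solve-∀

  -- In continuation form, so that callers split on the residue r of i + 2j and refute each r whose
  -- square is not u mod 3.
  residue-clash : ∀ {A : Set} m i j u n → Represents (u ℕ.+ n ℕ.* 3) (centred m i , centred m j) →
    (∀ r → r ℕ.< 3 → 3 ℕ∣.∣ ∣ + u ℤ.- + r ℤ.* + r ∣ → r ≡ (i ℕ.+ 2 ℕ.* j) % 3 → A) → A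
  residue-clash m i j u n rep k = k ((i ℕ.+ 2 ℕ.* j) % 3) (m%n<n (i ℕ.+ 2 ℕ.* j) 3)
    (ℤ∣.∣⇒∣ᵤ (Q-mod-3 m i j u _ ((i ℕ.+ 2 ℕ.* j) / 3) n rep (m≡m%n+[m/n]*n (i ℕ.+ 2 ℕ.* j) 3))) ≡.refl

  private
    c : ℕ → ℕ → R.Carrier
    c i j = ω ^ᵣ (i ℕ.+ 2 ℕ.* j) R.+ ω ^ᵣ (j ℕ.+ 2 ℕ.* i)

    weight-value : ∀ i j r → r ≡ (i ℕ.+ 2 ℕ.* j) % 3 → ω ^ᵣ (i ℕ.+ 2 ℕ.* j) R.≈ ω ^ᵣ r
    weight-value i j r eq = R.trans (R.reflexive (≡.cong (ω ^ᵣ_) (m≡m%n+[m/n]*n (i ℕ.+ 2 ℕ.* j) 3)))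
      (R.trans (pow-residue ((i ℕ.+ 2 ℕ.* j) % 3) ((i ℕ.+ 2 ℕ.* j) / 3)) (R.reflexive (≡.cong (ω ^ᵣ_) (≡.sym eq))))

    inverse-value : ∀ i j r → r ≡ (i ℕ.+ 2 ℕ.* j) % 3 → r ℕ.≤ 3 → ω ^ᵣ (j ℕ.+ 2 ℕ.* i) R.≈ ω ^ᵣ (3 ℕ.∸ r)
    inverse-value i j r eq r≤3 = R.trans (R.sym (R.*-identityˡ _))
      (R.trans (R.*-congʳ (R.sym (R.trans (R.sym (^ᵣ-homo ω (3 ℕ.∸ r) r)) (R.trans (R.reflexive (≡.cong (ω ^ᵣ_) (ℕₚ.m∸n+n≡m r≤3))) (root-pow ω-root 1)))))
      (R.trans (R.*-assoc _ _ _)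
      (R.trans (R.*-congˡ (R.trans (R.*-congʳ (R.reflexive (≡.cong (ω ^ᵣ_) eq))) (symmetric-weight i j))) (R.*-identityʳ _))))

  c-0 : ∀ m i j n → Represents (n ℕ.* 3) (centred m i , centred m j) → c i j R.≈ Rₙ.nat 2
  c-0 m i j n rep = residue-clash m i j 0 n rep go
    where
    go : ∀ r → r ℕ.< 3 → 3 ℕ∣.∣ ∣ + 0 ℤ.- + r ℤ.* + r ∣ → r ≡ (i ℕ.+ 2 ℕ.* j) % 3 → c i j R.≈ Rₙ.nat 2
    go 0 _ _ eq = R.+-cong (weight-value i j 0 eq) (R.trans (inverse-value i j 0 eq z≤n) (root-pow ω-root 1))
    go 1 _ 3∣1 _ = ⊥-elim (from-no (3 ℕ∣.∣? 1) 3∣1)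
    go 2 _ 3∣4 _ = ⊥-elim (from-no (3 ℕ∣.∣? 4) 3∣4)
    go (suc (suc (suc _))) (s≤s (s≤s (s≤s ())))

  c-1 : ∀ m i j n → Represents (1 ℕ.+ n ℕ.* 3) (centred m i , centred m j) → c i j R.≈ R.- R.1#
  c-1 m i j n rep = residue-clash m i j 1 n rep go
    where
    ω+ω²≈-1 : ω R.+ ω R.* ω R.≈ R.- R.1#
    ω+ω²≈-1 = R.trans (Rₙ.solve 1 (λ w → w Rₙ.:+ w Rₙ.:* w Rₙ.:= (Rₙ.:nat 1 Rₙ.:+ w Rₙ.:+ w Rₙ.:* w) Rₙ.:- Rₙ.:nat 1) R.refl ω)
                (R.trans (R.+-congʳ ω-root) (R.+-identityˡ _))
    go : ∀ r → r ℕ.< 3 → 3 ℕ∣.∣ ∣ + 1 ℤ.- + r ℤ.* + r ∣ → r ≡ (i ℕ.+ 2 ℕ.* j) % 3 → c i j R.≈ R.- R.1#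
    go 0 _ 3∣1 _ = ⊥-elim (from-no (3 ℕ∣.∣? 1) 3∣1)
    go 1 _ _ eq = R.trans (R.+-cong (weight-value i j 1 eq) (inverse-value i j 1 eq (s≤s z≤n)))
      (R.trans (Rₙ.solve 1 (λ w → w Rₙ.:^ 1 Rₙ.:+ w Rₙ.:^ 2 Rₙ.:= w Rₙ.:+ w Rₙ.:* w) R.refl ω) ω+ω²≈-1)
    go 2 _ _ eq = R.trans (R.+-cong (weight-value i j 2 eq) (inverse-value i j 2 eq (s≤s (s≤s z≤n))))
      (R.trans (Rₙ.solve 1 (λ w → w Rₙ.:^ 2 Rₙ.:+ w Rₙ.:^ 1 Rₙ.:= w Rₙ.:+ w Rₙ.:* w) R.refl ω) ω+ω²≈-1)
    go (suc (suc (suc _))) (s≤s (s≤s (s≤s ())))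

  -- 2 is not a square modulo 3.
  c-2 : ∀ m i j n → ¬ Represents (2 ℕ.+ n ℕ.* 3) (centred m i , centred m j)
  c-2 m i j n rep = residue-clash m i j 2 n rep go
    where
    go : ∀ r → r ℕ.< 3 → 3 ℕ∣.∣ ∣ + 2 ℤ.- + r ℤ.* + r ∣ → r ≡ (i ℕ.+ 2 ℕ.* j) % 3 → ⊥
    go 0 _ 3∣2 _ = from-no (3 ℕ∣.∣? 2) 3∣2
    go 1 _ 3∣1 _ = from-no (3 ℕ∣.∣? 1) 3∣1
    go 2 _ 3∣2 _ = from-no (3 ℕ∣.∣? 2) 3∣2
    go (suc (suc (suc _))) (s≤s (s≤s (s≤s ())))

  -- Adding the sum with (k, m) swapped replaces the weight w by w + w⁻¹, which depends on Q(k, m) mod 3 only.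
  lattice-symmetrised : ∀ m d → (∀ i j → Represents m (centred m i , centred m j) → c i j R.≈ d) →
                        Rₙ.nat 2 R.* lattice m R.≈ d R.* Rₙ.nat (θ m)
  lattice-symmetrised m d weights = R.trans
    (Rₙ.solve 1 (λ l → Rₙ.:nat 2 Rₙ.:* l Rₙ.:= l Rₙ.:+ l) R.refl (lattice m))
    (R.trans (R.+-congˡ (sum-swap n n (latticeTerm m)))
    (R.trans (R.sym (sum-+ n (λ i → sum n (latticeTerm m i)) (λ i → sum n (λ j → latticeTerm m j i))))
    (R.trans (sum-cong n (λ i _ → R.sym (sum-+ n (latticeTerm m i) (λ j → latticeTerm m j i))))
    (R.trans (box-cong m term)
    (R.trans (sum-cong n (λ i _ → R.sym (sum-*ˡ n d (λ j → [ rep? i j ]))))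
    (R.trans (R.sym (sum-*ˡ n d (λ i → sum n (λ j → [ rep? i j ])))) (R.*-congˡ (R.sym (nat-θ m)))))))))
    where
    n : ℕ
    n = suc (m ℕ.+ m)
    rep? : ∀ i j → Dec (Represents m (centred m i , centred m j))
    rep? i j = represents? m (centred m i , centred m j)
    swap : ∀ i j → [ rep? j i ] R.≈ [ rep? i j ]
    swap i j = []-cong (rep? j i) (rep? i j) (≡.trans (Q-sym (centred m i) (centred m j))) (≡.trans (Q-sym (centred m j) (centred m i)))
    value : ∀ i j (dec : Dec (Represents m (centred m i , centred m j))) → c i j R.* [ dec ] R.≈ d R.* [ dec ]
    value i j (yes rep) = R.*-congʳ (weights i j rep)
    value i j (no _)    = R.trans (R.zeroʳ _) (R.sym (R.zeroʳ _))
    term : ∀ i j → latticeTerm m i j R.+ latticeTerm m j i R.≈ d R.* [ rep? i j ]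
    term i j = R.trans (R.+-congˡ (R.*-congˡ (swap i j)))
      (R.trans (R.sym (R.distribʳ _ _ _)) (value i j (rep? i j)))

  θ-2mod3 : ∀ n → Rₙ.nat (θ (2 ℕ.+ n ℕ.* 3)) R.≈ R.0#
  θ-2mod3 n = R.trans (nat-θ m) (sum-zero (suc (m ℕ.+ m)) λ i _ → sum-zero (suc (m ℕ.+ m)) λ j _ → []-false (represents? m (centred m i , centred m j)) (c-2 m i j n))
    where
    m : ℕ
    m = 2 ℕ.+ n ℕ.* 3

  lattice-2mod3 : ∀ n → lattice (2 ℕ.+ n ℕ.* 3) R.≈ R.0#
  lattice-2mod3 n = sum-zero (suc (m ℕ.+ m)) λ i _ → sum-zero (suc (m ℕ.+ m)) λ j _ →
    R.trans (R.*-congˡ {ω ^ᵣ (i ℕ.+ 2 ℕ.* j)} ([]-false (represents? m (centred m i , centred m j)) (c-2 m i j n))) (R.zeroʳ _)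
    where
    m : ℕ
    m = 2 ℕ.+ n ℕ.* 3

-- The congruences

-- Defined by nesting, so that the values of cφ₃ along these indices are iterated `U 2` and `U 1` by
-- computation.
oddIndex evenIndex : ℕ → ℕ → ℕ
oddIndex zero    n = 2 ℕ.+ n ℕ.* 3
oddIndex (suc k) n = evenIndex k (1 ℕ.+ n ℕ.* 3)
evenIndex k n = oddIndex k (2 ℕ.+ n ℕ.* 3)

-- The factor 8 clears the denominator of the offset: 8 times an index, minus 1, is a power of 3
-- times 8n + 5 or 8n + 7.
oddIndex-spec : ∀ k n → oddIndex k n ℕ.* 8 ≡ 3 ℕ.^ (1 ℕ.+ 2 ℕ.* k) ℕ.* (8 ℕ.* n ℕ.+ 5) ℕ.+ 1
evenIndex-spec : ∀ k n → evenIndex k n ℕ.* 8 ≡ 3 ℕ.^ (2 ℕ.+ 2 ℕ.* k) ℕ.* (8 ℕ.* n ℕ.+ 7) ℕ.+ 1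
oddIndex-spec zero n = lemma n
  where
  lemma : ∀ n → (2 ℕ.+ n ℕ.* 3) ℕ.* 8 ≡ 3 ℕ.* (8 ℕ.* n ℕ.+ 5) ℕ.+ 1
  lemma = ℕ-Solver.solve-∀
oddIndex-spec (suc k) n = ≡.trans (evenIndex-spec k (1 ℕ.+ n ℕ.* 3))
  (≡.trans (lemma (3 ℕ.^ (2 ℕ.* k)) n) (≡.cong (λ e → 3 ℕ.^ suc e ℕ.* (8 ℕ.* n ℕ.+ 5) ℕ.+ 1) (≡.sym (ℕₚ.*-suc 2 k))))
  where
  lemma : ∀ t n → 3 ℕ.* (3 ℕ.* t) ℕ.* (8 ℕ.* (1 ℕ.+ n ℕ.* 3) ℕ.+ 7) ℕ.+ 1 ≡ 3 ℕ.* (3 ℕ.* (3 ℕ.* t)) ℕ.* (8 ℕ.* n ℕ.+ 5) ℕ.+ 1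
  lemma = ℕ-Solver.solve-∀
evenIndex-spec k n = ≡.trans (oddIndex-spec k (2 ℕ.+ n ℕ.* 3)) (lemma (3 ℕ.^ (2 ℕ.* k)) n)
  where
  lemma : ∀ t n → 3 ℕ.* t ℕ.* (8 ℕ.* (2 ℕ.+ n ℕ.* 3) ℕ.+ 5) ℕ.+ 1 ≡ 3 ℕ.* (3 ℕ.* t) ℕ.* (8 ℕ.* n ℕ.+ 7) ℕ.+ 1
  lemma = ℕ-Solver.solve-∀

-- Dividing the whole equation by 8 spares a separate proof that 8 divides d.
solve-index : ∀ i c d → i ℕ.* 8 ≡ c ℕ.* 8 ℕ.+ d → i ≡ c ℕ.+ d / 8
solve-index i c d eq = ≡.trans (≡.sym (m*n/n≡m i 8)) (≡.trans (≡.cong (_/ 8) eq)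
  (≡.trans (+-distrib-/-∣ˡ d (ℕ∣.divides c ≡.refl)) (≡.cong (ℕ._+ d / 8) (m*n/n≡m c 8))))

module Congruences (R : CommutativeRing 0ℓ 0ℓ)
  (ω : CommutativeRing.Carrier R)
  (ω-root : PrimitiveCubeRoots.Root R ω)
  where
  private
    module R = CommutativeRing R
    module Rₙ = IntegerSolver R
  open PowerSeries R
  open Dissection R
  open Coefficients R
  open EulerProduct R
  open LatticeSum R ω ω-root
  open EtaQuotients R E P EP≈1 using (b)
  open CommutativeRing ring[[X]] hiding (zero)
  open IntegerSolver ring[[X]]

  module _
    (2-cancel : ∀ x y → Rₙ.nat 2 R.* x R.≈ Rₙ.nat 2 R.* y → x R.≈ y)
    (3-cancel : ∀ x y → Rₙ.nat 3 R.* x R.≈ Rₙ.nat 3 R.* y → x R.≈ y)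
    (nat-∣ : ∀ m d x → Rₙ.nat m R.≈ Rₙ.nat d R.* x → d ℕ∣.∣ m)
    where

    a : Carrier
    a n = Rₙ.nat (θ n)

    a₁ : ∀ n → a (1 ℕ.+ n ℕ.* 3) R.≈ R.- (Rₙ.nat 2 R.* b (1 ℕ.+ n ℕ.* 3))
    a₁ n = R.trans (Rₙ.solve 1 (λ t → t Rₙ.:= Rₙ.:- ((Rₙ.:- Rₙ.:nat 1) Rₙ.:* t)) R.refl (a m))
      (R.-‿cong (R.trans (R.sym (lattice-symmetrised m (R.- R.1#) (λ i j → c-1 m i j n))) (R.*-congˡ (at lattice≈b m))))
      where m = 1 ℕ.+ n ℕ.* 3

    b₀ : ∀ n → b (n ℕ.* 3) R.≈ a n
    b₀ n = R.trans (R.sym (at lattice≈b m))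
      (R.trans (2-cancel _ _ (lattice-symmetrised m (Rₙ.nat 2) (λ i j → c-0 m i j n))) (R.reflexive (≡.cong Rₙ.nat (θ-triple n))))
      where m = n ℕ.* 3

    b-at-1 : b 1 R.≈ R.- Rₙ.nat 3
    b-at-1 = R.trans (R.sym (at lattice≈b 1)) (2-cancel _ _ (R.trans (lattice-symmetrised 1 (R.- R.1#) (λ i j → c-1 1 i j 0))
      -- `θ 1` evaluates to 6, the number of units of ℤ[ω]; hence 2 b(1) = -6.
      (Rₙ.solve 0 ((Rₙ.:- Rₙ.:nat 1) Rₙ.:* Rₙ.:nat 6 Rₙ.:= Rₙ.:nat 2 Rₙ.:* (Rₙ.:- Rₙ.:nat 3)) R.refl)))

    open CubicTheta.Identities R E P EP≈1 ω ω-root 3-cancel R.refl R.refl (Norm.norm ω ω-root)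
      a (λ n → R.reflexive (≡.cong Rₙ.nat (θ-triple n))) a₁ θ-2mod3
      b₀ (λ n → R.trans (R.sym (at lattice≈b (2 ℕ.+ n ℕ.* 3))) (lattice-2mod3 n)) b-at-1
      using (a-dissection; b-dissection; a³≈b³+27ql³)
    oddSeries evenSeries : ℕ → Carrier
    oddSeries k n = Rₙ.nat (cφ3 (oddIndex k n))
    evenSeries k n = Rₙ.nat (cφ3 (evenIndex k n))

    open Descent.Steps R E P EP≈1 (nat-cancel 3 3-cancel) a a-dissection b-dissection a³≈b³+27ql³
      using (odd-multiple; even-multiple; U₁-odd-multiple; U₂-even-multiple)

    Multiple : ℕ → Carrier → Set
    Multiple d F = ∃ λ f → F ≈ nat d * f

    multiple-∣ : ∀ d (i : ℕ → ℕ) → Multiple d (λ n → Rₙ.nat (cφ3 (i n))) → ∀ n → d ℕ∣.∣ cφ3 (i n)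
    multiple-∣ d i (f , eq) n = nat-∣ (cφ3 (i n)) d (f n) (R.trans (at eq n) (nat*-at d f n))

    odd-zero : oddSeries 0 ≈ U 2 (a * (P * P * P))
    odd-zero .at n = nat-cφ3 (2 ℕ.+ n ℕ.* 3)

    odd-∣ : ∀ k n → 3 ℕ.^ (5 ℕ.* k ℕ.+ 3) ℕ∣.∣ cφ3 (oddIndex k n)
    odd-∣ k = multiple-∣ (3 ℕ.^ (5 ℕ.* k ℕ.+ 3)) (oddIndex k)
      (odd-multiple oddSeries evenSeries odd-zero (λ _ → refl) (λ _ → refl) k)

    even-∣ : ∀ k n → 3 ℕ.^ (5 ℕ.* k ℕ.+ 7) ℕ∣.∣ cφ3 (evenIndex k n)
    even-∣ k = multiple-∣ (3 ℕ.^ (5 ℕ.* k ℕ.+ 7)) (evenIndex k)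
      (even-multiple oddSeries evenSeries odd-zero (λ _ → refl) (λ _ → refl) k)

    odd-extra-∣ : ∀ k n → 3 ℕ.^ (5 ℕ.* k ℕ.+ 5) ℕ∣.∣ cφ3 (oddIndex k (1 ℕ.+ n ℕ.* 3))
    odd-extra-∣ k = multiple-∣ (3 ℕ.^ (5 ℕ.* k ℕ.+ 5)) (λ n → oddIndex k (1 ℕ.+ n ℕ.* 3))
      (U₁-odd-multiple oddSeries evenSeries odd-zero (λ _ → refl) (λ _ → refl) k)

    even-extra-∣ : ∀ k n → 3 ℕ.^ (5 ℕ.* k ℕ.+ 9) ℕ∣.∣ cφ3 (evenIndex k (2 ℕ.+ n ℕ.* 3))
    even-extra-∣ k = multiple-∣ (3 ℕ.^ (5 ℕ.* k ℕ.+ 9)) (λ n → evenIndex k (2 ℕ.+ n ℕ.* 3))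
      (U₂-even-multiple oddSeries evenSeries odd-zero (λ _ → refl) (λ _ → refl) k)

-- ℤ[ω] with ω² = − 1 − ω, the pair (x , y) standing for x + y ω.
module Eisenstein where
  Carrier : Set
  Carrier = ℤ × ℤ

  neg : Carrier → Carrier
  neg (x , y) = ℤ.- x , ℤ.- y

  infixl 6 _+_
  infixl 7 _*_
  _+_ _*_ : Carrier → Carrier → Carrier
  (x , y) + (x′ , y′) = x ℤ.+ x′ , y ℤ.+ y′
  (x , y) * (x′ , y′) = x ℤ.* x′ ℤ.- y ℤ.* y′ , x ℤ.* y′ ℤ.+ y ℤ.* x′ ℤ.- y ℤ.* y′

  *-comm : ∀ u v → u * v ≡ v * u
  *-comm (x , y) (x′ , y′) = ≡.cong₂ _,_ (lemma₁ x y x′ y′) (lemma₂ x y x′ y′)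
    where
    lemma₁ : ∀ x y x′ y′ → x ℤ.* x′ ℤ.- y ℤ.* y′ ≡ x′ ℤ.* x ℤ.- y′ ℤ.* y
    lemma₁ = solve-∀
    lemma₂ : ∀ x y x′ y′ → x ℤ.* y′ ℤ.+ y ℤ.* x′ ℤ.- y ℤ.* y′ ≡ x′ ℤ.* y ℤ.+ y′ ℤ.* x ℤ.- y′ ℤ.* y
    lemma₂ = solve-∀

  *-assoc : ∀ u v w → (u * v) * w ≡ u * (v * w)
  *-assoc (x , y) (x′ , y′) (x″ , y″) = ≡.cong₂ _,_ (lemma₁ x y x′ y′ x″ y″) (lemma₂ x y x′ y′ x″ y″)
    where
    lemma₁ : ∀ x y x′ y′ x″ y″ → (x ℤ.* x′ ℤ.- y ℤ.* y′) ℤ.* x″ ℤ.- (x ℤ.* y′ ℤ.+ y ℤ.* x′ ℤ.- y ℤ.* y′) ℤ.* y″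
                               ≡ x ℤ.* (x′ ℤ.* x″ ℤ.- y′ ℤ.* y″) ℤ.- y ℤ.* (x′ ℤ.* y″ ℤ.+ y′ ℤ.* x″ ℤ.- y′ ℤ.* y″)
    lemma₁ = solve-∀
    lemma₂ : ∀ x y x′ y′ x″ y″ → (x ℤ.* x′ ℤ.- y ℤ.* y′) ℤ.* y″ ℤ.+ (x ℤ.* y′ ℤ.+ y ℤ.* x′ ℤ.- y ℤ.* y′) ℤ.* x″ ℤ.- (x ℤ.* y′ ℤ.+ y ℤ.* x′ ℤ.- y ℤ.* y′) ℤ.* y″
                               ≡ x ℤ.* (x′ ℤ.* y″ ℤ.+ y′ ℤ.* x″ ℤ.- y′ ℤ.* y″) ℤ.+ y ℤ.* (x′ ℤ.* x″ ℤ.- y′ ℤ.* y″) ℤ.- y ℤ.* (x′ ℤ.* y″ ℤ.+ y′ ℤ.* x″ ℤ.- y′ ℤ.* y″)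
    lemma₂ = solve-∀

  *-identityˡ : ∀ u → (+ 1 , + 0) * u ≡ u
  *-identityˡ (x , y) = ≡.cong₂ _,_ (lemma₁ x y) (lemma₂ x y)
    where
    lemma₁ : ∀ x y → + 1 ℤ.* x ℤ.- + 0 ℤ.* y ≡ x
    lemma₁ = solve-∀
    lemma₂ : ∀ x y → + 1 ℤ.* y ℤ.+ + 0 ℤ.* x ℤ.- + 0 ℤ.* y ≡ y
    lemma₂ = solve-∀

  distribˡ : ∀ u v w → u * (v + w) ≡ u * v + u * w
  distribˡ (x , y) (x′ , y′) (x″ , y″) = ≡.cong₂ _,_ (lemma₁ x y x′ y′ x″ y″) (lemma₂ x y x′ y′ x″ y″)
    where
    lemma₁ : ∀ x y x′ y′ x″ y″ → x ℤ.* (x′ ℤ.+ x″) ℤ.- y ℤ.* (y′ ℤ.+ y″) ≡ (x ℤ.* x′ ℤ.- y ℤ.* y′) ℤ.+ (x ℤ.* x″ ℤ.- y ℤ.* y″)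
    lemma₁ = solve-∀
    lemma₂ : ∀ x y x′ y′ x″ y″ → x ℤ.* (y′ ℤ.+ y″) ℤ.+ y ℤ.* (x′ ℤ.+ x″) ℤ.- y ℤ.* (y′ ℤ.+ y″)
                               ≡ (x ℤ.* y′ ℤ.+ y ℤ.* x′ ℤ.- y ℤ.* y′) ℤ.+ (x ℤ.* y″ ℤ.+ y ℤ.* x″ ℤ.- y ℤ.* y″)
    lemma₂ = solve-∀

  ring : CommutativeRing 0ℓ 0ℓ
  ring = record
    { Carrier = Carrier
    ; _≈_ = _≡_
    ; _+_ = _+_
    ; _*_ = _*_
    ; -_ = neg
    ; 0# = + 0 , + 0
    ; 1# = + 1 , + 0
    ; isCommutativeRing = record
      { isRing = record
        { +-isAbelianGroup = record
          { isGroup = record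
            { isMonoid = record
              { isSemigroup = record
                { isMagma = record { isEquivalence = ≡.isEquivalence ; ∙-cong = ≡.cong₂ _+_ }
                ; assoc = λ (x , y) (x′ , y′) (x″ , y″) → ≡.cong₂ _,_ (ℤₚ.+-assoc x x′ x″) (ℤₚ.+-assoc y y′ y″)
                }
              ; identity = (λ (x , y) → ≡.cong₂ _,_ (ℤₚ.+-identityˡ x) (ℤₚ.+-identityˡ y))
                         , (λ (x , y) → ≡.cong₂ _,_ (ℤₚ.+-identityʳ x) (ℤₚ.+-identityʳ y))
              }
            ; inverse = (λ (x , y) → ≡.cong₂ _,_ (ℤₚ.+-inverseˡ x) (ℤₚ.+-inverseˡ y))
                      , (λ (x , y) → ≡.cong₂ _,_ (ℤₚ.+-inverseʳ x) (ℤₚ.+-inverseʳ y))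
            ; ⁻¹-cong = ≡.cong neg
            }
          ; comm = λ (x , y) (x′ , y′) → ≡.cong₂ _,_ (ℤₚ.+-comm x x′) (ℤₚ.+-comm y y′)
          }
        ; *-cong = ≡.cong₂ _*_
        ; *-assoc = *-assoc
        ; *-identity = *-identityˡ , (λ u → ≡.trans (*-comm u _) (*-identityˡ u))
        ; distrib = distribˡ
                  , (λ u v w → ≡.trans (*-comm (v + w) u) (≡.trans (distribˡ u v w) (≡.cong₂ _+_ (*-comm u v) (*-comm u w))))
        }
      ; *-comm = *-comm
      }
    }

  open IntegerSolver ring using (nat; nat-suc)

  nat≡ : ∀ n → nat n ≡ (+ n , + 0)
  nat≡ zero    = ≡.refl
  nat≡ (suc n) = ≡.trans (nat-suc n) (≡.cong (λ u → (+ 1 , + 0) + u) (nat≡ n))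

  nat-* : ∀ n u → nat n * u ≡ (+ n ℤ.* proj₁ u , + n ℤ.* proj₂ u)
  nat-* n (x , y) = ≡.trans (≡.cong (_* (x , y)) (nat≡ n)) (≡.cong₂ _,_ (lemma₁ (+ n) x y) (lemma₂ (+ n) x y))
    where
    lemma₁ : ∀ n x y → n ℤ.* x ℤ.- + 0 ℤ.* y ≡ n ℤ.* x
    lemma₁ = solve-∀
    lemma₂ : ∀ n x y → n ℤ.* y ℤ.+ + 0 ℤ.* x ℤ.- + 0 ℤ.* y ≡ n ℤ.* y
    lemma₂ = solve-∀

  nat-cancel : ∀ n → .⦃ ℕ.NonZero n ⦄ → ∀ u v → nat n * u ≡ nat n * v → u ≡ v
  nat-cancel n@(suc _) u v eq = ≡.cong₂ _,_ (ℤₚ.*-cancelˡ-≡ (+ n) _ _ (≡.cong proj₁ eq′)) (ℤₚ.*-cancelˡ-≡ (+ n) _ _ (≡.cong proj₂ eq′))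
    where
    eq′ : (+ n ℤ.* proj₁ u , + n ℤ.* proj₂ u) ≡ (+ n ℤ.* proj₁ v , + n ℤ.* proj₂ v)
    eq′ = ≡.trans (≡.sym (nat-* n u)) (≡.trans eq (nat-* n v))

  -- Divisibility descends from ℤ[ω] to ℤ through the first coordinate.
  nat-∣ : ∀ m d u → nat m ≡ nat d * u → d ℕ∣.∣ m
  nat-∣ m d u eq = ℤ∣.∣⇒∣ᵤ {+ d} {+ m} (ℤ∣.divides (proj₁ u)
    (≡.trans (≡.cong proj₁ (≡.trans (≡.sym (nat≡ m)) (≡.trans eq (nat-* d u)))) (ℤₚ.*-comm (+ d) (proj₁ u))))

-- The pair is ω itself, and 1 + ω + ω² = 0 holds by evaluation.
open Congruences Eisenstein.ring (+ 0 , + 1) ≡.refl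

weaken : ∀ e i {m} → 3 ℕ.^ (e ℕ.+ i) ℕ∣.∣ m → 3 ℕ.^ e ℕ∣.∣ m
weaken e i = ℕ∣.∣-trans (≡.subst (3 ℕ.^ e ℕ∣.∣_) (≡.sym (ℕₚ.^-distribˡ-+-* 3 e i)) (ℕ∣.m∣m*n (3 ℕ.^ i)))

open import Data.Nat using (_+_; _*_; _^_; _≤_)
open import Data.Nat.Divisibility using (_∣_)

divisible-at : ∀ i c d e {e′} r → e′ ≡ e + r → i * 8 ≡ c * 8 + d → 3 ^ e′ ∣ cφ3 i → 3 ^ e ∣ cφ3 (c + d / 8)
divisible-at i c d e r ≡.refl eq 3ᵉ′∣ = ≡.subst (λ j → 3 ^ e ∣ cφ3 j) (solve-index i c d eq) (weaken e r 3ᵉ′∣)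

-- For k = 3 + i all four proved exponents exceed the claimed ones by exactly i, so they coincide at
-- k = 3. `evenIndex` is taken at k - 1, where its modulus is 3^(2k).
congruences : (i n : ℕ) → let k = 3 + i in
    (3 ^ (4 * k + 5) ∣ cφ3 (3 ^ (2 * k) * n + (7 * 3 ^ (2 * k) + 1) / 8)) ×
    (3 ^ (4 * k + 6) ∣ cφ3 (3 ^ (2 * k + 1) * n + (5 * 3 ^ (2 * k + 1) + 1) / 8)) ×
    (3 ^ (4 * k + 7) ∣ cφ3 (3 ^ (2 * k + 1) * n + (23 * 3 ^ (2 * k) + 1) / 8)) ×
    (3 ^ (4 * k + 8) ∣ cφ3 (3 ^ (2 * k + 2) * n + (13 * 3 ^ (2 * k + 1) + 1) / 8))
congruences i n =
    divisible-at (evenIndex (2 + i) n) (t * n) (7 * t + 1) (4 * k + 5) i (exp₁ i)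
      (≡.trans (even n) (index₁ t n)) (even-∣ c₂ c₃ d (2 + i) n)
  , divisible-at (oddIndex (3 + i) n) (3 ^ (2 * k + 1) * n) (5 * 3 ^ (2 * k + 1) + 1) (4 * k + 6) i (exp₂ i)
      (≡.trans (odd n) (≡.trans (index₂ t n) (≡.cong (λ s → s * n * 8 + (5 * s + 1)) (≡.sym 3t))))
      (odd-∣ c₂ c₃ d (3 + i) n)
  , divisible-at (evenIndex (2 + i) (2 + n * 3)) (3 ^ (2 * k + 1) * n) (23 * t + 1) (4 * k + 7) i (exp₃ i)
      (≡.trans (even (2 + n * 3)) (≡.trans (index₃ t n) (≡.cong (λ s → s * n * 8 + (23 * t + 1)) (≡.sym 3t))))
      (even-extra-∣ c₂ c₃ d (2 + i) n)
  , divisible-at (oddIndex (3 + i) (1 + n * 3)) (3 ^ (2 * k + 2) * n) (13 * 3 ^ (2 * k + 1) + 1) (4 * k + 8) i (exp₄ i)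
      (≡.trans (odd (1 + n * 3)) (≡.trans (index₄ t n)
        (≡.cong₂ (λ s s′ → s * n * 8 + (13 * s′ + 1)) (≡.sym 9t) (≡.sym 3t))))
      (odd-extra-∣ c₂ c₃ d (3 + i) n)
  where
  c₂ = Eisenstein.nat-cancel 2
  c₃ = Eisenstein.nat-cancel 3
  d  = Eisenstein.nat-∣
  k t : ℕ
  k = 3 + i
  t = 3 ^ (2 * k)
  3t : 3 ^ (2 * k + 1) ≡ 3 * t
  3t = ≡.cong (3 ^_) (ℕₚ.+-comm (2 * k) 1)
  9t : 3 ^ (2 * k + 2) ≡ 3 * (3 * t)
  9t = ≡.cong (3 ^_) (ℕₚ.+-comm (2 * k) 2)
  even : ∀ n → evenIndex (2 + i) n * 8 ≡ t * (8 * n + 7) + 1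
  even n = ≡.trans (evenIndex-spec (2 + i) n) (≡.cong (λ e → 3 ^ e * (8 * n + 7) + 1) (≡.sym (ℕₚ.*-suc 2 (2 + i))))
  odd : ∀ n → oddIndex (3 + i) n * 8 ≡ 3 * t * (8 * n + 5) + 1
  odd = oddIndex-spec (3 + i)
  exp₁ : ∀ i → 5 * (2 + i) + 7 ≡ 4 * (3 + i) + 5 + i
  exp₁ = ℕ-Solver.solve-∀
  exp₂ : ∀ i → 5 * (3 + i) + 3 ≡ 4 * (3 + i) + 6 + i
  exp₂ = ℕ-Solver.solve-∀
  exp₃ : ∀ i → 5 * (2 + i) + 9 ≡ 4 * (3 + i) + 7 + i
  exp₃ = ℕ-Solver.solve-∀
  exp₄ : ∀ i → 5 * (3 + i) + 5 ≡ 4 * (3 + i) + 8 + i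
  exp₄ = ℕ-Solver.solve-∀
  index₁ : ∀ t n → t * (8 * n + 7) + 1 ≡ t * n * 8 + (7 * t + 1)
  index₁ = ℕ-Solver.solve-∀
  index₂ : ∀ t n → 3 * t * (8 * n + 5) + 1 ≡ 3 * t * n * 8 + (5 * (3 * t) + 1)
  index₂ = ℕ-Solver.solve-∀
  index₃ : ∀ t n → t * (8 * (2 + n * 3) + 7) + 1 ≡ 3 * t * n * 8 + (23 * t + 1)
  index₃ = ℕ-Solver.solve-∀
  index₄ : ∀ t n → 3 * t * (8 * (1 + n * 3) + 5) + 1 ≡ 3 * (3 * t) * n * 8 + (13 * (3 * t) + 1)
  index₄ = ℕ-Solver.solve-∀

theorem1p2 : (k : ℕ) → 3 ≤ k → (n : ℕ) →
    (3 ^ (4 * k + 5) ∣ cφ3 (3 ^ (2 * k) * n + (7 * 3 ^ (2 * k) + 1) / 8)) ×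
    (3 ^ (4 * k + 6) ∣ cφ3 (3 ^ (2 * k + 1) * n + (5 * 3 ^ (2 * k + 1) + 1) / 8)) ×
    (3 ^ (4 * k + 7) ∣ cφ3 (3 ^ (2 * k + 1) * n + (23 * 3 ^ (2 * k) + 1) / 8)) ×
    (3 ^ (4 * k + 8) ∣ cφ3 (3 ^ (2 * k + 2) * n + (13 * 3 ^ (2 * k + 1) + 1) / 8))
theorem1p2 k 3≤k n =
  let i , 3+i≡k = ℕₚ.m≤n⇒∃[o]m+o≡n 3≤k
  in ≡.subst (λ k →
    (3 ^ (4 * k + 5) ∣ cφ3 (3 ^ (2 * k) * n + (7 * 3 ^ (2 * k) + 1) / 8)) ×
    (3 ^ (4 * k + 6) ∣ cφ3 (3 ^ (2 * k + 1) * n + (5 * 3 ^ (2 * k + 1) + 1) / 8)) ×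
    (3 ^ (4 * k + 7) ∣ cφ3 (3 ^ (2 * k + 1) * n + (23 * 3 ^ (2 * k) + 1) / 8)) ×
    (3 ^ (4 * k + 8) ∣ cφ3 (3 ^ (2 * k + 2) * n + (13 * 3 ^ (2 * k + 1) + 1) / 8))) 3+i≡k (congruences i n)
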